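{- Fix a nonnegative integer $n$. Consider the formal power series in $X,Y,Z$ with coefficients in $\mathbb{Q}[x,y,z]$ $$f(X,Y,Z)=(1+X+Y+Z)^{\frac{n+x+y+z}4}(1+X-Y-Z)^{\frac{n+x-y-z}4}(1-X+Y-Z)^{\frac{n-x+y-z}4}(1-X-Y+Z)^{\frac{n-x-y+z}4},$$ where $(1+u)^{\alpha}=\sum_{k\ge0}\binom{\alpha}{k}u^k$ with $\binom{\alpha}{k}=\alpha(\alpha-1)\cdots(\alpha-k+1)/k!$. Then for all nonnegative integers $r_1,r_2,r_3$ with $r_1+r_2+r_3\le n$, the coefficient of $X^{r_1}Y^{r_2}Z^{r_3}$ in $f$ equals $P^{r_1,r_2,r_3}(x,y,z)$.
   Context: The $n$-cube $H^n$ has as vertices the binary words of length $n$, adjacent iff they differ in exactly one position; $d$ is the graph distance. An equitable partition is an ordered partition $C=(C_1,\dots,C_m)$ of the vertex set such that every vertex of $C_i$ has the same number $S_{ij}$ of neighbours in $C_j$; $S=(S_{ij})$ is the quotient matrix. $T^{r_1,r_2,r_3}$ is the row vector of length $m^3$ indexed by $(i,j,k)$ with $T^{r_1,r_2,r_3}_{ijk}$ the number of vertex triples $(v,x,y)$, $v\in C_i,x\in C_j,y\in C_k$, with $d(x,y)=r_2+r_3$, $d(v,y)=r_1+r_3$, $d(v,x)=r_1+r_2$. $S'=S\otimes I\otimes I$, $S''=I\otimes S\otimes I$, $S'''=I\otimes I\otimes S$ act on row vectors by $(US')_{ijk}=\sum_t U_{tjk}S_{ti}$, $(US'')_{ijk}=\sum_t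 U_{itk}S_{tj}$, $(US''')_{ijk}=\sum_t U_{ijt}S_{tk}$ (they pairwise commute). For $r_1+r_2+r_3\le n$, $P^{r_1,r_2,r_3}(x,y,z)$ denotes the unique polynomial of degree at most $r_1+r_2+r_3$ such that $T^{r_1,r_2,r_3}=T^{0,0,0}P^{r_1,r_2,r_3}(S',S'',S''')$ for every equitable partition of $H^n$. -}

module Defs where

open import Data.Bool using (Bool; true; false; _∧_; if_then_else_)
open import Data.Nat as ℕ using (ℕ; zero; suc; _∸_; _≤_; _<_; _!)
open import Data.Nat.Properties using (_!≢0)
open import Data.Fin using (Fin)
open import Data.Fin.Properties using () renaming (_≟_ to _≟ᶠ_)
open import Data.Vec using (Vec; []; _∷_)
open import Data.List using (List; []; _∷_; map; concatMap; foldr; upTo; length; filterᵇ; allFin)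
open import Data.Integer using (ℤ; +_; -[1+_])
open import Data.Rational using (ℚ; 0ℚ; 1ℚ; _+_; _*_; -_; _/_)
open import Data.Product using (_×_; ∃)
open import Relation.Nullary.Decidable using (⌊_⌋)
open import Relation.Binary.PropositionalEquality using (_≡_)

module _ {A : Set} (_⊕_ : A → A → A) (o : A) where
  sumL : List A → A
  sumL = foldr _⊕_ o

  sumTo : ℕ → (ℕ → A) → A
  sumTo a f = sumL (map f (upTo (suc a)))

  conv3 : (A → A → A) → (ℕ → ℕ → ℕ → A) → (ℕ → ℕ → ℕ → A) → ℕ → ℕ → ℕ → A
  conv3 _⊗_ p q a b c =
    sumTo a λ i → sumTo b λ j → sumTo c λ k →
      p i j k ⊗ q (a ∸ i) (b ∸ j) (c ∸ k)

-- Polynomials (formal power series) in x, y, z over ℚ: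
-- p a b c = coefficient of x^a y^b z^c.

Poly3 : Set
Poly3 = ℕ → ℕ → ℕ → ℚ

0ₚ : Poly3
0ₚ _ _ _ = 0ℚ

_+ₚ_ : Poly3 → Poly3 → Poly3
(p +ₚ q) a b c = p a b c + q a b c

_*ₚ_ : Poly3 → Poly3 → Poly3
_*ₚ_ = conv3 _+_ 0ℚ _*_

monₚ : ℚ → ℕ → ℕ → ℕ → Poly3
monₚ q a b c i j k = if (a ℕ.≡ᵇ i) ∧ (b ℕ.≡ᵇ j) ∧ (c ℕ.≡ᵇ k) then q else 0ℚ

constₚ : ℚ → Poly3
constₚ q = monₚ q 0 0 0

DegreeAtMost : ℕ → Poly3 → Set
DegreeAtMost d p = ∀ a b c → d < a ℕ.+ b ℕ.+ c → p a b c ≡ 0ℚ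

-- Formal power series in X, Y, Z with coefficients in ℚ[x,y,z]:
-- s a b c = coefficient of X^a Y^b Z^c.

Ser : Set
Ser = ℕ → ℕ → ℕ → Poly3

0ₛ : Ser
0ₛ _ _ _ = 0ₚ

_+ₛ_ : Ser → Ser → Ser
(s +ₛ t) a b c = s a b c +ₚ t a b c

_*ₛ_ : Ser → Ser → Ser
_*ₛ_ = conv3 _+ₚ_ 0ₚ _*ₚ_

monₛ : Poly3 → ℕ → ℕ → ℕ → Ser
monₛ p a b c i j k = if (a ℕ.≡ᵇ i) ∧ (b ℕ.≡ᵇ j) ∧ (c ℕ.≡ᵇ k) then p else 0ₚ

1ₛ : Ser
1ₛ = monₛ (constₚ 1ℚ) 0 0 0

_^ₛ_ : Ser → ℕ → Ser
s ^ₛ zero  = 1ₛ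
s ^ₛ suc k = s *ₛ (s ^ₛ k)

_·ₛ_ : Poly3 → Ser → Ser
(p ·ₛ s) a b c = p *ₚ s a b c

falling : Poly3 → ℕ → Poly3
falling α zero    = constₚ 1ℚ
falling α (suc k) = falling α k *ₚ (α +ₚ constₚ (- (+ k / 1)))

binomₚ : Poly3 → ℕ → Poly3
binomₚ α k = constₚ (_/_ (+ 1) (k !) {{k !≢0}}) *ₚ falling α k

-- (1+u)^α = Σ_{k≥0} binom(α,k) u^k, for u a series with no constant term
-- in X,Y,Z.  The coefficient of X^a Y^b Z^c only receives contributions
-- from k ≤ a+b+c (u^k has X,Y,Z-order ≥ k), so it is computed as the
-- coefficient of the finite partial sum up to k = a+b+c.
binSeries : Poly3 → Ser → Ser
binSeries α u a b c =
  sumTo _+ₛ_ 0ₛ (a ℕ.+ b ℕ.+ c) (λ k → binomₚ α k ·ₛ (u ^ₛ k)) a b c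

expo : ℕ → ℤ → ℤ → ℤ → Poly3
expo n e₁ e₂ e₃ =
  constₚ (+ n / 4) +ₚ (monₚ (e₁ / 4) 1 0 0 +ₚ (monₚ (e₂ / 4) 0 1 0 +ₚ monₚ (e₃ / 4) 0 0 1))

base : ℤ → ℤ → ℤ → Ser
base e₁ e₂ e₃ =
  monₛ (constₚ (e₁ / 1)) 1 0 0 +ₛ (monₛ (constₚ (e₂ / 1)) 0 1 0 +ₛ monₛ (constₚ (e₃ / 1)) 0 0 1)

factor : ℕ → ℤ → ℤ → ℤ → Ser
factor n e₁ e₂ e₃ = binSeries (expo n e₁ e₂ e₃) (base e₁ e₂ e₃)

pos neg : ℤ
pos = + 1
neg = -[1+ 0 ]

fSeries : ℕ → Ser
fSeries n =
  factor n pos pos pos *ₛ (factor n pos neg neg *ₛ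
  (factor n neg pos neg *ₛ factor n neg neg pos))

Vertex : ℕ → Set
Vertex n = Vec Bool n

allVertices : (n : ℕ) → List (Vertex n)
allVertices zero    = [] ∷ []
allVertices (suc n) = concatMap (λ v → (false ∷ v) ∷ (true ∷ v) ∷ []) (allVertices n)

differ : Bool → Bool → Bool
differ false false = false
differ true  true  = false
differ _     _     = true

dist : ∀ {n} → Vertex n → Vertex n → ℕ
dist []       []       = 0
dist (a ∷ v) (b ∷ w) = (if differ a b then 1 else 0) ℕ.+ dist v w

count : {A : Set} → (A → Bool) → List A → ℕ
count p xs = length (filterᵇ p xs)

IsOrderedPartition : ∀ {n m} → (Vertex n → Fin m) → Set
IsOrderedPartition {n} {m} C = ∀ (i : Fin m) → ∃ λ (v : Vertex n) → C v ≡ i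

nbrCount : ∀ {n m} → (Vertex n → Fin m) → Vertex n → Fin m → ℕ
nbrCount {n} C v j = count (λ w → (dist v w ℕ.≡ᵇ 1) ∧ ⌊ C w ≟ᶠ j ⌋) (allVertices n)

IsEquitable : ∀ {n m} → (Vertex n → Fin m) → (Fin m → Fin m → ℕ) → Set
IsEquitable {n} C S = ∀ i j (v : Vertex n) → C v ≡ i → nbrCount C v j ≡ S i j

Tcount : ∀ {n m} → ℕ → ℕ → ℕ → (Vertex n → Fin m) → Fin m → Fin m → Fin m → ℕ
Tcount {n} r₁ r₂ r₃ C i j k =
  sumL ℕ._+_ 0 (map (λ v → sumL ℕ._+_ 0 (map (λ x → count (λ y →
      ⌊ C v ≟ᶠ i ⌋ ∧ ⌊ C x ≟ᶠ j ⌋ ∧ ⌊ C y ≟ᶠ k ⌋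
    ∧ (dist x y ℕ.≡ᵇ (r₂ ℕ.+ r₃)) ∧ (dist v y ℕ.≡ᵇ (r₁ ℕ.+ r₃)) ∧ (dist v x ℕ.≡ᵇ (r₁ ℕ.+ r₂)))
    (allVertices n)) (allVertices n))) (allVertices n))

Vec3 : ℕ → Set
Vec3 m = Fin m → Fin m → Fin m → ℚ

toℚ : ℕ → ℚ
toℚ s = + s / 1

sumFin : ∀ m → (Fin m → ℚ) → ℚ
sumFin m f = sumL _+_ 0ℚ (map f (allFin m))

act₁ : ∀ {m} → (Fin m → Fin m → ℕ) → Vec3 m → Vec3 m
act₁ {m} S U i j k = sumFin m λ t → U t j k * toℚ (S t i)

act₂ : ∀ {m} → (Fin m → Fin m → ℕ) → Vec3 m → Vec3 m
act₂ {m} S U i j k = sumFin m λ t → U i t k * toℚ (S t j)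

act₃ : ∀ {m} → (Fin m → Fin m → ℕ) → Vec3 m → Vec3 m
act₃ {m} S U i j k = sumFin m λ t → U i j t * toℚ (S t k)

iter : {A : Set} → (A → A) → ℕ → A → A
iter f zero    a = a
iter f (suc k) a = f (iter f k a)

-- U · Q(S',S'',S''') for a polynomial Q of degree ≤ d
evalOp : ∀ {m} → (Fin m → Fin m → ℕ) → Poly3 → ℕ → Vec3 m → Vec3 m
evalOp S Q d U i j k =
  sumTo _+_ 0ℚ d λ a → sumTo _+_ 0ℚ d λ b → sumTo _+_ 0ℚ d λ c →
    Q a b c * iter (act₁ S) a (iter (act₂ S) b (iter (act₃ S) c U)) i j k

IsP : ℕ → ℕ → ℕ → ℕ → Poly3 → Set
IsP n r₁ r₂ r₃ Q =
  DegreeAtMost (r₁ ℕ.+ r₂ ℕ.+ r₃) Q ×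
  (∀ (m : ℕ) (C : Vertex n → Fin m) → IsOrderedPartition C →
     ∀ (S : Fin m → Fin m → ℕ) → IsEquitable C S →
     ∀ i j k → toℚ (Tcount r₁ r₂ r₃ C i j k)
             ≡ evalOp S Q (r₁ ℕ.+ r₂ ℕ.+ r₃) (λ i′ j′ k′ → toℚ (Tcount 0 0 0 C i′ j′ k′)) i j k)

{-# OPTIONS --safe #-}
module Submission where

-- Put P = ∂_X + Y∂_Z + Z∂_Y and E = X∂_X + Y∂_Y + Z∂_Z.  For u = e₁X + e₂Y + e₃Z with signs
-- e₁e₂e₃ = 1 one has (P − XE)(1 + u) = (e₁ − X)(1 + u), so (1 + u)^α is an eigenfunction of
-- the derivation P − XE with eigenvalue α(e₁ − X).  The four exponents sum to n and, weighted
-- by e₁, to x; hence x f = (P − XE + nX) f, and symmetrically for y and z.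
-- On the combinatorial side, give a triple of vertices the product over the coordinates of
-- 1, X, Y or Z, according to which of the three bits is the odd one out.  Flipping the bit of
-- v exchanges 1 with X and Y with Z, so summing the weight over the neighbours of v also acts
-- as P − XE + nX; summing over the cells of an equitable partition turns the neighbour sum
-- into the action of S'.  Coefficientwise both equations express (r₁ + 1) times the
-- coefficient at (r₁ + 1, r₂, r₃) through coefficients of degree at most r₁ + r₂ + r₃, which
-- determines everything, including the degree bound, from the constant term.

open import Defs
open import Level using (0ℓ)
open import Algebra.Bundles using (CommutativeMonoid; CommutativeSemiring; CommutativeRing)
import Algebra.Properties.CommutativeMonoid.Mult as MonoidMult
import Algebra.Properties.CommutativeSemigroup as CommutativeSemigroupProperties
open import Algebra.Properties.Group using (∙-cancelʳ)
import Algebra.Properties.Semiring.Exp as SemiringExp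
import Algebra.Properties.Semiring.Mult as SemiringMult
import Algebra.Solver.Ring.NaturalCoefficients.Default as SemiringSolver
open import Algebra.Structures.Biased using (IsCommutativeSemiringˡ)
open import Data.Bool using (Bool; true; false; _∧_; if_then_else_; not; T)
open import Data.Bool.Properties using (T-∧; ∧-comm)
open import Data.Empty using (⊥-elim)
open import Data.Fin using (Fin; zero; suc)
open import Data.Fin.Properties using () renaming (_≟_ to _≟ᶠ_)
open import Data.Integer as ℤ using (ℤ; +_)
import Data.Integer.Properties as ℤ
open import Data.List using (List; []; _∷_; map; concatMap; upTo; allFin; tabulate)
open import Data.List.Properties using (map-applyUpTo; map-tabulate)
open import Data.Nat as ℕ using (ℕ; zero; suc; _∸_; _!)
import Data.Nat.Properties as ℕ
open import Data.Nat.Solver using () renaming (module +-*-Solver to ℕ-Solver)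
open import Data.Product using (_,_)
open import Data.Rational as ℚ using (ℚ; 0ℚ; 1ℚ; _/_; fromℚᵘ)
import Data.Rational.Properties as ℚ
open import Data.Rational.Solver using (module +-*-Solver)
open import Data.Rational.Unnormalised as ℚᵘ using (mkℚᵘ; *≡*)
import Data.Rational.Unnormalised.Properties as ℚᵘ
open import Data.Vec using ([]; _∷_)
open import Function using (_∘_; id; Equivalence)
open import Relation.Binary.PropositionalEquality as ≡ using (_≡_; _≢_)
import Relation.Binary.Reasoning.Setoid as SetoidReasoning
open import Relation.Binary.Structures using (IsEquivalence)
open import Relation.Nullary using (yes; no)
open import Relation.Nullary.Decidable using (⌊_⌋)

-- The operator `P − XE + nX` comes from a homogeneous model. With a fourth variable W for the
-- coordinates at which all three bits agree, the weight of a triple is a monomial of degree n, and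
-- flipping the bits of v acts as X∂_W + W∂_X + Z∂_Y + Y∂_Z. Setting W = 1 and replacing W∂_W by n -
-- E, which is Euler's relation, turns X∂_W into X(n - E). The linear forms W + e₁X + e₂Y + e₃Z with
-- e₁e₂e₃ = 1 are the common eigenvectors of the three flips; their coefficients are the characters
-- of the Klein four-group. The negative term is kept on the other side of each equation. The
-- calculus of series then needs only commutative semirings, and one development serves series over
-- ℚ and series over ℚ[x,y,z]; a relation that respects 0 and sums suffices to compare the two. The
-- obstacle in that comparison is that `evalOp` cuts polynomials off at a fixed degree:
-- multiplication by x becomes the action of S' only below the cutoff. The degree bound on the
-- coefficients of f is therefore established on its own, and the evaluation relies on it.

CSemiring : Set₁
CSemiring = CommutativeSemiring 0ℓ 0ℓ

-- Finite sums and additive maps.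

module Sums (M : CommutativeMonoid 0ℓ 0ℓ) where
  open CommutativeMonoid M
  open CommutativeSemigroupProperties commutativeSemigroup using (interchange)
  open SetoidReasoning setoid

  ∑ : {I : Set} → List I → (I → Carrier) → Carrier
  ∑ xs f = sumL _∙_ ε (map f xs)

  ∑-cong : {I : Set} {f g : I → Carrier} (xs : List I) → (∀ x → f x ≈ g x) → ∑ xs f ≈ ∑ xs g
  ∑-cong []       f≈g = refl
  ∑-cong (x ∷ xs) f≈g = ∙-cong (f≈g x) (∑-cong xs f≈g)

  ∑-ε : {I : Set} (xs : List I) → ∑ xs (λ _ → ε) ≈ ε
  ∑-ε []       = refl
  ∑-ε (x ∷ xs) = trans (identityˡ _) (∑-ε xs)

  ∑-∙ : {I : Set} {f g : I → Carrier} (xs : List I) → ∑ xs (λ x → f x ∙ g x) ≈ ∑ xs f ∙ ∑ xs g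
  ∑-∙ []       = sym (identityˡ _)
  ∑-∙ (x ∷ xs) = trans (∙-congˡ (∑-∙ xs)) (interchange _ _ _ _)

  ∑-swap : {I J : Set} {f : I → J → Carrier} (xs : List I) (ys : List J) →
    ∑ xs (λ x → ∑ ys (f x)) ≈ ∑ ys (λ y → ∑ xs (λ x → f x y))
  ∑-swap []       ys = sym (∑-ε ys)
  ∑-swap (x ∷ xs) ys = trans (∙-congˡ (∑-swap xs ys)) (sym (∑-∙ ys))

  sumTo-suc : ∀ n {f : ℕ → Carrier} → sumTo _∙_ ε (suc n) f ≡ f 0 ∙ sumTo _∙_ ε n (f ∘ suc)
  sumTo-suc n {f} = ≡.cong (λ xs → f 0 ∙ sumL _∙_ ε xs)
    (≡.trans (map-applyUpTo suc f (suc n)) (≡.sym (map-applyUpTo id (f ∘ suc) (suc n))))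

  sumTo-cong : ∀ n {f g : ℕ → Carrier} → (∀ k → f k ≈ g k) → sumTo _∙_ ε n f ≈ sumTo _∙_ ε n g
  sumTo-cong n = ∑-cong (upTo (suc n))

  sumTo³-∙ : ∀ n (f g : ℕ → ℕ → ℕ → Carrier) →
    sumTo _∙_ ε n (λ a → sumTo _∙_ ε n (λ b → sumTo _∙_ ε n (λ c → f a b c ∙ g a b c))) ≈
    sumTo _∙_ ε n (λ a → sumTo _∙_ ε n (λ b → sumTo _∙_ ε n (λ c → f a b c))) ∙
    sumTo _∙_ ε n (λ a → sumTo _∙_ ε n (λ b → sumTo _∙_ ε n (λ c → g a b c)))
  sumTo³-∙ n f g = trans (sumTo-cong n (λ a →
      trans (sumTo-cong n (λ b → ∑-∙ (upTo (suc n)))) (∑-∙ (upTo (suc n)))))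
    (∑-∙ (upTo (suc n)))

  sumTo-head : ∀ n {f : ℕ → Carrier} → (∀ k → f (suc k) ≈ ε) → sumTo _∙_ ε n f ≈ f 0
  sumTo-head zero    f≈0 = identityʳ _
  sumTo-head (suc n) f≈0 = trans (reflexive (sumTo-suc n))
    (trans (∙-congˡ (trans (sumTo-cong n f≈0) (∑-ε (upTo (suc n))))) (identityʳ _))

  -- The upper limit is the same on both sides, so the two sums differ by the last term `g n`, which
  -- has to vanish. This is where a fixed cutoff meets multiplication by a variable.
  sumTo-shift : ∀ n {f g : ℕ → Carrier} → f 0 ≈ ε → (∀ k → f (suc k) ≈ g k) → g n ≈ ε →
    sumTo _∙_ ε n f ≈ sumTo _∙_ ε n g
  sumTo-shift zero    f0 fg gn = ∙-congʳ (trans f0 (sym gn))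
  sumTo-shift (suc n) {f} {g} f0 fg gn = begin
    sumTo _∙_ ε (suc n) f                ≡⟨ sumTo-suc n ⟩
    f 0 ∙ sumTo _∙_ ε n (f ∘ suc)        ≈⟨ ∙-cong f0 (sumTo-cong n fg) ⟩
    ε ∙ sumTo _∙_ ε n g                  ≈⟨ identityˡ _ ⟩
    sumTo _∙_ ε n g                      ≈⟨ sym (dropLast n gn) ⟩
    sumTo _∙_ ε (suc n) g                ∎
    where
    dropLast : ∀ n {g : ℕ → Carrier} → g (suc n) ≈ ε → sumTo _∙_ ε (suc n) g ≈ sumTo _∙_ ε n g
    dropLast zero    gn = ∙-congˡ (trans (identityʳ _) gn)
    dropLast (suc n) gn = trans (reflexive (sumTo-suc (suc n)))
      (trans (∙-congˡ (dropLast n gn)) (sym (reflexive (sumTo-suc n))))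

  sumTo-last : ∀ n {f : ℕ → Carrier} → (∀ k → k ℕ.< n → f k ≈ ε) → sumTo _∙_ ε n f ≈ f n
  sumTo-last zero    z = identityʳ _
  sumTo-last (suc n) z = trans (reflexive (sumTo-suc n))
    (trans (∙-cong (z 0 (ℕ.s≤s ℕ.z≤n)) (sumTo-last n (λ k k<n → z (suc k) (ℕ.s≤s k<n)))) (identityˡ _))

-- Coefficient extraction, both sides of the neighbour identity, evaluation at the quotient matrix
-- and the cast from ℕ to ℚ are all maps of this kind.
record _→⁺_ (M N : CommutativeMonoid 0ℓ 0ℓ) : Set where
  private
    module M = CommutativeMonoid M
    module N = CommutativeMonoid N
  field
    ⟦_⟧    : M.Carrier → N.Carrier
    cong   : ∀ {x y} → x M.≈ y → ⟦ x ⟧ N.≈ ⟦ y ⟧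
    ∙-homo : ∀ x y → ⟦ x M.∙ y ⟧ N.≈ ⟦ x ⟧ N.∙ ⟦ y ⟧
    ε-homo : ⟦ M.ε ⟧ N.≈ N.ε

module Additive {M N : CommutativeMonoid 0ℓ 0ℓ} (φ : M →⁺ N) where
  private
    module M = CommutativeMonoid M
    module N = CommutativeMonoid N
    module ΣM = Sums M
    module ΣN = Sums N
    module ×M = MonoidMult M
    module ×N = MonoidMult N
  open _→⁺_ φ

  ∑-homo : {I : Set} {f : I → M.Carrier} (xs : List I) → ⟦ ΣM.∑ xs f ⟧ N.≈ ΣN.∑ xs (λ x → ⟦ f x ⟧)
  ∑-homo []       = ε-homo
  ∑-homo (x ∷ xs) = N.trans (∙-homo _ _) (N.∙-congˡ (∑-homo xs))

  ×-homo : ∀ n x → ⟦ n ×M.× x ⟧ N.≈ n ×N.× ⟦ x ⟧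
  ×-homo zero    x = ε-homo
  ×-homo (suc n) x = N.trans (∙-homo _ _) (N.∙-congˡ (×-homo n x))

  if-homo : ∀ b x → ⟦ if b then x else M.ε ⟧ N.≈ (if b then ⟦ x ⟧ else N.ε)
  if-homo false x = ε-homo
  if-homo true  x = N.refl

-- In a semiring the Leibniz rule only yields δ 1 = δ 1 + δ 1, from which δ 1 = 0 cannot be
-- cancelled out; that equation is supplied separately wherever it is used.
record Derivation (A : CSemiring) : Set where
  open CommutativeSemiring A
  field
    δ       : Carrier → Carrier
    δ-cong  : ∀ {x y} → x ≈ y → δ x ≈ δ y
    δ-+     : ∀ x y → δ (x + y) ≈ δ x + δ y
    leibniz : ∀ x y → δ (x * y) ≈ δ x * y + x * δ y

-- Formal power series in one variable.

module PowerSeries (R : CSemiring) where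
  open CommutativeSemiring R
  open Sums +-commutativeMonoid
  open CommutativeSemigroupProperties
    (CommutativeMonoid.commutativeSemigroup +-commutativeMonoid) using (interchange; x∙yz≈y∙xz)
  open SemiringMult semiring using (_×_; ×-congʳ; ×-comm-*; ×-assoc-*)
  open MonoidMult +-commutativeMonoid using (×-distrib-+)
  open SetoidReasoning setoid

  PS : Set
  PS = ℕ → Carrier

  infix 4 _≈ᵖ_
  _≈ᵖ_ : PS → PS → Set
  p ≈ᵖ q = ∀ n → p n ≈ q n

  _⊕_ : PS → PS → PS
  (p ⊕ q) n = p n + q n

  -- Recursion on the index, instead of the convolution sum, lets the semiring laws and the Leibniz
  -- rule go by induction with `p ∘ suc` in place of `p`; `⊛-sumTo` recovers the sum.
  _⊛_ : PS → PS → PS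
  (p ⊛ q) zero    = p 0 * q 0
  (p ⊛ q) (suc n) = p 0 * q (suc n) + ((p ∘ suc) ⊛ q) n

  mono : Carrier → ℕ → PS
  mono r m n = if m ℕ.≡ᵇ n then r else 0#

  shift : PS → PS
  shift p zero    = 0#
  shift p (suc n) = p n

  deriv : PS → PS
  deriv p n = suc n × p (suc n)

  ⊛-cong : ∀ {p p′ q q′} → p ≈ᵖ p′ → q ≈ᵖ q′ → p ⊛ q ≈ᵖ p′ ⊛ q′
  ⊛-cong pp qq zero    = *-cong (pp 0) (qq 0)
  ⊛-cong pp qq (suc n) = +-cong (*-cong (pp 0) (qq (suc n))) (⊛-cong (pp ∘ suc) qq n)

  ⊛-zeroˡ : ∀ q → (λ _ → 0#) ⊛ q ≈ᵖ (λ _ → 0#)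
  ⊛-zeroˡ q zero    = zeroˡ _
  ⊛-zeroˡ q (suc n) = trans (+-cong (zeroˡ _) (⊛-zeroˡ q n)) (+-identityˡ _)

  ⊛-distribʳ : ∀ r p q → (p ⊕ q) ⊛ r ≈ᵖ (p ⊛ r) ⊕ (q ⊛ r)
  ⊛-distribʳ r p q zero    = distribʳ _ _ _
  ⊛-distribʳ r p q (suc n) =
    trans (+-cong (distribʳ _ _ _) (⊛-distribʳ r (p ∘ suc) (q ∘ suc) n)) (interchange _ _ _ _)

  ⊛-scale : ∀ c p q → (λ n → c * p n) ⊛ q ≈ᵖ (λ n → c * (p ⊛ q) n)
  ⊛-scale c p q zero    = *-assoc _ _ _
  ⊛-scale c p q (suc n) =
    trans (+-cong (*-assoc _ _ _) (⊛-scale c (p ∘ suc) q n)) (sym (distribˡ _ _ _))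

  -- The definition peels off the lowest coefficient of the left factor; peeling the right factor
  -- instead is what commutativity needs.
  ⊛-sucʳ : ∀ p q n → (p ⊛ q) (suc n) ≈ p (suc n) * q 0 + (p ⊛ (q ∘ suc)) n
  ⊛-sucʳ p q zero    = +-comm _ _
  ⊛-sucʳ p q (suc n) = trans (+-congˡ (⊛-sucʳ (p ∘ suc) q n)) (x∙yz≈y∙xz _ _ _)

  ⊛-comm : ∀ p q → p ⊛ q ≈ᵖ q ⊛ p
  ⊛-comm p q zero    = *-comm _ _
  ⊛-comm p q (suc n) = trans (+-cong (*-comm _ _) (⊛-comm (p ∘ suc) q n)) (sym (⊛-sucʳ q p n))

  ⊛-assoc : ∀ p q r → (p ⊛ q) ⊛ r ≈ᵖ p ⊛ (q ⊛ r)
  ⊛-assoc p q r zero    = *-assoc _ _ _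
  ⊛-assoc p q r (suc n) = begin
    p 0 * q 0 * r (suc n) + (((λ k → p 0 * q (suc k)) ⊕ ((p ∘ suc) ⊛ q)) ⊛ r) n
      ≈⟨ +-cong (*-assoc _ _ _) (⊛-distribʳ r _ _ n) ⟩
    p 0 * (q 0 * r (suc n)) + (((λ k → p 0 * q (suc k)) ⊛ r) n + (((p ∘ suc) ⊛ q) ⊛ r) n)
      ≈⟨ +-congˡ (+-cong (⊛-scale _ _ r n) (⊛-assoc (p ∘ suc) q r n)) ⟩
    p 0 * (q 0 * r (suc n)) + (p 0 * ((q ∘ suc) ⊛ r) n + ((p ∘ suc) ⊛ (q ⊛ r)) n)
      ≈⟨ +-assoc _ _ _ ⟨
    p 0 * (q 0 * r (suc n)) + p 0 * ((q ∘ suc) ⊛ r) n + ((p ∘ suc) ⊛ (q ⊛ r)) n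
      ≈⟨ +-congʳ (distribˡ _ _ _) ⟨
    p 0 * (q ⊛ r) (suc n) + ((p ∘ suc) ⊛ (q ⊛ r)) n ∎

  mono-0 : ∀ r p → mono r 0 ⊛ p ≈ᵖ (λ n → r * p n)
  mono-0 r p zero    = refl
  mono-0 r p (suc n) = trans (+-congˡ (⊛-zeroˡ p n)) (+-identityʳ _)

  mono-1 : ∀ r p → mono r 1 ⊛ p ≈ᵖ shift (λ n → r * p n)
  mono-1 r p zero    = zeroˡ _
  mono-1 r p (suc n) = trans (+-cong (zeroˡ _) (mono-0 r p n)) (+-identityˡ _)

  ⊛-identityˡ : ∀ p → mono 1# 0 ⊛ p ≈ᵖ p
  ⊛-identityˡ p n = trans (mono-0 1# p n) (*-identityˡ _)

  ⊛-sumTo : ∀ p q n → (p ⊛ q) n ≈ sumTo _+_ 0# n (λ i → p i * q (n ∸ i))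
  ⊛-sumTo p q zero    = sym (+-identityʳ _)
  ⊛-sumTo p q (suc n) = trans (+-congˡ (⊛-sumTo (p ∘ suc) q n)) (sym (reflexive (sumTo-suc n)))

  semiringᵖ : CSemiring
  semiringᵖ = record
    { _≈_ = _≈ᵖ_ ; _+_ = _⊕_ ; _*_ = _⊛_ ; 0# = λ _ → 0# ; 1# = mono 1# 0
    ; isCommutativeSemiring = IsCommutativeSemiringˡ.isCommutativeSemiring record
      { +-isCommutativeMonoid = record
        { isMonoid = record
          { isSemigroup = record
            { isMagma = record
              { isEquivalence = ≈ᵖ-equiv
              ; ∙-cong = λ pp qq n → +-cong (pp n) (qq n) }
            ; assoc = λ p q r n → +-assoc _ _ _ }
          ; identity = (λ p n → +-identityˡ _) , (λ p n → +-identityʳ _) }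
        ; comm = λ p q n → +-comm _ _ }
      ; *-isCommutativeMonoid = record
        { isMonoid = record
          { isSemigroup = record
            { isMagma = record
              { isEquivalence = ≈ᵖ-equiv
              ; ∙-cong = ⊛-cong }
            ; assoc = ⊛-assoc }
          ; identity = ⊛-identityˡ
                     , (λ p n → trans (⊛-comm p (mono 1# 0) n) (⊛-identityˡ p n)) }
        ; comm = ⊛-comm }
      ; distribʳ = ⊛-distribʳ
      ; zeroˡ = ⊛-zeroˡ } }
    where
    ≈ᵖ-equiv : IsEquivalence _≈ᵖ_
    ≈ᵖ-equiv = record
      { refl = λ n → refl ; sym = λ e n → sym (e n) ; trans = λ e f n → trans (e n) (f n) }

  -- The factor m + 2 splits as 1 + (m + 1). The m + 1 copies fall to the induction hypothesis for
  -- `p′`, and the single copy makes up the difference between `deriv p` and `deriv p′`, since (k +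
  -- 2) p(k + 2) is `p″ k` plus `deriv p′ k`.
  deriv-leibniz : ∀ p q n → deriv (p ⊛ q) n ≈ (deriv p ⊛ q) n + (p ⊛ deriv q) n
  deriv-leibniz p q zero = begin
    1 × (p 0 * q 1 + p 1 * q 0)         ≈⟨ ×-distrib-+ _ _ 1 ⟩
    1 × (p 0 * q 1) + 1 × (p 1 * q 0)   ≈⟨ +-comm _ _ ⟩
    1 × (p 1 * q 0) + 1 × (p 0 * q 1)   ≈⟨ +-cong (×-assoc-* 1 _ _) (×-comm-* 1 _ _) ⟨
    (1 × p 1) * q 0 + p 0 * (1 × q 1)   ∎
  deriv-leibniz p q (suc m) = begin
    suc (suc m) × (p 0 * q (suc (suc m)) + (p′ ⊛ q) (suc m))
      ≈⟨ ×-distrib-+ _ _ (suc (suc m)) ⟩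
    suc (suc m) × (p 0 * q (suc (suc m))) + ((p′ ⊛ q) (suc m) + suc m × (p′ ⊛ q) (suc m))
      ≈⟨ +-cong (sym (×-comm-* (suc (suc m)) _ _)) (+-congˡ (deriv-leibniz p′ q m)) ⟩
    A + ((p 1 * q (suc m) + (p″ ⊛ q) m) + ((deriv p′ ⊛ q) m + (p′ ⊛ deriv q) m))
      ≈⟨ +-congˡ (trans (sym (+-assoc _ _ _)) (+-congʳ (+-assoc _ _ _))) ⟩
    A + ((p 1 * q (suc m) + ((p″ ⊛ q) m + (deriv p′ ⊛ q) m)) + (p′ ⊛ deriv q) m)
      ≈⟨ x∙yz≈y∙xz _ _ _ ⟩
    (p 1 * q (suc m) + ((p″ ⊛ q) m + (deriv p′ ⊛ q) m)) + (A + (p′ ⊛ deriv q) m)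
      ≈⟨ +-congʳ (+-cong (*-congʳ (+-identityʳ _)) (⊛-distribʳ q p″ (deriv p′) m)) ⟨
    (deriv p ⊛ q) (suc m) + (p ⊛ deriv q) (suc m) ∎
    where
    p′ p″ : PS
    p′ = p ∘ suc
    p″ = p′ ∘ suc
    A : Carrier
    A = p 0 * deriv q (suc m)

  derivation : Derivation semiringᵖ
  derivation = record
    { δ       = deriv
    ; δ-cong  = λ e n → ×-congʳ (suc n) (e (suc n))
    ; δ-+     = λ p q n → ×-distrib-+ _ _ (suc n)
    ; leibniz = deriv-leibniz }

  -- Differentiation with respect to an inner variable of an iterated power series.
  coefficientwise : Derivation R → Derivation semiringᵖ
  coefficientwise D = record
    { δ       = λ p n → δ (p n)
    ; δ-cong  = λ e n → δ-cong (e n)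
    ; δ-+     = λ p q n → δ-+ _ _
    ; leibniz = leib }
    where
    open Derivation D
    leib : ∀ p q n → δ ((p ⊛ q) n) ≈ ((δ ∘ p) ⊛ q) n + (p ⊛ (δ ∘ q)) n
    leib p q zero    = leibniz _ _
    leib p q (suc n) = trans (δ-+ _ _)
      (trans (+-cong (leibniz _ _) (leib (p ∘ suc) q n)) (interchange _ _ _ _))

-- The differential equation along one variable.

-- Permuting the variables makes the computation for one of them serve for all three.
module Axis (A : CSemiring) (X Y Z : CommutativeSemiring.Carrier A) (DX DY DZ : Derivation A) where
  open CommutativeSemiring A
  open SetoidReasoning setoid
  open SemiringSolver A using (solve; _:=_; _:+_; _:*_)
  open Derivation DX using () renaming (δ to ∂x; δ-cong to ∂x-cong; δ-+ to ∂x-+; leibniz to ∂x-*)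
  open Derivation DY using () renaming (δ to ∂y; δ-cong to ∂y-cong; δ-+ to ∂y-+; leibniz to ∂y-*)
  open Derivation DZ using () renaming (δ to ∂z; δ-cong to ∂z-cong; δ-+ to ∂z-+; leibniz to ∂z-*)

  swap euler : Derivation A
  swap = record
    { δ = λ s → ∂x s + (Y * ∂z s + Z * ∂y s)
    ; δ-cong = λ e → +-cong (∂x-cong e) (+-cong (*-congˡ (∂z-cong e)) (*-congˡ (∂y-cong e)))
    ; δ-+ = λ s t → trans
        (+-cong (∂x-+ s t) (+-cong (*-congˡ (∂z-+ s t)) (*-congˡ (∂y-+ s t))))
        (solve 8 (λ y z a b c a′ b′ c′ →
            (a :+ a′) :+ (y :* (b :+ b′) :+ z :* (c :+ c′)) :=
            (a :+ (y :* b :+ z :* c)) :+ (a′ :+ (y :* b′ :+ z :* c′)))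
          refl Y Z (∂x s) (∂z s) (∂y s) (∂x t) (∂z t) (∂y t))
    ; leibniz = λ s t → trans
        (+-cong (∂x-* s t) (+-cong (*-congˡ (∂z-* s t)) (*-congˡ (∂y-* s t))))
        (solve 10 (λ y z s t a b c a′ b′ c′ →
            (a :* t :+ s :* a′) :+ (y :* (b :* t :+ s :* b′) :+ z :* (c :* t :+ s :* c′)) :=
            (a :+ (y :* b :+ z :* c)) :* t :+ s :* (a′ :+ (y :* b′ :+ z :* c′)))
          refl Y Z s t (∂x s) (∂z s) (∂y s) (∂x t) (∂z t) (∂y t)) }
  euler = record
    { δ = λ s → X * ∂x s + (Y * ∂y s + Z * ∂z s)
    ; δ-cong = λ e → +-cong (*-congˡ (∂x-cong e)) (+-cong (*-congˡ (∂y-cong e)) (*-congˡ (∂z-cong e)))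
    ; δ-+ = λ s t → trans
        (+-cong (*-congˡ (∂x-+ s t)) (+-cong (*-congˡ (∂y-+ s t)) (*-congˡ (∂z-+ s t))))
        (solve 9 (λ x y z a b c a′ b′ c′ →
            x :* (a :+ a′) :+ (y :* (b :+ b′) :+ z :* (c :+ c′)) :=
            (x :* a :+ (y :* b :+ z :* c)) :+ (x :* a′ :+ (y :* b′ :+ z :* c′)))
          refl X Y Z (∂x s) (∂y s) (∂z s) (∂x t) (∂y t) (∂z t))
    ; leibniz = λ s t → trans
        (+-cong (*-congˡ (∂x-* s t)) (+-cong (*-congˡ (∂y-* s t)) (*-congˡ (∂z-* s t))))
        (solve 11 (λ x y z s t a b c a′ b′ c′ →
            x :* (a :* t :+ s :* a′) :+ (y :* (b :* t :+ s :* b′) :+ z :* (c :* t :+ s :* c′)) :=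
            (x :* a :+ (y :* b :+ z :* c)) :* t :+ s :* (x :* a′ :+ (y :* b′ :+ z :* c′)))
          refl X Y Z s t (∂x s) (∂y s) (∂z s) (∂x t) (∂y t) (∂z t)) }

  open Derivation swap using () renaming (δ to P; leibniz to P-*; δ-cong to P-cong; δ-+ to P-+) public
  open Derivation euler using () renaming (δ to E; leibniz to E-*; δ-cong to E-cong; δ-+ to E-+) public

  -- The differential equation  β s = (P − X E + γ X) s  without subtraction.
  record Solves (β γ s : Carrier) : Set where
    constructor solution
    field equation : P s + γ * (X * s) ≈ β * s + X * E s
  open Solves public

  Solves-cong : ∀ {β β′ γ γ′ s t} → β ≈ β′ → γ ≈ γ′ → s ≈ t → Solves β γ s → Solves β′ γ′ t
  Solves-cong ββ γγ st h = solution (trans (+-cong (P-cong (sym st)) (*-cong (sym γγ) (*-congˡ (sym st))))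
    (trans (equation h) (+-cong (*-cong ββ st) (*-congˡ (E-cong st)))))

  -- `P` and `E` are derivations, so their logarithmic derivatives add under products, and with them
  -- β and γ.
  Solves-* : ∀ {β β′ γ γ′ s t} → Solves β γ s → Solves β′ γ′ t → Solves (β + β′) (γ + γ′) (s * t)
  Solves-* {β} {β′} {γ} {γ′} {s} {t} hs ht = solution (begin
    P (s * t) + (γ + γ′) * (X * (s * t))
      ≈⟨ +-congʳ (P-* s t) ⟩
    (P s * t + s * P t) + (γ + γ′) * (X * (s * t))
      ≈⟨ solve 7 (λ x s t p p′ g g′ →
           (p :* t :+ s :* p′) :+ (g :+ g′) :* (x :* (s :* t)) :=
           (p :+ g :* (x :* s)) :* t :+ s :* (p′ :+ g′ :* (x :* t)))
         refl X s t (P s) (P t) γ γ′ ⟩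
    (P s + γ * (X * s)) * t + s * (P t + γ′ * (X * t))
      ≈⟨ +-cong (*-congʳ (equation hs)) (*-congˡ (equation ht)) ⟩
    (β * s + X * E s) * t + s * (β′ * t + X * E t)
      ≈⟨ solve 7 (λ x s t p p′ g g′ →
           (g :* s :+ x :* p) :* t :+ s :* (g′ :* t :+ x :* p′) :=
           (g :+ g′) :* (s :* t) :+ x :* (p :* t :+ s :* p′))
         refl X s t (E s) (E t) β β′ ⟩
    (β + β′) * (s * t) + X * (E s * t + s * E t)
      ≈⟨ +-congˡ (*-congˡ (E-* s t)) ⟨
    (β + β′) * (s * t) + X * E (s * t) ∎)

  Solves-*₄ : ∀ {β₁ β₂ β₃ β₄ β γ₁ γ₂ γ₃ γ₄ γ s₁ s₂ s₃ s₄ t₁ t₂ t₃ t₄} →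
    β₁ + (β₂ + (β₃ + β₄)) ≈ β → γ₁ + (γ₂ + (γ₃ + γ₄)) ≈ γ →
    s₁ ≈ t₁ → s₂ ≈ t₂ → s₃ ≈ t₃ → s₄ ≈ t₄ →
    Solves β₁ γ₁ s₁ → Solves β₂ γ₂ s₂ → Solves β₃ γ₃ s₃ → Solves β₄ γ₄ s₄ →
    Solves β γ (t₁ * (t₂ * (t₃ * t₄)))
  Solves-*₄ ∑β ∑γ e₁ e₂ e₃ e₄ h₁ h₂ h₃ h₄ =
    Solves-cong ∑β ∑γ (*-cong e₁ (*-cong e₂ (*-cong e₃ e₄)))
      (Solves-* h₁ (Solves-* h₂ (Solves-* h₃ h₄)))

  -- A power g = (1 + e₁X + e₂Y + e₃Z)^α; here h = α g / (1 + e₁X + e₂Y + e₃Z).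
  Solves-power : ∀ {e₁ e₂ e₃ α g h} → e₁ * e₁ ≈ 1# → e₁ * e₂ ≈ e₃ → e₁ * e₃ ≈ e₂ →
    ∂x g ≈ e₁ * h → ∂y g ≈ e₂ * h → ∂z g ≈ e₃ * h → α * g ≈ h + E g → Solves (e₁ * α) α g
  Solves-power {e₁} {e₂} {e₃} {α} {g} {h} e₁₁ e₁₂ e₁₃ gx gy gz αg = solution (begin
    P g + α * (X * g)
      ≈⟨ +-cong (+-cong gx (+-cong (*-congˡ gz) (*-congˡ gy)))
           (trans (solve 3 (λ a x g → a :* (x :* g) := x :* (a :* g)) refl α X g) (*-congˡ αg)) ⟩
    (e₁ * h + (Y * (e₃ * h) + Z * (e₂ * h))) + X * (h + E g)
      ≈⟨ solve 8 (λ x y z e₁ e₂ e₃ h w →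
           (e₁ :* h :+ (y :* (e₃ :* h) :+ z :* (e₂ :* h))) :+ x :* (h :+ w) :=
           (e₁ :* h :+ (x :* h :+ (y :* (e₃ :* h) :+ z :* (e₂ :* h)))) :+ x :* w)
         refl X Y Z e₁ e₂ e₃ h (E g) ⟩
    (e₁ * h + (X * h + (Y * (e₃ * h) + Z * (e₂ * h)))) + X * E g
      ≈⟨ +-congʳ (+-congˡ (sym e₁E)) ⟩
    (e₁ * h + e₁ * E g) + X * E g
      ≈⟨ +-congʳ (trans (sym (distribˡ _ _ _)) (trans (*-congˡ (sym αg)) (sym (*-assoc _ _ _)))) ⟩
    e₁ * α * g + X * E g ∎)
    where
    -- Multiplication by e₁ fixes the sign pattern up to exchanging e₂ and e₃, because e₁e₂ = e₃ and
    -- e₁e₃ = e₂. This matches the exchange of Y and Z in `P`, so that P g + X h becomes e₁ (h + E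
    -- g).
    e₁E : e₁ * E g ≈ X * h + (Y * (e₃ * h) + Z * (e₂ * h))
    e₁E = begin
      e₁ * E g
        ≈⟨ *-congˡ (+-cong (*-congˡ gx) (+-cong (*-congˡ gy) (*-congˡ gz))) ⟩
      e₁ * (X * (e₁ * h) + (Y * (e₂ * h) + Z * (e₃ * h)))
        ≈⟨ solve 7 (λ x y z e₁ e₂ e₃ h →
             e₁ :* (x :* (e₁ :* h) :+ (y :* (e₂ :* h) :+ z :* (e₃ :* h))) :=
             x :* (e₁ :* e₁ :* h) :+ (y :* (e₁ :* e₂ :* h) :+ z :* (e₁ :* e₃ :* h)))
           refl X Y Z e₁ e₂ e₃ h ⟩
      X * (e₁ * e₁ * h) + (Y * (e₁ * e₂ * h) + Z * (e₁ * e₃ * h))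
        ≈⟨ +-cong (*-congˡ (trans (*-congʳ e₁₁) (*-identityˡ h)))
             (+-cong (*-congˡ (*-congʳ e₁₂)) (*-congˡ (*-congʳ e₁₃))) ⟩
      X * h + (Y * (e₃ * h) + Z * (e₂ * h)) ∎

-- Formal power series in three variables.

-- R[[X,Y,Z]] as R[[Z]][[Y]][[X]].
module Series3 (R : CSemiring) where
  open CommutativeSemiring R hiding (zero)
  open Sums +-commutativeMonoid
  open MonoidMult +-commutativeMonoid using (_×_; ×-homo-+)
  open CommutativeSemigroupProperties
    (CommutativeMonoid.commutativeSemigroup +-commutativeMonoid) using (x∙yz≈y∙xz)
  open SetoidReasoning setoid
  private
    module Z = PowerSeries R
    module Y = PowerSeries Z.semiringᵖ
    module X = PowerSeries Y.semiringᵖ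
    module XS = CommutativeSemiring X.semiringᵖ

  S³ : Set
  S³ = ℕ → ℕ → ℕ → Carrier

  infix 4 _≈³_
  _≈³_ : S³ → S³ → Set
  s ≈³ t = ∀ a b c → s a b c ≈ t a b c

  mono³ : Carrier → ℕ → ℕ → ℕ → S³
  mono³ r a b c i j k = if (a ℕ.≡ᵇ i) ∧ (b ℕ.≡ᵇ j) ∧ (c ℕ.≡ᵇ k) then r else 0#

  infixl 7 _*³_
  _*³_ : S³ → S³ → S³
  _*³_ = conv3 _+_ 0# _*_

  private
    at : (Q : CSemiring) (n : ℕ) →
      CommutativeSemiring.+-commutativeMonoid (PowerSeries.semiringᵖ Q) →⁺
      CommutativeSemiring.+-commutativeMonoid Q
    at Q n = record
      { ⟦_⟧ = λ p → p n ; cong = λ e → e n ; ∙-homo = λ _ _ → Q.refl ; ε-homo = Q.refl }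
      where module Q = CommutativeSemiring Q

  -- Triple and iterated series have the same carrier and the same pointwise equality, so this
  -- comparison of products is all that is needed to transport the semiring laws and the Leibniz
  -- rules.
  *³≈⊛ : ∀ s t → s *³ t ≈³ s X.⊛ t
  *³≈⊛ s t a b c = sym (begin
    (s X.⊛ t) a b c
      ≈⟨ X.⊛-sumTo s t a b c ⟩
    sumTo Y._⊕_ (λ _ _ → 0#) a (λ i → s i Y.⊛ t (a ∸ i)) b c
      ≈⟨ Additive.∑-homo (at Z.semiringᵖ b) {f = λ i → s i Y.⊛ t (a ∸ i)} (upTo (suc a)) c ⟩
    sumTo Z._⊕_ (λ _ → 0#) a (λ i → (s i Y.⊛ t (a ∸ i)) b) c
      ≈⟨ Additive.∑-homo (at R c) {f = λ i → (s i Y.⊛ t (a ∸ i)) b} (upTo (suc a)) ⟩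
    sumTo _+_ 0# a (λ i → (s i Y.⊛ t (a ∸ i)) b c)
      ≈⟨ sumTo-cong a (λ i → begin
         (s i Y.⊛ t (a ∸ i)) b c
           ≈⟨ Y.⊛-sumTo (s i) (t (a ∸ i)) b c ⟩
         sumTo Z._⊕_ (λ _ → 0#) b (λ j → s i j Z.⊛ t (a ∸ i) (b ∸ j)) c
           ≈⟨ Additive.∑-homo (at R c) {f = λ j → s i j Z.⊛ t (a ∸ i) (b ∸ j)} (upTo (suc b)) ⟩
         sumTo _+_ 0# b (λ j → (s i j Z.⊛ t (a ∸ i) (b ∸ j)) c)
           ≈⟨ sumTo-cong b (λ j → Z.⊛-sumTo (s i j) _ c) ⟩
         sumTo _+_ 0# b (λ j → sumTo _+_ 0# c (λ k → s i j k * t (a ∸ i) (b ∸ j) (c ∸ k))) ∎) ⟩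
    (s *³ t) a b c ∎)

  private
    mono³≈ : ∀ r a b c → mono³ r a b c ≈³ X.mono (Y.mono (Z.mono r c) b) a
    mono³≈ r a b c i j k with a ℕ.≡ᵇ i
    ... | false = refl
    ... | true with b ℕ.≡ᵇ j
    ...   | false = refl
    ...   | true  = refl

    lift₁ : ∀ r a b c s → mono³ r a b c *³ s ≈³ X.mono (Y.mono (Z.mono r c) b) a X.⊛ s
    lift₁ r a b c s i j k = trans (*³≈⊛ (mono³ r a b c) s i j k)
      (X.⊛-cong (mono³≈ r a b c) (λ _ _ _ → refl) i j k)

  shiftX shiftY shiftZ : S³ → S³
  shiftX s zero    b c = 0#
  shiftX s (suc a) b c = s a b c
  shiftY s a zero    c = 0#
  shiftY s a (suc b) c = s a b c
  shiftZ s a b zero    = 0#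
  shiftZ s a b (suc c) = s a b c

  mono³-const : ∀ r s → mono³ r 0 0 0 *³ s ≈³ (λ a b c → r * s a b c)
  mono³-const r s a b c = trans (lift₁ r 0 0 0 s a b c)
    (trans (X.mono-0 _ s a b c) (trans (Y.mono-0 _ (s a) b c) (Z.mono-0 r (s a b) c)))

  mono³-X : ∀ r s → mono³ r 1 0 0 *³ s ≈³ shiftX (λ a b c → r * s a b c)
  mono³-X r s a b c = trans (lift₁ r 1 0 0 s a b c) (trans (X.mono-1 _ s a b c) (go a))
    where
    go : ∀ a → X.shift (λ n → Y.mono (Z.mono r 0) 0 Y.⊛ s n) a b c ≈ shiftX (λ a b c → r * s a b c) a b c
    go zero    = refl
    go (suc a) = trans (Y.mono-0 _ (s a) b c) (Z.mono-0 r (s a b) c)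

  mono³-Y : ∀ r s → mono³ r 0 1 0 *³ s ≈³ shiftY (λ a b c → r * s a b c)
  mono³-Y r s a b c = trans (lift₁ r 0 1 0 s a b c)
    (trans (X.mono-0 _ s a b c) (trans (Y.mono-1 _ (s a) b c) (go b)))
    where
    go : ∀ b → Y.shift (λ n → Z.mono r 0 Z.⊛ s a n) b c ≈ shiftY (λ a b c → r * s a b c) a b c
    go zero    = refl
    go (suc b) = Z.mono-0 r (s a b) c

  mono³-Z : ∀ r s → mono³ r 0 0 1 *³ s ≈³ shiftZ (λ a b c → r * s a b c)
  mono³-Z r s a b c = trans (lift₁ r 0 0 1 s a b c)
    (trans (X.mono-0 _ s a b c) (trans (Y.mono-0 _ (s a) b c) (trans (Z.mono-1 r (s a b) c) (go c))))
    where
    go : ∀ c → Z.shift (λ n → r * s a b n) c ≈ shiftZ (λ a b c → r * s a b c) a b c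
    go zero    = refl
    go (suc c) = refl

  -- The product is `conv3` itself and not the iterated `⊛`, so that over ℚ and over `Poly3` this
  -- semiring has exactly `_*ₚ_` and `_*ₛ_` as its multiplications.
  semiring³ : CSemiring
  semiring³ = record
    { _≈_ = _≈³_ ; _+_ = λ s t a b c → s a b c + t a b c ; _*_ = _*³_
    ; 0# = λ _ _ _ → 0# ; 1# = mono³ 1# 0 0 0
    ; isCommutativeSemiring = IsCommutativeSemiringˡ.isCommutativeSemiring record
      { +-isCommutativeMonoid = XS.+-isCommutativeMonoid
      ; *-isCommutativeMonoid = record
        { isMonoid = record
          { isSemigroup = record
            { isMagma = record
              { isEquivalence = XS.isEquivalence
              ; ∙-cong = λ {s} {s′} {t} {t′} e f →
                  via s t s′ t′ (X.⊛-cong e f) }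
            ; assoc = λ s t u → XS.trans (*³≈⊛ (s *³ t) u) (XS.trans (X.⊛-cong (*³≈⊛ s t) (XS.refl {u}))
                (XS.trans (X.⊛-assoc s t u)
                (XS.sym (XS.trans (*³≈⊛ s (t *³ u)) (X.⊛-cong (XS.refl {s}) (*³≈⊛ t u)))))) }
          ; identity = identityˡ
                     , (λ s → XS.trans (comm s (mono³ 1# 0 0 0)) (identityˡ s)) }
        ; comm = comm }
      ; distribʳ = λ u s t → XS.trans (*³≈⊛ (λ a b c → s a b c + t a b c) u)
          (XS.trans (X.⊛-distribʳ u s t)
          (XS.sym (XS.+-cong (*³≈⊛ s u) (*³≈⊛ t u))))
      ; zeroˡ = λ s → XS.trans (*³≈⊛ (λ _ _ _ → 0#) s) (X.⊛-zeroˡ s) } }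
    where
    via : ∀ s t s′ t′ → s X.⊛ t ≈³ s′ X.⊛ t′ → s *³ t ≈³ s′ *³ t′
    via s t s′ t′ e a b c = trans (*³≈⊛ s t a b c) (trans (e a b c) (sym (*³≈⊛ s′ t′ a b c)))

    comm : ∀ s t → s *³ t ≈³ t *³ s
    comm s t = via s t t s (X.⊛-comm s t)

    identityˡ : ∀ s → mono³ 1# 0 0 0 *³ s ≈³ s
    identityˡ s a b c = trans (mono³-const 1# s a b c) (*-identityˡ _)

  private
    reproduct : Derivation X.semiringᵖ → Derivation semiring³
    reproduct D = record
      { δ = δ ; δ-cong = δ-cong ; δ-+ = δ-+
      ; leibniz = λ s t → XS.trans (δ-cong (*³≈⊛ s t)) (XS.trans (leibniz s t)
          (XS.sym (XS.+-cong (*³≈⊛ (δ s) t) (*³≈⊛ s (δ t))))) }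
      where open Derivation D

  ∂X ∂Y ∂Z : Derivation semiring³
  ∂X = reproduct X.derivation
  ∂Y = reproduct (X.coefficientwise Y.derivation)
  ∂Z = reproduct (X.coefficientwise (Y.coefficientwise Z.derivation))

  coefficient : ℕ → ℕ → ℕ →
    CommutativeSemiring.+-commutativeMonoid semiring³ →⁺ +-commutativeMonoid
  coefficient a b c = record
    { ⟦_⟧ = λ s → s a b c ; cong = λ e → e a b c ; ∙-homo = λ _ _ → refl ; ε-homo = refl }

  ∂X-coefficient : ∀ s a b c → Derivation.δ ∂X s a b c ≈ suc a × s (suc a) b c
  ∂X-coefficient s a b c = trans
    (Additive.×-homo (at Z.semiringᵖ b) (suc a) (s (suc a)) c)
    (Additive.×-homo (at R c) (suc a) (s (suc a) b))

  ∂Y-coefficient : ∀ s a b c → Derivation.δ ∂Y s a b c ≈ suc b × s a (suc b) c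
  ∂Y-coefficient s a b c = Additive.×-homo (at R c) (suc b) (s a (suc b))

  ∂Z-coefficient : ∀ s a b c → Derivation.δ ∂Z s a b c ≈ suc c × s a b (suc c)
  ∂Z-coefficient s a b c = refl

  𝕏 𝕐 𝕫 : S³
  𝕏 = mono³ 1# 1 0 0
  𝕐 = mono³ 1# 0 1 0
  𝕫 = mono³ 1# 0 0 1

  𝕏-* : ∀ s → 𝕏 *³ s ≈³ shiftX s
  𝕏-* s zero    b c = mono³-X 1# s zero b c
  𝕏-* s (suc a) b c = trans (mono³-X 1# s (suc a) b c) (*-identityˡ _)

  𝕐-* : ∀ s → 𝕐 *³ s ≈³ shiftY s
  𝕐-* s a zero    c = mono³-Y 1# s a zero c
  𝕐-* s a (suc b) c = trans (mono³-Y 1# s a (suc b) c) (*-identityˡ _)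

  𝕫-* : ∀ s → 𝕫 *³ s ≈³ shiftZ s
  𝕫-* s a b zero    = mono³-Z 1# s a b zero
  𝕫-* s a b (suc c) = trans (mono³-Z 1# s a b (suc c)) (*-identityˡ _)

  private
    ×-0 : ∀ n → n × 0# ≈ 0#
    ×-0 zero    = refl
    ×-0 (suc n) = trans (+-identityˡ _) (×-0 n)

    if-∧-false : ∀ b r → (if b ∧ false then r else 0#) ≡ 0#
    if-∧-false false r = ≡.refl
    if-∧-false true  r = ≡.refl

    if-∧-∧-false : ∀ b b′ r → (if b ∧ b′ ∧ false then r else 0#) ≡ 0#
    if-∧-∧-false false b′ r = ≡.refl
    if-∧-∧-false true  b′ r = if-∧-false b′ r

    ×-≡0 : ∀ n {x} → x ≡ 0# → n × x ≈ 0#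
    ×-≡0 n ≡.refl = ×-0 n

  ∂X-free : ∀ r b c → Derivation.δ ∂X (mono³ r 0 b c) ≈³ (λ _ _ _ → 0#)
  ∂X-free r b c i j k = trans (∂X-coefficient (mono³ r 0 b c) i j k) (×-0 (suc i))

  ∂Y-free : ∀ r a c → Derivation.δ ∂Y (mono³ r a 0 c) ≈³ (λ _ _ _ → 0#)
  ∂Y-free r a c i j k = trans (∂Y-coefficient (mono³ r a 0 c) i j k)
    (×-≡0 (suc j) (if-∧-false (a ℕ.≡ᵇ i) r))

  ∂Z-free : ∀ r a b → Derivation.δ ∂Z (mono³ r a b 0) ≈³ (λ _ _ _ → 0#)
  ∂Z-free r a b i j k = ×-≡0 (suc k) (if-∧-∧-false (a ℕ.≡ᵇ i) (b ℕ.≡ᵇ j) r)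

  ∂X-linear : ∀ r b c → Derivation.δ ∂X (mono³ r 1 b c) ≈³ mono³ r 0 b c
  ∂X-linear r b c zero    j k = trans (∂X-coefficient (mono³ r 1 b c) zero j k) (+-identityʳ _)
  ∂X-linear r b c (suc i) j k = trans (∂X-coefficient (mono³ r 1 b c) (suc i) j k) (×-0 (suc (suc i)))

  ∂Y-linear : ∀ r a c → Derivation.δ ∂Y (mono³ r a 1 c) ≈³ mono³ r a 0 c
  ∂Y-linear r a c i zero    k = trans (∂Y-coefficient (mono³ r a 1 c) i zero k) (+-identityʳ _)
  ∂Y-linear r a c i (suc j) k = trans (∂Y-coefficient (mono³ r a 1 c) i (suc j) k)
    (trans (×-≡0 (suc (suc j)) (if-∧-false (a ℕ.≡ᵇ i) r)) (sym (reflexive (if-∧-false (a ℕ.≡ᵇ i) r))))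

  ∂Z-linear : ∀ r a b → Derivation.δ ∂Z (mono³ r a b 1) ≈³ mono³ r a b 0
  ∂Z-linear r a b i j zero    = +-identityʳ _
  ∂Z-linear r a b i j (suc k) = trans
    (×-≡0 (suc (suc k)) (if-∧-∧-false (a ℕ.≡ᵇ i) (b ℕ.≡ᵇ j) r))
    (sym (reflexive (if-∧-∧-false (a ℕ.≡ᵇ i) (b ℕ.≡ᵇ j) r)))

  X∂X : ∀ s a b c → (𝕏 *³ Derivation.δ ∂X s) a b c ≈ a × s a b c
  X∂X s zero    b c = 𝕏-* (Derivation.δ ∂X s) zero b c
  X∂X s (suc a) b c = trans (𝕏-* (Derivation.δ ∂X s) (suc a) b c) (∂X-coefficient s a b c)

  Y∂Y : ∀ s a b c → (𝕐 *³ Derivation.δ ∂Y s) a b c ≈ b × s a b c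
  Y∂Y s a zero    c = 𝕐-* (Derivation.δ ∂Y s) a zero c
  Y∂Y s a (suc b) c = trans (𝕐-* (Derivation.δ ∂Y s) a (suc b) c) (∂Y-coefficient s a b c)

  Z∂Z : ∀ s a b c → (𝕫 *³ Derivation.δ ∂Z s) a b c ≈ c × s a b c
  Z∂Z s a b zero    = 𝕫-* (Derivation.δ ∂Z s) a b zero
  Z∂Z s a b (suc c) = trans (𝕫-* (Derivation.δ ∂Z s) a b (suc c)) (∂Z-coefficient s a b c)

  module Axis₁ = Axis semiring³ 𝕏 𝕐 𝕫 ∂X ∂Y ∂Z
  module Axis₂ = Axis semiring³ 𝕐 𝕏 𝕫 ∂Y ∂X ∂Z
  module Axis₃ = Axis semiring³ 𝕫 𝕏 𝕐 ∂Z ∂X ∂Y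

  E₂≈E₁ : ∀ s → Axis₂.E s ≈³ Axis₁.E s
  E₂≈E₁ s a b c = x∙yz≈y∙xz _ _ _

  E₃≈E₁ : ∀ s → Axis₃.E s ≈³ Axis₁.E s
  E₃≈E₁ s a b c = trans (+-comm _ _) (+-assoc _ _ _)

  degree-× : ∀ s a b c → Axis₁.E s a b c ≈ (a ℕ.+ b ℕ.+ c) × s a b c
  degree-× s a b c = begin
    Axis₁.E s a b c
      ≈⟨ +-cong (X∂X s a b c) (+-cong (Y∂Y s a b c) (Z∂Z s a b c)) ⟩
    a × s a b c + (b × s a b c + c × s a b c)
      ≈⟨ +-assoc _ _ _ ⟨
    a × s a b c + b × s a b c + c × s a b c
      ≈⟨ +-congʳ (×-homo-+ _ a b) ⟨
    (a ℕ.+ b) × s a b c + c × s a b c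
      ≈⟨ ×-homo-+ _ (a ℕ.+ b) c ⟨
    (a ℕ.+ b ℕ.+ c) × s a b c ∎

  C : Carrier → S³
  C r = mono³ r 0 0 0

  C-* : ∀ {r s t} → r * s ≈ t → C r *³ C s ≈³ C t
  C-* {r} {s} {t} rs a b c = trans (mono³-const r (C s) a b c)
    (go ((0 ℕ.≡ᵇ a) ∧ (0 ℕ.≡ᵇ b) ∧ (0 ℕ.≡ᵇ c)))
    where
    go : ∀ x → r * (if x then s else 0#) ≈ (if x then t else 0#)
    go true  = rs
    go false = zeroʳ r

  C-+ : ∀ {r s t} → r + s ≈ t → (λ a b c → C r a b c + C s a b c) ≈³ C t
  C-+ {r} {s} {t} rs a b c = go ((0 ℕ.≡ᵇ a) ∧ (0 ℕ.≡ᵇ b) ∧ (0 ℕ.≡ᵇ c))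
    where
    go : ∀ x → (if x then r else 0#) + (if x then s else 0#) ≈ (if x then t else 0#)
    go true  = rs
    go false = +-identityˡ 0#

  C-∑₄ : ∀ {r₁ r₂ r₃ r₄ r} → r₁ + (r₂ + (r₃ + r₄)) ≈ r →
    (λ a b c → C r₁ a b c + (C r₂ a b c + (C r₃ a b c + C r₄ a b c))) ≈³ C r
  C-∑₄ {r₁} {r₂} {r₃} {r₄} eq a b c = trans
    (+-congˡ (trans (+-congˡ (C-+ {r₃} {r₄} refl a b c)) (C-+ {r₂} refl a b c))) (C-+ {r₁} eq a b c)

  constant-term-* : ∀ {s t} → s 0 0 0 ≈ 1# → t 0 0 0 ≈ 1# → (s *³ t) 0 0 0 ≈ 1#
  constant-term-* s≈1 t≈1 = trans
    (trans (+-identityʳ _) (trans (+-identityʳ _) (+-identityʳ _)))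
    (trans (*-cong s≈1 t≈1) (*-identityˡ 1#))

-- Rational scalars and the recursion of the binomial coefficients.

ℚ-semiring : CSemiring
ℚ-semiring = CommutativeRing.commutativeSemiring ℚ.+-*-commutativeRing

open MonoidMult (CommutativeSemiring.+-commutativeMonoid ℚ-semiring) using () renaming (_×_ to _×ℚ_)

fromℚᵘ-+ : ∀ p q → fromℚᵘ (p ℚᵘ.+ q) ≡ fromℚᵘ p ℚ.+ fromℚᵘ q
fromℚᵘ-+ p q = ℚ.toℚᵘ-injective (ℚᵘ.≃-trans (ℚ.toℚᵘ-fromℚᵘ (p ℚᵘ.+ q))
  (ℚᵘ.≃-sym (ℚᵘ.≃-trans (ℚ.toℚᵘ-homo-+ (fromℚᵘ p) (fromℚᵘ q))
    (ℚᵘ.+-cong (ℚ.toℚᵘ-fromℚᵘ p) (ℚ.toℚᵘ-fromℚᵘ q)))))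

fromℚᵘ-* : ∀ p q → fromℚᵘ (p ℚᵘ.* q) ≡ fromℚᵘ p ℚ.* fromℚᵘ q
fromℚᵘ-* p q = ℚ.toℚᵘ-injective (ℚᵘ.≃-trans (ℚ.toℚᵘ-fromℚᵘ (p ℚᵘ.* q))
  (ℚᵘ.≃-sym (ℚᵘ.≃-trans (ℚ.toℚᵘ-homo-* (fromℚᵘ p) (fromℚᵘ q))
    (ℚᵘ.*-cong (ℚ.toℚᵘ-fromℚᵘ p) (ℚ.toℚᵘ-fromℚᵘ q)))))

toℚ-+ : ∀ m n → toℚ (m ℕ.+ n) ≡ toℚ m ℚ.+ toℚ n
toℚ-+ m n = ≡.trans
  (ℚ.fromℚᵘ-cong {mkℚᵘ (+ (m ℕ.+ n)) 0} {mkℚᵘ (+ m) 0 ℚᵘ.+ mkℚᵘ (+ n) 0}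
    (*≡* (≡.cong (ℤ._* + 1) (≡.sym (≡.cong₂ ℤ._+_ (ℤ.*-identityʳ (+ m)) (ℤ.*-identityʳ (+ n)))))))
  (fromℚᵘ-+ (mkℚᵘ (+ m) 0) (mkℚᵘ (+ n) 0))

×ℚ≡toℚ* : ∀ n q → n ×ℚ q ≡ toℚ n ℚ.* q
×ℚ≡toℚ* zero    q = ≡.sym (ℚ.*-zeroˡ q)
×ℚ≡toℚ* (suc n) q = ≡.sym (begin
  toℚ (suc n) ℚ.* q          ≡⟨ ≡.cong (ℚ._* q) (toℚ-+ 1 n) ⟩
  (1ℚ ℚ.+ toℚ n) ℚ.* q       ≡⟨ ℚ.*-distribʳ-+ q 1ℚ (toℚ n) ⟩
  1ℚ ℚ.* q ℚ.+ toℚ n ℚ.* q   ≡⟨ ≡.cong₂ ℚ._+_ (ℚ.*-identityˡ q) (≡.sym (×ℚ≡toℚ* n q)) ⟩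
  q ℚ.+ n ×ℚ q               ∎)
  where open ≡.≡-Reasoning

toℚ*1/ : ∀ s m .{{_ : ℕ.NonZero m}} .{{_ : ℕ.NonZero (suc s ℕ.* m)}} →
  toℚ (suc s) ℚ.* (+ 1 / (suc s ℕ.* m)) ≡ + 1 / m
toℚ*1/ s (suc m) = ≡.trans
  (≡.sym (fromℚᵘ-* (mkℚᵘ (+ suc s) 0) (mkℚᵘ (+ 1) (m ℕ.+ s ℕ.* suc m))))
  (ℚ.fromℚᵘ-cong {mkℚᵘ (+ suc s) 0 ℚᵘ.* mkℚᵘ (+ 1) (m ℕ.+ s ℕ.* suc m)} {mkℚᵘ (+ 1) m} (*≡* (begin
    (+ suc s ℤ.* + 1) ℤ.* + suc m      ≡⟨ ≡.cong (ℤ._* + suc m) (ℤ.*-identityʳ (+ suc s)) ⟩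
    + suc s ℤ.* + suc m                ≡⟨ ℤ.pos-* (suc s) (suc m) ⟨
    + (suc s ℕ.* suc m)                ≡⟨ ≡.cong +_ (ℕ.*-identityˡ _) ⟨
    + (1 ℕ.* (suc s ℕ.* suc m))        ≡⟨ ≡.cong +_ (≡.cong (1 ℕ.*_) (ℕ.*-identityˡ _)) ⟨
    + (1 ℕ.* (1 ℕ.* (suc s ℕ.* suc m))) ≡⟨⟩
    + 1 ℤ.* + (1 ℕ.* (suc s ℕ.* suc m)) ∎)))
  where open ≡.≡-Reasoning

×ℚ-1/! : ∀ k → suc k ×ℚ (_/_ (+ 1) (suc k !) {{suc k ℕ.!≢0}}) ≡ _/_ (+ 1) (k !) {{k ℕ.!≢0}}
×ℚ-1/! k = ≡.trans (×ℚ≡toℚ* (suc k) _) (toℚ*1/ k (k !) {{k ℕ.!≢0}} {{suc k ℕ.!≢0}})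

module ℚ³ = Series3 ℚ-semiring

Poly-semiring : CSemiring
Poly-semiring = ℚ³.semiring³

module Poly = CommutativeSemiring Poly-semiring
module Poly³ = Series3 Poly-semiring

open MonoidMult Poly.+-commutativeMonoid using () renaming (_×_ to _×ₚ_)

×ₚ-coefficient : ∀ n p a b c → (n ×ₚ p) a b c ≡ n ×ℚ p a b c
×ₚ-coefficient n p a b c = Additive.×-homo (ℚ³.coefficient a b c) n p

constₚ-* : ∀ q p → constₚ q *ₚ p Poly.≈ (λ a b c → q ℚ.* p a b c)
constₚ-* = ℚ³.mono³-const

-- The constant -k inside `falling` is traded here for a natural multiple on the other side, which
-- makes the recursion of the binomials free of subtraction.
cancel-× : ∀ k w → constₚ (ℚ.- (+ k / 1)) Poly.* w Poly.+ k ×ₚ w Poly.≈ 0ₚ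
cancel-× k w a b c = begin
  (constₚ (ℚ.- toℚ k) *ₚ w) a b c ℚ.+ (k ×ₚ w) a b c
    ≡⟨ ≡.cong₂ ℚ._+_ (constₚ-* (ℚ.- toℚ k) w a b c)
         (≡.trans (×ₚ-coefficient k w a b c) (×ℚ≡toℚ* k (w a b c))) ⟩
  ℚ.- toℚ k ℚ.* w a b c ℚ.+ toℚ k ℚ.* w a b c
    ≡⟨ ℚ.*-distribʳ-+ (w a b c) (ℚ.- toℚ k) (toℚ k) ⟨
  (ℚ.- toℚ k ℚ.+ toℚ k) ℚ.* w a b c
    ≡⟨ ≡.cong (ℚ._* w a b c) (ℚ.+-inverseˡ (toℚ k)) ⟩
  0ℚ ℚ.* w a b c
    ≡⟨ ℚ.*-zeroˡ (w a b c) ⟩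
  0ℚ ∎
  where open ≡.≡-Reasoning

×ₚ-1/! : ∀ k → suc k ×ₚ constₚ (_/_ (+ 1) (suc k !) {{suc k ℕ.!≢0}}) Poly.≈
               constₚ (_/_ (+ 1) (k !) {{k ℕ.!≢0}})
×ₚ-1/! k a b c = ≡.trans (×ₚ-coefficient (suc k) (constₚ q) a b c) (go ((0 ℕ.≡ᵇ a) ∧ (0 ℕ.≡ᵇ b) ∧ (0 ℕ.≡ᵇ c)))
  where
  q = _/_ (+ 1) (suc k !) {{suc k ℕ.!≢0}}
  go : ∀ t → suc k ×ℚ (if t then q else 0ℚ) ≡ (if t then _/_ (+ 1) (k !) {{k ℕ.!≢0}} else 0ℚ)
  go true  = ×ℚ-1/! k
  go false = ≡.trans (×ℚ≡toℚ* (suc k) 0ℚ) (ℚ.*-zeroʳ (toℚ (suc k)))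

module _ (A : CSemiring) where
  open CommutativeSemiring A
  open MonoidMult +-commutativeMonoid using (_×_)
  open SetoidReasoning setoid
  open SemiringMult semiring using (×-assoc-*)
  open SemiringSolver A using (solve; _:=_; _:+_; _:*_)

  -- The rule (k + 1) binom(α, k + 1) = (α - k) binom(α, k), with c and c′ for 1/k! and 1/(k + 1)!,
  -- F for the falling factorial of length k and m for -k.
  binomial-step : ∀ k {c c′} F α m → suc k × c′ ≈ c → m * (c * F) + k × (c * F) ≈ 0# →
    suc k × (c′ * (F * (α + m))) + k × (c * F) ≈ α * (c * F)
  binomial-step k {c} {c′} F α m c≈ m≈ = begin
    suc k × (c′ * (F * (α + m))) + k × (c * F)
      ≈⟨ +-congʳ (×-assoc-* (suc k) c′ _) ⟨
    (suc k × c′) * (F * (α + m)) + k × (c * F)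
      ≈⟨ +-congʳ (*-congʳ c≈) ⟩
    c * (F * (α + m)) + k × (c * F)
      ≈⟨ solve 5 (λ c F α m r → c :* (F :* (α :+ m)) :+ r := α :* (c :* F) :+ (m :* (c :* F) :+ r))
           refl c F α m (k × (c * F)) ⟩
    α * (c * F) + (m * (c * F) + k × (c * F))
      ≈⟨ +-congˡ m≈ ⟩
    α * (c * F) + 0#
      ≈⟨ +-identityʳ _ ⟩
    α * (c * F) ∎

binomₚ-rec : ∀ α k → suc k ×ₚ binomₚ α (suc k) Poly.+ k ×ₚ binomₚ α k Poly.≈ α Poly.* binomₚ α k
binomₚ-rec α k = binomial-step Poly-semiring k
  {constₚ (_/_ (+ 1) (k !) {{k ℕ.!≢0}})} {constₚ (_/_ (+ 1) (suc k !) {{suc k ℕ.!≢0}})}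
  (falling α k) α (constₚ (ℚ.- (+ k / 1))) (×ₚ-1/! k) (cancel-× k (binomₚ α k))

-- Binomial series of a linear form.

module PowerRule (A : CSemiring) (D : Derivation A) where
  open CommutativeSemiring A hiding (zero)
  open Derivation D
  open SemiringExp semiring using (_^_)
  open SemiringMult semiring using (_×_; ×-congʳ; ×-comm-*)
  open SemiringSolver A using (solve; _:=_; _:*_)
  open SetoidReasoning setoid

  δ-^ : ∀ {u e} → δ 1# ≈ 0# → δ u ≈ e → ∀ k → δ (u ^ suc k) ≈ suc k × (e * u ^ k)
  δ-^ {u} {e} δ1 δu k = trans (leibniz u (u ^ k)) (+-cong (*-congʳ δu) (rest k))
    where
    rest : ∀ k → u * δ (u ^ k) ≈ k × (e * u ^ k)
    rest zero    = trans (*-congˡ δ1) (zeroʳ u)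
    rest (suc k) = begin
      u * δ (u ^ suc k)             ≈⟨ *-congˡ (δ-^ δ1 δu k) ⟩
      u * (suc k × (e * u ^ k))     ≈⟨ ×-comm-* (suc k) u _ ⟩
      suc k × (u * (e * u ^ k))     ≈⟨ ×-congʳ (suc k)
        (solve 3 (λ u e w → u :* (e :* w) := e :* (u :* w)) refl u e (u ^ k)) ⟩
      suc k × (e * (u * u ^ k))     ∎

-- The series g = Σ_k coef k · u^k for u = e₁X + e₂Y + e₃Z, where coef k behaves as binom(α , k).
module LinearPowers (R : CSemiring) (e₁ e₂ e₃ : CommutativeSemiring.Carrier R) where
  open CommutativeSemiring R hiding (zero)
  open Series3 R
  open SemiringMult semiring using (_×_; ×-congʳ; ×-comm-*; ×-assoc-*)
  open SemiringSolver R using (solve; _:=_; _:*_)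
  open SetoidReasoning setoid
  private
    module S = CommutativeSemiring semiring³
  open SemiringExp S.semiring using (_^_)
  open MonoidMult S.+-commutativeMonoid using () renaming (_×_ to _×³_)

  u : S³
  u = mono³ e₁ 1 0 0 S.+ (mono³ e₂ 0 1 0 S.+ mono³ e₃ 0 0 1)

  u-* : ∀ s a b c → (u *³ s) a b c ≈
    shiftX (λ a b c → e₁ * s a b c) a b c + (shiftY (λ a b c → e₂ * s a b c) a b c
      + shiftZ (λ a b c → e₃ * s a b c) a b c)
  u-* s a b c = begin
    (u *³ s) a b c
      ≈⟨ S.distribʳ s (mono³ e₁ 1 0 0) (mono³ e₂ 0 1 0 S.+ mono³ e₃ 0 0 1) a b c ⟩
    (mono³ e₁ 1 0 0 *³ s) a b c + ((mono³ e₂ 0 1 0 S.+ mono³ e₃ 0 0 1) *³ s) a b c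
      ≈⟨ +-cong (mono³-X e₁ s a b c) (trans (S.distribʳ s (mono³ e₂ 0 1 0) (mono³ e₃ 0 0 1) a b c)
           (+-cong (mono³-Y e₂ s a b c) (mono³-Z e₃ s a b c))) ⟩
    _ ∎

  -- This is one half of the homogeneity of u^k. The other half is built into `binSeries`, whose
  -- partial sum stops at k = a + b + c; together they leave a single term in each coefficient.
  u^-low : ∀ k a b c → k ℕ.< a ℕ.+ b ℕ.+ c → (u ^ k) a b c ≈ 0#
  u^-low zero zero    zero    (suc c) k< = refl
  u^-low zero zero    (suc b) c       k< = refl
  u^-low zero (suc a) b       c       k< = refl
  u^-low (suc k) a b c k< = trans (u-* (u ^ k) a b c)
    (trans (+-cong (inX a k<) (trans (+-cong (inY b k<) (inZ c k<)) (+-identityˡ 0#))) (+-identityˡ 0#))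
    where
    kill : ∀ e {x} → x ≈ 0# → e * x ≈ 0#
    kill e x≈0 = trans (*-congˡ x≈0) (zeroʳ e)
    inX : ∀ a → suc k ℕ.< a ℕ.+ b ℕ.+ c → shiftX (λ a b c → e₁ * (u ^ k) a b c) a b c ≈ 0#
    inX zero    lt = refl
    inX (suc a) lt = kill e₁ (u^-low k a b c (ℕ.s<s⁻¹ lt))
    inY : ∀ b → suc k ℕ.< a ℕ.+ b ℕ.+ c → shiftY (λ a b c → e₂ * (u ^ k) a b c) a b c ≈ 0#
    inY zero    lt = refl
    inY (suc b) lt = kill e₂ (u^-low k a b c
      (ℕ.s<s⁻¹ (≡.subst (suc k ℕ.<_) (≡.cong (ℕ._+ c) (ℕ.+-suc a b)) lt)))
    inZ : ∀ c → suc k ℕ.< a ℕ.+ b ℕ.+ c → shiftZ (λ a b c → e₃ * (u ^ k) a b c) a b c ≈ 0#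
    inZ zero    lt = refl
    inZ (suc c) lt = kill e₃ (u^-low k a b c
      (ℕ.s<s⁻¹ (≡.subst (suc k ℕ.<_) (ℕ.+-suc (a ℕ.+ b) c) lt)))

  private
    0+0+ : ∀ {x y z : Carrier} → x ≈ 0# → y ≈ 0# → x + (y + z) ≈ z
    0+0+ x≈0 y≈0 = trans (+-cong x≈0 (trans (+-congʳ y≈0) (+-identityˡ _))) (+-identityˡ _)

    0++0 : ∀ {x y z : Carrier} → x ≈ 0# → z ≈ 0# → x + (y + z) ≈ y
    0++0 x≈0 z≈0 = trans (+-cong x≈0 (trans (+-congˡ z≈0) (+-identityʳ _))) (+-identityˡ _)

    +0+0 : ∀ {x y z : Carrier} → y ≈ 0# → z ≈ 0# → x + (y + z) ≈ x
    +0+0 y≈0 z≈0 = trans (+-congˡ (trans (+-cong y≈0 z≈0) (+-identityʳ _))) (+-identityʳ _)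

    open Derivation ∂X using () renaming (δ to ∂x; δ-+ to ∂x-+)
    open Derivation ∂Y using () renaming (δ to ∂y; δ-+ to ∂y-+)
    open Derivation ∂Z using () renaming (δ to ∂z; δ-+ to ∂z-+)

    u₁ u₂ u₃ : S³
    u₁ = mono³ e₁ 1 0 0
    u₂ = mono³ e₂ 0 1 0
    u₃ = mono³ e₃ 0 0 1

  ∂X-u : ∂x u S.≈ C e₁
  ∂X-u a b c = trans (∂x-+ u₁ (u₂ S.+ u₃) a b c) (trans (+-congˡ (∂x-+ u₂ u₃ a b c))
    (trans (+0+0 (∂X-free e₂ 1 0 a b c) (∂X-free e₃ 0 1 a b c)) (∂X-linear e₁ 0 0 a b c)))

  ∂Y-u : ∂y u S.≈ C e₂
  ∂Y-u a b c = trans (∂y-+ u₁ (u₂ S.+ u₃) a b c) (trans (+-congˡ (∂y-+ u₂ u₃ a b c))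
    (trans (0++0 (∂Y-free e₁ 1 0 a b c) (∂Y-free e₃ 0 1 a b c)) (∂Y-linear e₂ 0 0 a b c)))

  ∂Z-u : ∂z u S.≈ C e₃
  ∂Z-u a b c = trans (∂z-+ u₁ (u₂ S.+ u₃) a b c) (trans (+-congˡ (∂z-+ u₂ u₃ a b c))
    (trans (0+0+ (∂Z-free e₁ 1 0 a b c) (∂Z-free e₂ 0 1 a b c)) (∂Z-linear e₃ 0 0 a b c)))

  module _ (coef : ℕ → Carrier) (α : Carrier)
    (coef-rec : ∀ k → suc k × coef (suc k) + k × coef k ≈ α * coef k) where

    -- Since u^k is homogeneous of degree k, only k = a + b + c contributes to a coefficient. `h` is
    -- the termwise derivative of the series with respect to u, that is, Σ (k + 1) coef(k + 1) u^k.
    g h : S³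
    g a b c = coef (a ℕ.+ b ℕ.+ c) * (u ^ (a ℕ.+ b ℕ.+ c)) a b c
    h a b c = (suc (a ℕ.+ b ℕ.+ c) × coef (suc (a ℕ.+ b ℕ.+ c))) * (u ^ (a ℕ.+ b ℕ.+ c)) a b c

    private
      g-at : ∀ a b c {k} → a ℕ.+ b ℕ.+ c ≡ k → g a b c ≈ coef k * (u ^ k) a b c
      g-at a b c ≡.refl = refl

      -- Differentiating u^(k+1) at a monomial of degree k; i is the exponent brought down.
      step : ∀ i k e a b c {x} → i × x ≈ (suc k ×³ (C e *³ u ^ k)) a b c →
        i × (coef (suc k) * x) ≈ e * ((suc k × coef (suc k)) * (u ^ k) a b c)
      step i k e a b c {x} ix = begin
        i × (coef (suc k) * x)
          ≈⟨ ×-comm-* i (coef (suc k)) x ⟨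
        coef (suc k) * (i × x)
          ≈⟨ *-congˡ (trans ix (Additive.×-homo (coefficient a b c) (suc k) (C e *³ u ^ k))) ⟩
        coef (suc k) * (suc k × (C e *³ u ^ k) a b c)
          ≈⟨ *-congˡ (×-congʳ (suc k) (mono³-const e (u ^ k) a b c)) ⟩
        coef (suc k) * (suc k × (e * (u ^ k) a b c))
          ≈⟨ ×-comm-* (suc k) _ _ ⟩
        suc k × (coef (suc k) * (e * (u ^ k) a b c))
          ≈⟨ ×-assoc-* (suc k) _ _ ⟨
        (suc k × coef (suc k)) * (e * (u ^ k) a b c)
          ≈⟨ solve 3 (λ p e w → p :* (e :* w) := e :* (p :* w)) refl (suc k × coef (suc k)) e _ ⟩
        e * ((suc k × coef (suc k)) * (u ^ k) a b c) ∎

    ∂X-g : ∂x g S.≈ C e₁ S.* h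
    ∂X-g a b c = trans (∂X-coefficient g a b c) (trans
      (step (suc a) (a ℕ.+ b ℕ.+ c) e₁ a b c (trans (sym (∂X-coefficient (u ^ suc (a ℕ.+ b ℕ.+ c)) a b c))
        (PowerRule.δ-^ semiring³ ∂X {u} {C e₁} (∂X-free 1# 0 0) ∂X-u (a ℕ.+ b ℕ.+ c) a b c)))
      (sym (mono³-const e₁ h a b c)))

    ∂Y-g : ∂y g S.≈ C e₂ S.* h
    ∂Y-g a b c = trans (∂Y-coefficient g a b c) (trans
      (×-congʳ (suc b) (g-at a (suc b) c (≡.cong (ℕ._+ c) (ℕ.+-suc a b)))) (trans
      (step (suc b) (a ℕ.+ b ℕ.+ c) e₂ a b c (trans (sym (∂Y-coefficient (u ^ suc (a ℕ.+ b ℕ.+ c)) a b c))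
        (PowerRule.δ-^ semiring³ ∂Y {u} {C e₂} (∂Y-free 1# 0 0) ∂Y-u (a ℕ.+ b ℕ.+ c) a b c)))
      (sym (mono³-const e₂ h a b c))))

    ∂Z-g : ∂z g S.≈ C e₃ S.* h
    ∂Z-g a b c = trans (∂Z-coefficient g a b c) (trans
      (×-congʳ (suc c) (g-at a b (suc c) (ℕ.+-suc (a ℕ.+ b) c))) (trans
      (step (suc c) (a ℕ.+ b ℕ.+ c) e₃ a b c (trans (sym (∂Z-coefficient (u ^ suc (a ℕ.+ b ℕ.+ c)) a b c))
        (PowerRule.δ-^ semiring³ ∂Z {u} {C e₃} (∂Z-free 1# 0 0) ∂Z-u (a ℕ.+ b ℕ.+ c) a b c)))
      (sym (mono³-const e₃ h a b c))))

    -- The equation (1 + u) dg/du = α g, with u dg/du written as `E g`. Euler's operator multiplies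
    -- degree k by k, so each coefficient is an instance of `coef-rec`.
    α-g : C α S.* g S.≈ h S.+ Axis₁.E g
    α-g a b c = begin
      (C α *³ g) a b c
        ≈⟨ mono³-const α g a b c ⟩
      α * (coef k * w)
        ≈⟨ *-assoc _ _ _ ⟨
      α * coef k * w
        ≈⟨ *-congʳ (coef-rec k) ⟨
      (suc k × coef (suc k) + k × coef k) * w
        ≈⟨ distribʳ _ _ _ ⟩
      h a b c + (k × coef k) * w
        ≈⟨ +-congˡ (trans (×-assoc-* k _ _) (sym (degree-× g a b c))) ⟩
      h a b c + Axis₁.E g a b c ∎
      where
      k : ℕ
      k = a ℕ.+ b ℕ.+ c
      w : Carrier
      w = (u ^ k) a b c

    module _ (e₁₁ : e₁ * e₁ ≈ 1#) (e₂₂ : e₂ * e₂ ≈ 1#) (e₃₃ : e₃ * e₃ ≈ 1#)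
      (e₁₂ : e₁ * e₂ ≈ e₃) (e₁₃ : e₁ * e₃ ≈ e₂) (e₂₃ : e₂ * e₃ ≈ e₁) where

      solves₁ : Axis₁.Solves (C (e₁ * α)) (C α) g
      solves₁ = Axis₁.Solves-cong {C e₁ S.* C α} {C (e₁ * α)} {C α} {C α} {g} {g}
        (C-* {e₁} {α} refl) (S.refl {C α}) (S.refl {g}) (Axis₁.Solves-power {C e₁} {C e₂} {C e₃} {C α} {g} {h}
        (C-* e₁₁) (C-* e₁₂) (C-* e₁₃) ∂X-g ∂Y-g ∂Z-g α-g)

      solves₂ : Axis₂.Solves (C (e₂ * α)) (C α) g
      solves₂ = Axis₂.Solves-cong {C e₂ S.* C α} {C (e₂ * α)} {C α} {C α} {g} {g}
        (C-* {e₂} {α} refl) (S.refl {C α}) (S.refl {g}) (Axis₂.Solves-power {C e₂} {C e₁} {C e₃} {C α} {g} {h}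
        (C-* e₂₂) (C-* (trans (*-comm _ _) e₁₂)) (C-* e₂₃) ∂Y-g ∂X-g ∂Z-g
        (λ a b c → trans (α-g a b c) (+-congˡ (sym (E₂≈E₁ g a b c)))))

      solves₃ : Axis₃.Solves (C (e₃ * α)) (C α) g
      solves₃ = Axis₃.Solves-cong {C e₃ S.* C α} {C (e₃ * α)} {C α} {C α} {g} {g}
        (C-* {e₃} {α} refl) (S.refl {C α}) (S.refl {g}) (Axis₃.Solves-power {C e₃} {C e₁} {C e₂} {C α} {g} {h}
        (C-* e₃₃) (C-* (trans (*-comm _ _) e₁₃)) (C-* (trans (*-comm _ _) e₂₃)) ∂Z-g ∂X-g ∂Y-g
        (λ a b c → trans (α-g a b c) (+-congˡ (sym (E₃≈E₁ g a b c)))))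

-- The series f and its three differential equations.

module Ser = CommutativeSemiring Poly³.semiring³
module SerExp = SemiringExp Ser.semiring

^ₛ≡^ : ∀ s k → s ^ₛ k ≡ s SerExp.^ k
^ₛ≡^ s zero    = ≡.refl
^ₛ≡^ s (suc k) = ≡.cong (s *ₛ_) (^ₛ≡^ s k)

module Factor (n : ℕ) (e₁ e₂ e₃ : ℤ) where
  open Poly³ using (module Axis₁; module Axis₂; module Axis₃; C)

  ε₁ ε₂ ε₃ α : Poly3
  ε₁ = constₚ (e₁ / 1)
  ε₂ = constₚ (e₂ / 1)
  ε₃ = constₚ (e₃ / 1)
  α = expo n e₁ e₂ e₃

  module L = LinearPowers Poly-semiring ε₁ ε₂ ε₃

  series : Ser
  series = L.g (binomₚ α) α (binomₚ-rec α)

  factor≈ : series Ser.≈ factor n e₁ e₂ e₃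
  factor≈ a b c = Poly.sym {factor n e₁ e₂ e₃ a b c} {series a b c}
    (Poly.trans {factor n e₁ e₂ e₃ a b c} {sumTo _+ₚ_ 0ₚ (a ℕ.+ b ℕ.+ c) terms} {series a b c}
      (Additive.∑-homo (Poly³.coefficient a b c) {f = λ k → binomₚ α k ·ₛ (base e₁ e₂ e₃ ^ₛ k)}
        (upTo (suc (a ℕ.+ b ℕ.+ c))))
      (Poly.trans {sumTo _+ₚ_ 0ₚ (a ℕ.+ b ℕ.+ c) terms} {terms (a ℕ.+ b ℕ.+ c)} {series a b c}
        (Sums.sumTo-last Poly.+-commutativeMonoid (a ℕ.+ b ℕ.+ c) {terms} low)
        (Poly.reflexive (≡.cong (λ s → binomₚ α (a ℕ.+ b ℕ.+ c) *ₚ s a b c)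
          (^ₛ≡^ (base e₁ e₂ e₃) (a ℕ.+ b ℕ.+ c))))))
    where
    terms : ℕ → Poly3
    terms k = binomₚ α k *ₚ (base e₁ e₂ e₃ ^ₛ k) a b c
    low : ∀ k → k ℕ.< a ℕ.+ b ℕ.+ c → terms k Poly.≈ 0ₚ
    low k k< = Poly.trans {terms k} {binomₚ α k *ₚ 0ₚ} {0ₚ}
      (Poly.*-congˡ {binomₚ α k} {(base e₁ e₂ e₃ ^ₛ k) a b c} {0ₚ}
        (≡.subst (λ s → s a b c Poly.≈ 0ₚ) (≡.sym (^ₛ≡^ (base e₁ e₂ e₃) k)) (L.u^-low k a b c k<)))
      (Poly.zeroʳ (binomₚ α k))

  constant-term : factor n e₁ e₂ e₃ 0 0 0 Poly.≈ constₚ 1ℚ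
  constant-term = Poly.trans {factor n e₁ e₂ e₃ 0 0 0} {series 0 0 0} {constₚ 1ℚ}
    (Poly.sym {series 0 0 0} {factor n e₁ e₂ e₃ 0 0 0} (factor≈ 0 0 0)) (Poly.trans {(constₚ 1ℚ *ₚ constₚ 1ℚ) *ₚ constₚ 1ℚ} {constₚ 1ℚ *ₚ constₚ 1ℚ} {constₚ 1ℚ}
    (Poly.*-identityʳ (constₚ 1ℚ *ₚ constₚ 1ℚ)) (Poly.*-identityʳ (constₚ 1ℚ)))

  module Solutions (e₁₁ : (e₁ / 1) ℚ.* (e₁ / 1) ≡ 1ℚ) (e₂₂ : (e₂ / 1) ℚ.* (e₂ / 1) ≡ 1ℚ)
    (e₃₃ : (e₃ / 1) ℚ.* (e₃ / 1) ≡ 1ℚ) (e₁₂ : (e₁ / 1) ℚ.* (e₂ / 1) ≡ e₃ / 1)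
    (e₁₃ : (e₁ / 1) ℚ.* (e₃ / 1) ≡ e₂ / 1) (e₂₃ : (e₂ / 1) ℚ.* (e₃ / 1) ≡ e₁ / 1) where
    private
      ε₁₁ = ℚ³.C-* {e₁ / 1} {e₁ / 1} {1ℚ} e₁₁
      ε₂₂ = ℚ³.C-* {e₂ / 1} {e₂ / 1} {1ℚ} e₂₂
      ε₃₃ = ℚ³.C-* {e₃ / 1} {e₃ / 1} {1ℚ} e₃₃
      ε₁₂ = ℚ³.C-* {e₁ / 1} {e₂ / 1} {e₃ / 1} e₁₂
      ε₁₃ = ℚ³.C-* {e₁ / 1} {e₃ / 1} {e₂ / 1} e₁₃
      ε₂₃ = ℚ³.C-* {e₂ / 1} {e₃ / 1} {e₁ / 1} e₂₃

    solves₁ : Axis₁.Solves (C (ε₁ *ₚ α)) (C α) series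
    solves₁ = L.solves₁ (binomₚ α) α (binomₚ-rec α) ε₁₁ ε₂₂ ε₃₃ ε₁₂ ε₁₃ ε₂₃

    solves₂ : Axis₂.Solves (C (ε₂ *ₚ α)) (C α) series
    solves₂ = L.solves₂ (binomₚ α) α (binomₚ-rec α) ε₁₁ ε₂₂ ε₃₃ ε₁₂ ε₁₃ ε₂₃

    solves₃ : Axis₃.Solves (C (ε₃ *ₚ α)) (C α) series
    solves₃ = L.solves₃ (binomₚ α) α (binomₚ-rec α) ε₁₁ ε₂₂ ε₃₃ ε₁₂ ε₁₃ ε₂₃

n/4 : ∀ n → + n / 4 ≡ toℚ n ℚ.* (+ 1 / 4)
n/4 n = ≡.trans
  (ℚ.fromℚᵘ-cong {mkℚᵘ (+ n) 3} {mkℚᵘ (+ n) 0 ℚᵘ.* mkℚᵘ (+ 1) 3}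
    (*≡* (≡.cong (ℤ._* + 4) (≡.sym (ℤ.*-identityʳ (+ n))))))
  (fromℚᵘ-* (mkℚᵘ (+ n) 0) (mkℚᵘ (+ 1) 3))

if≡* : ∀ b q → (if b then q else 0ℚ) ≡ q ℚ.* (if b then 1ℚ else 0ℚ)
if≡* true  q = ≡.sym (ℚ.*-identityʳ q)
if≡* false q = ≡.sym (ℚ.*-zeroʳ q)

module Exponents (n : ℕ) where
  private
    -- An exponent at one coefficient; i₀, …, i₃ are the indicators of 1, x, y, z.
    linear : ℤ → ℤ → ℤ → ℚ → ℚ → ℚ → ℚ → ℚ
    linear e₁ e₂ e₃ i₀ i₁ i₂ i₃ =
      (toℚ n ℚ.* (+ 1 / 4)) ℚ.* i₀ ℚ.+ ((e₁ / 4) ℚ.* i₁ ℚ.+ ((e₂ / 4) ℚ.* i₂ ℚ.+ (e₃ / 4) ℚ.* i₃))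

    ind : ℕ → ℕ → ℕ → ℕ → ℕ → ℕ → ℚ
    ind i j k a b c = monₚ 1ℚ i j k a b c

    -- With the four indicators as unknowns, an identity between exponents becomes one identity over
    -- ℚ for the ring solver, and no case distinction on a, b, c is needed.
    expo≡ : ∀ e₁ e₂ e₃ a b c → expo n e₁ e₂ e₃ a b c ≡
      linear e₁ e₂ e₃ (ind 0 0 0 a b c) (ind 1 0 0 a b c) (ind 0 1 0 a b c) (ind 0 0 1 a b c)
    expo≡ e₁ e₂ e₃ a b c = ≡.cong₂ ℚ._+_
      (≡.trans (≡.cong (λ q → monₚ q 0 0 0 a b c) (n/4 n)) (if≡* _ (toℚ n ℚ.* (+ 1 / 4))))
      (≡.cong₂ ℚ._+_ (if≡* _ (e₁ / 4)) (≡.cong₂ ℚ._+_ (if≡* _ (e₂ / 4)) (if≡* _ (e₃ / 4))))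

    open +-*-Solver using (solve; _:=_; _:+_; _:*_; con; Polynomial)

    linear′ : ∀ {m} → ℤ → ℤ → ℤ → (N i₀ i₁ i₂ i₃ : Polynomial m) → Polynomial m
    linear′ e₁ e₂ e₃ N i₀ i₁ i₂ i₃ =
      (N :* con (+ 1 / 4)) :* i₀ :+ (con (e₁ / 4) :* i₁ :+ (con (e₂ / 4) :* i₂ :+ con (e₃ / 4) :* i₃))

  ∑α : expo n pos pos pos +ₚ (expo n pos neg neg +ₚ (expo n neg pos neg +ₚ expo n neg neg pos))
       Poly.≈ constₚ (toℚ n)
  ∑α a b c = ≡.trans
    (≡.cong₂ ℚ._+_ (expo≡ pos pos pos a b c) (≡.cong₂ ℚ._+_ (expo≡ pos neg neg a b c)
      (≡.cong₂ ℚ._+_ (expo≡ neg pos neg a b c) (expo≡ neg neg pos a b c))))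
    (≡.trans (solve 5 (λ N i₀ i₁ i₂ i₃ →
        linear′ pos pos pos N i₀ i₁ i₂ i₃ :+ (linear′ pos neg neg N i₀ i₁ i₂ i₃ :+
        (linear′ neg pos neg N i₀ i₁ i₂ i₃ :+ linear′ neg neg pos N i₀ i₁ i₂ i₃))
        := N :* i₀) ≡.refl (toℚ n) (ind 0 0 0 a b c) (ind 1 0 0 a b c) (ind 0 1 0 a b c) (ind 0 0 1 a b c))
      (≡.sym (if≡* _ (toℚ n))))

  private
    weighted : ∀ e e₁ e₂ e₃ a b c → (constₚ (e / 1) *ₚ expo n e₁ e₂ e₃) a b c ≡ (e / 1) ℚ.*
      linear e₁ e₂ e₃ (ind 0 0 0 a b c) (ind 1 0 0 a b c) (ind 0 1 0 a b c) (ind 0 0 1 a b c)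
    weighted e e₁ e₂ e₃ a b c = ≡.trans (constₚ-* (e / 1) (expo n e₁ e₂ e₃) a b c)
      (≡.cong ((e / 1) ℚ.*_) (expo≡ e₁ e₂ e₃ a b c))

    weightedSum : ℤ → ℤ → ℤ → ℤ → Poly3
    weightedSum e e′ e″ e‴ = (constₚ (e / 1) *ₚ expo n pos pos pos) +ₚ
      ((constₚ (e′ / 1) *ₚ expo n pos neg neg) +ₚ
      ((constₚ (e″ / 1) *ₚ expo n neg pos neg) +ₚ (constₚ (e‴ / 1) *ₚ expo n neg neg pos)))

    weightedSum′ : ∀ {m} → ℤ → ℤ → ℤ → ℤ → (N i₀ i₁ i₂ i₃ : Polynomial m) → Polynomial m
    weightedSum′ e e′ e″ e‴ N i₀ i₁ i₂ i₃ = con (e / 1) :* linear′ pos pos pos N i₀ i₁ i₂ i₃ :+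
      (con (e′ / 1) :* linear′ pos neg neg N i₀ i₁ i₂ i₃ :+
      (con (e″ / 1) :* linear′ neg pos neg N i₀ i₁ i₂ i₃ :+ con (e‴ / 1) :* linear′ neg neg pos N i₀ i₁ i₂ i₃))

    unfold : ∀ e e′ e″ e‴ a b c → weightedSum e e′ e″ e‴ a b c ≡ _
    unfold e e′ e″ e‴ a b c =
      ≡.cong₂ ℚ._+_ (weighted e pos pos pos a b c) (≡.cong₂ ℚ._+_ (weighted e′ pos neg neg a b c)
        (≡.cong₂ ℚ._+_ (weighted e″ neg pos neg a b c) (weighted e‴ neg neg pos a b c)))

  ∑αx : weightedSum pos pos neg neg Poly.≈ monₚ 1ℚ 1 0 0
  ∑αx a b c = ≡.trans (unfold pos pos neg neg a b c)
    (solve 5 (λ N i₀ i₁ i₂ i₃ → weightedSum′ pos pos neg neg N i₀ i₁ i₂ i₃ := i₁) ≡.refl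
      (toℚ n) (ind 0 0 0 a b c) (ind 1 0 0 a b c) (ind 0 1 0 a b c) (ind 0 0 1 a b c))

  ∑αy : weightedSum pos neg pos neg Poly.≈ monₚ 1ℚ 0 1 0
  ∑αy a b c = ≡.trans (unfold pos neg pos neg a b c)
    (solve 5 (λ N i₀ i₁ i₂ i₃ → weightedSum′ pos neg pos neg N i₀ i₁ i₂ i₃ := i₂) ≡.refl
      (toℚ n) (ind 0 0 0 a b c) (ind 1 0 0 a b c) (ind 0 1 0 a b c) (ind 0 0 1 a b c))

  ∑αz : weightedSum pos neg neg pos Poly.≈ monₚ 1ℚ 0 0 1
  ∑αz a b c = ≡.trans (unfold pos neg neg pos a b c)
    (solve 5 (λ N i₀ i₁ i₂ i₃ → weightedSum′ pos neg neg pos N i₀ i₁ i₂ i₃ := i₃) ≡.refl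
      (toℚ n) (ind 0 0 0 a b c) (ind 1 0 0 a b c) (ind 0 1 0 a b c) (ind 0 0 1 a b c))

*ₛ≡* : ∀ s t → s *ₛ t ≡ s Ser.* t
*ₛ≡* s t = ≡.refl

-- Stated for abstract operations: comparing the two nested products directly unfolds them completely.
nested₄ : {A : Set} {_∙_ _∗_ : A → A → A} → (∀ s t → s ∙ t ≡ s ∗ t) →
  ∀ s t u v → s ∙ (t ∙ (u ∙ v)) ≡ s ∗ (t ∗ (u ∗ v))
nested₄ {_∗_ = _∗_} eq s t u v =
  ≡.trans (eq s _) (≡.cong (s ∗_) (≡.trans (eq t _) (≡.cong (t ∗_) (eq u v))))

fSeries≡ : ∀ n → fSeries n ≡ factor n pos pos pos Ser.*
  (factor n pos neg neg Ser.* (factor n neg pos neg Ser.* factor n neg neg pos))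
fSeries≡ n = nested₄ *ₛ≡*
  (factor n pos pos pos) (factor n pos neg neg) (factor n neg pos neg) (factor n neg neg pos)

module Generating (n : ℕ) where
  open Poly³ using (module Axis₁; module Axis₂; module Axis₃; C)
  open Exponents n
  private
    module F₁ = Factor n pos pos pos
    module F₂ = Factor n pos neg neg
    module F₃ = Factor n neg pos neg
    module F₄ = Factor n neg neg pos
    module S₁ = F₁.Solutions ≡.refl ≡.refl ≡.refl ≡.refl ≡.refl ≡.refl
    module S₂ = F₂.Solutions ≡.refl ≡.refl ≡.refl ≡.refl ≡.refl ≡.refl
    module S₃ = F₃.Solutions ≡.refl ≡.refl ≡.refl ≡.refl ≡.refl ≡.refl
    module S₄ = F₄.Solutions ≡.refl ≡.refl ≡.refl ≡.refl ≡.refl ≡.refl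

    N : Poly3
    N = constₚ (toℚ n)

    ∑γ : C F₁.α Ser.+ (C F₂.α Ser.+ (C F₃.α Ser.+ C F₄.α)) Ser.≈ C N
    ∑γ = Poly³.C-∑₄ {F₁.α} {F₂.α} {F₃.α} {F₄.α} {N} ∑α

  fSeries-solves₁ : Axis₁.Solves (C (monₚ 1ℚ 1 0 0)) (C (constₚ (toℚ n))) (fSeries n)
  fSeries-solves₁ = ≡.subst (Axis₁.Solves (C (monₚ 1ℚ 1 0 0)) (C N)) (≡.sym (fSeries≡ n)) (Axis₁.Solves-*₄
    {C (F₁.ε₁ *ₚ F₁.α)} {C (F₂.ε₁ *ₚ F₂.α)} {C (F₃.ε₁ *ₚ F₃.α)} {C (F₄.ε₁ *ₚ F₄.α)} {C (monₚ 1ℚ 1 0 0)}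
    {C F₁.α} {C F₂.α} {C F₃.α} {C F₄.α} {C N} {F₁.series} {F₂.series} {F₃.series} {F₄.series}
    {factor n pos pos pos} {factor n pos neg neg} {factor n neg pos neg} {factor n neg neg pos}
    (Poly³.C-∑₄ {F₁.ε₁ *ₚ F₁.α} {F₂.ε₁ *ₚ F₂.α} {F₃.ε₁ *ₚ F₃.α} {F₄.ε₁ *ₚ F₄.α} {monₚ 1ℚ 1 0 0} ∑αx)
    ∑γ F₁.factor≈ F₂.factor≈ F₃.factor≈ F₄.factor≈ S₁.solves₁ S₂.solves₁ S₃.solves₁ S₄.solves₁)

  fSeries-solves₂ : Axis₂.Solves (C (monₚ 1ℚ 0 1 0)) (C (constₚ (toℚ n))) (fSeries n)
  fSeries-solves₂ = ≡.subst (Axis₂.Solves (C (monₚ 1ℚ 0 1 0)) (C N)) (≡.sym (fSeries≡ n)) (Axis₂.Solves-*₄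
    {C (F₁.ε₂ *ₚ F₁.α)} {C (F₂.ε₂ *ₚ F₂.α)} {C (F₃.ε₂ *ₚ F₃.α)} {C (F₄.ε₂ *ₚ F₄.α)} {C (monₚ 1ℚ 0 1 0)}
    {C F₁.α} {C F₂.α} {C F₃.α} {C F₄.α} {C N} {F₁.series} {F₂.series} {F₃.series} {F₄.series}
    {factor n pos pos pos} {factor n pos neg neg} {factor n neg pos neg} {factor n neg neg pos}
    (Poly³.C-∑₄ {F₁.ε₂ *ₚ F₁.α} {F₂.ε₂ *ₚ F₂.α} {F₃.ε₂ *ₚ F₃.α} {F₄.ε₂ *ₚ F₄.α} {monₚ 1ℚ 0 1 0} ∑αy)
    ∑γ F₁.factor≈ F₂.factor≈ F₃.factor≈ F₄.factor≈ S₁.solves₂ S₂.solves₂ S₃.solves₂ S₄.solves₂)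

  fSeries-solves₃ : Axis₃.Solves (C (monₚ 1ℚ 0 0 1)) (C (constₚ (toℚ n))) (fSeries n)
  fSeries-solves₃ = ≡.subst (Axis₃.Solves (C (monₚ 1ℚ 0 0 1)) (C N)) (≡.sym (fSeries≡ n)) (Axis₃.Solves-*₄
    {C (F₁.ε₃ *ₚ F₁.α)} {C (F₂.ε₃ *ₚ F₂.α)} {C (F₃.ε₃ *ₚ F₃.α)} {C (F₄.ε₃ *ₚ F₄.α)} {C (monₚ 1ℚ 0 0 1)}
    {C F₁.α} {C F₂.α} {C F₃.α} {C F₄.α} {C N} {F₁.series} {F₂.series} {F₃.series} {F₄.series}
    {factor n pos pos pos} {factor n pos neg neg} {factor n neg pos neg} {factor n neg neg pos}
    (Poly³.C-∑₄ {F₁.ε₃ *ₚ F₁.α} {F₂.ε₃ *ₚ F₂.α} {F₃.ε₃ *ₚ F₃.α} {F₄.ε₃ *ₚ F₄.α} {monₚ 1ℚ 0 0 1} ∑αz)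
    ∑γ F₁.factor≈ F₂.factor≈ F₃.factor≈ F₄.factor≈ S₁.solves₃ S₂.solves₃ S₃.solves₃ S₄.solves₃)

  fSeries-000 : fSeries n 0 0 0 Poly.≈ constₚ 1ℚ
  fSeries-000 = Poly³.constant-term-* {factor n pos pos pos}
    {factor n pos neg neg *ₛ (factor n neg pos neg *ₛ factor n neg neg pos)} F₁.constant-term
    (Poly³.constant-term-* {factor n pos neg neg} {factor n neg pos neg *ₛ factor n neg neg pos}
      F₂.constant-term (Poly³.constant-term-* {factor n neg pos neg} {factor n neg neg pos}
        F₃.constant-term F₄.constant-term))

-- Sums over neighbours and over the cells of a partition.

dist-sym : ∀ {n} (v w : Vertex n) → dist v w ≡ dist w v
dist-sym []      []      = ≡.refl
dist-sym (a ∷ v) (b ∷ w) = ≡.cong₂ (λ d → (if d then 1 else 0) ℕ.+_) (differ-sym a b) (dist-sym v w)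
  where
  differ-sym : ∀ a b → differ a b ≡ differ b a
  differ-sym false false = ≡.refl
  differ-sym false true  = ≡.refl
  differ-sym true  false = ≡.refl
  differ-sym true  true  = ≡.refl

module CubeSums (M : CommutativeMonoid 0ℓ 0ℓ) where
  open CommutativeMonoid M
  open Sums M
  open MonoidMult M using (_×_)
  open SetoidReasoning setoid

  if-cong : ∀ b {x y} → x ≈ y → (if b then x else ε) ≈ (if b then y else ε)
  if-cong true  xy = xy
  if-cong false xy = refl

  ∑-if-∧ : {I : Set} (xs : List I) (b : Bool) (p : I → Bool) (f : I → Carrier) →
    ∑ xs (λ x → if b ∧ p x then f x else ε) ≈ (if b then ∑ xs (λ x → if p x then f x else ε) else ε)
  ∑-if-∧ xs true  p f = refl
  ∑-if-∧ xs false p f = ∑-ε xs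

  ∑-if : {I : Set} (xs : List I) (b : Bool) (f : I → Carrier) →
    ∑ xs (λ x → if b then f x else ε) ≈ (if b then ∑ xs f else ε)
  ∑-if xs true  f = refl
  ∑-if xs false f = ∑-ε xs

  count-× : {I : Set} (p : I → Bool) (xs : List I) (x : Carrier) →
    count p xs × x ≈ ∑ xs (λ i → if p i then x else ε)
  count-× p []       x = refl
  count-× p (i ∷ xs) x with p i
  ... | true  = ∙-congˡ (count-× p xs x)
  ... | false = trans (count-× p xs x) (sym (identityˡ _))

  ∑-allFin-δ : ∀ {m} (i : Fin m) (f : Fin m → Carrier) → (∀ t → i ≢ t → f t ≈ ε) →
    ∑ (allFin m) f ≈ f i
  ∑-allFin-δ {suc m} i f f≈ε = trans (∙-congˡ (reflexive tail≡)) (split i f≈ε)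
    where
    tail≡ : ∑ (tabulate suc) f ≡ ∑ (allFin m) (f ∘ suc)
    tail≡ = ≡.cong (sumL _∙_ ε) (≡.trans (map-tabulate suc f) (≡.sym (map-tabulate id (f ∘ suc))))
    split : ∀ i → (∀ t → i ≢ t → f t ≈ ε) → f zero ∙ ∑ (allFin m) (f ∘ suc) ≈ f i
    split zero    f≈ε = trans
      (∙-congˡ (trans (∑-cong (allFin m) (λ t → f≈ε (suc t) λ ())) (∑-ε (allFin m)))) (identityʳ _)
    split (suc i) f≈ε = trans (∙-cong (f≈ε zero λ ()) (∑-allFin-δ i (f ∘ suc)
      (λ t i≢t → f≈ε (suc t) (λ { ≡.refl → i≢t ≡.refl })))) (identityˡ _)

  ∑-allVertices-suc : ∀ n (φ : Vertex (suc n) → Carrier) →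
    ∑ (allVertices (suc n)) φ ≈ ∑ (allVertices n) (λ w → φ (false ∷ w) ∙ φ (true ∷ w))
  ∑-allVertices-suc n φ = go (allVertices n)
    where
    go : ∀ vs → ∑ (concatMap (λ v → (false ∷ v) ∷ (true ∷ v) ∷ []) vs) φ ≈
                ∑ vs (λ w → φ (false ∷ w) ∙ φ (true ∷ w))
    go []       = refl
    go (v ∷ vs) = trans (∙-congˡ (∙-congˡ (go vs))) (sym (assoc _ _ _))

  ∑-at-distance : ∀ {n} → ℕ → Vertex n → (Vertex n → Carrier) → Carrier
  ∑-at-distance {n} d v φ = ∑ (allVertices n) (λ w → if dist v w ℕ.≡ᵇ d then φ w else ε)

  ∑-neighbours : ∀ {n} → Vertex n → (Vertex n → Carrier) → Carrier
  ∑-neighbours = ∑-at-distance 1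

  ∑-neighbours-cong : ∀ {n} (v : Vertex n) {φ ψ : Vertex n → Carrier} → (∀ w → φ w ≈ ψ w) →
    ∑-neighbours v φ ≈ ∑-neighbours v ψ
  ∑-neighbours-cong {n} v e = ∑-cong (allVertices n) (λ w → if-cong (dist v w ℕ.≡ᵇ 1) (e w))

  ∑-distance-0 : ∀ {n} (v : Vertex n) (φ : Vertex n → Carrier) → ∑-at-distance 0 v φ ≈ φ v
  ∑-distance-0 []      φ = identityʳ _
  ∑-distance-0 {suc n} (false ∷ v) φ = trans (∑-allVertices-suc n _)
    (trans (∑-cong (allVertices n) (λ w → identityʳ _)) (∑-distance-0 v (φ ∘ (false ∷_))))
  ∑-distance-0 {suc n} (true  ∷ v) φ = trans (∑-allVertices-suc n _)
    (trans (∑-cong (allVertices n) (λ w → identityˡ _)) (∑-distance-0 v (φ ∘ (true ∷_))))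

  -- A neighbour either flips the head and keeps the tail, which is distance 0 there, or keeps the
  -- head and moves to a neighbour of the tail.
  ∑-neighbours-∷ : ∀ {n} a (v : Vertex n) (φ : Vertex (suc n) → Carrier) →
    ∑-neighbours (a ∷ v) φ ≈ φ (not a ∷ v) ∙ ∑-neighbours v (φ ∘ (a ∷_))
  ∑-neighbours-∷ {n} false v φ = trans (∑-allVertices-suc n _) (trans (∑-∙ (allVertices n))
    (trans (comm _ _) (∙-congʳ (∑-distance-0 v (φ ∘ (true ∷_))))))
  ∑-neighbours-∷ {n} true  v φ = trans (∑-allVertices-suc n _) (trans (∑-∙ (allVertices n))
    (∙-congʳ (∑-distance-0 v (φ ∘ (false ∷_)))))

  module Cells {n m : ℕ} (C : Vertex n → Fin m) where

    ∑-cell : Fin m → (Vertex n → Carrier) → Carrier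
    ∑-cell i φ = ∑ (allVertices n) (λ v → if ⌊ C v ≟ᶠ i ⌋ then φ v else ε)

    ∑-cell-cong : ∀ i {φ ψ : Vertex n → Carrier} → (∀ v → φ v ≈ ψ v) → ∑-cell i φ ≈ ∑-cell i ψ
    ∑-cell-cong i e = ∑-cong (allVertices n) (λ v → if-cong ⌊ C v ≟ᶠ i ⌋ (e v))

    ∑-cell-∙ : ∀ i {φ ψ : Vertex n → Carrier} → ∑-cell i (λ v → φ v ∙ ψ v) ≈ ∑-cell i φ ∙ ∑-cell i ψ
    ∑-cell-∙ i = trans (∑-cong (allVertices n) (λ v → if-∙ ⌊ C v ≟ᶠ i ⌋)) (∑-∙ (allVertices n))
      where
      if-∙ : ∀ b {x y} → (if b then x ∙ y else ε) ≈ (if b then x else ε) ∙ (if b then y else ε)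
      if-∙ true  = refl
      if-∙ false = sym (identityˡ ε)

    ∑-cell-ε : ∀ i → ∑-cell i (λ _ → ε) ≈ ε
    ∑-cell-ε i = trans (∑-cong (allVertices n) (λ v → if-ε ⌊ C v ≟ᶠ i ⌋)) (∑-ε (allVertices n))
      where
      if-ε : ∀ b → (if b then ε else ε) ≈ ε
      if-ε true  = refl
      if-ε false = refl

    ∑-cell-∑ : {I : Set} (i : Fin m) (ts : List I) {φ : I → Vertex n → Carrier} →
      ∑ ts (λ t → ∑-cell i (φ t)) ≈ ∑-cell i (λ v → ∑ ts (λ t → φ t v))
    ∑-cell-∑ i ts = trans (∑-swap ts (allVertices n)) (∑-cong (allVertices n) (λ v → ∑-if ts _ _))

    ∑-cell-× : ∀ i k {φ : Vertex n → Carrier} → k × ∑-cell i φ ≈ ∑-cell i (λ v → k × φ v)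
    ∑-cell-× i zero    = sym (∑-cell-ε i)
    ∑-cell-× i (suc k) = trans (∙-congˡ (∑-cell-× i k)) (sym (∑-cell-∙ i))

    -- Double counting of the edges between a cell and the whole cube.
    quotient-action : ∀ {S} → IsEquitable C S → ∀ i (φ : Vertex n → Carrier) →
      ∑ (allFin m) (λ t → S t i × ∑-cell t φ) ≈ ∑-cell i (λ w → ∑-neighbours w φ)
    quotient-action {S} eq i φ = begin
      ∑ (allFin m) (λ t → S t i × ∑-cell t φ)
        ≈⟨ ∑-cong (allFin m) (λ t → ∑-cell-× t (S t i)) ⟩
      ∑ (allFin m) (λ t → ∑ (allVertices n) (λ v → if ⌊ C v ≟ᶠ t ⌋ then S t i × φ v else ε))
        ≈⟨ ∑-swap (allFin m) (allVertices n) ⟩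
      ∑ (allVertices n) (λ v → ∑ (allFin m) (λ t → if ⌊ C v ≟ᶠ t ⌋ then S t i × φ v else ε))
        -- Only t = C v survives, and equitability, read at the vertex v itself, turns the matrix
        -- entry into a count of neighbours of v.
        ≈⟨ ∑-cong (allVertices n) (λ v → trans (∑-allFin-δ (C v) _ (off v)) (on v)) ⟩
      ∑ (allVertices n) (λ v → nbrCount C v i × φ v)
        ≈⟨ ∑-cong (allVertices n) (λ v → count-× _ (allVertices n) (φ v)) ⟩
      ∑ (allVertices n) (λ v → ∑ (allVertices n) (λ w →
        if (dist v w ℕ.≡ᵇ 1) ∧ ⌊ C w ≟ᶠ i ⌋ then φ v else ε))
        ≈⟨ ∑-swap (allVertices n) (allVertices n) ⟩
      ∑ (allVertices n) (λ w → ∑ (allVertices n) (λ v →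
        if (dist v w ℕ.≡ᵇ 1) ∧ ⌊ C w ≟ᶠ i ⌋ then φ v else ε))
        -- Adjacency is symmetric: the cell condition now concerns the outer vertex w, and the inner
        -- sum runs over the neighbours v of w.
        ≈⟨ ∑-cong (allVertices n) (λ w → trans
             (∑-cong (allVertices n) (λ v → reflexive (≡.cong (λ b → if b then φ v else ε)
               (≡.trans (∧-comm (dist v w ℕ.≡ᵇ 1) _)
                 (≡.cong (λ d → ⌊ C w ≟ᶠ i ⌋ ∧ (d ℕ.≡ᵇ 1)) (dist-sym v w))))))
             (∑-if-∧ (allVertices n) ⌊ C w ≟ᶠ i ⌋ (λ v → dist w v ℕ.≡ᵇ 1) φ)) ⟩
      ∑-cell i (λ w → ∑-neighbours w φ) ∎
      where
      off : ∀ v t → C v ≢ t → (if ⌊ C v ≟ᶠ t ⌋ then S t i × φ v else ε) ≈ ε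
      off v t Cv≢t with C v ≟ᶠ t
      ... | yes Cv≡t = ⊥-elim (Cv≢t Cv≡t)
      ... | no  _    = refl
      on : ∀ v → (if ⌊ C v ≟ᶠ C v ⌋ then S (C v) i × φ v else ε) ≈ nbrCount C v i × φ v
      on v with C v ≟ᶠ C v
      ... | yes _   = reflexive (≡.cong (_× φ v) (≡.sym (eq (C v) i v ≡.refl)))
      ... | no  C≢C = ⊥-elim (C≢C ≡.refl)

    ∑-neighbours-cell : ∀ w j {ψ : Vertex n → Vertex n → Carrier} →
      ∑-neighbours w (λ v → ∑-cell j (ψ v)) ≈ ∑-cell j (λ x → ∑-neighbours w (λ v → ψ v x))
    ∑-neighbours-cell w j {ψ} = trans
      (∑-cong (allVertices n) (λ v → if-cell (dist w v ℕ.≡ᵇ 1) (ψ v))) (∑-cell-∑ j (allVertices n))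
      where
      if-cell : ∀ b (φ : Vertex n → Carrier) →
        (if b then ∑-cell j φ else ε) ≈ ∑-cell j (λ x → if b then φ x else ε)
      if-cell true  φ = refl
      if-cell false φ = sym (∑-cell-ε j)

    ∑-cell³ : Fin m → Fin m → Fin m → (Vertex n → Vertex n → Vertex n → Carrier) → Carrier
    ∑-cell³ i j k Φ = ∑-cell i (λ v → ∑-cell j (λ x → ∑-cell k (λ y → Φ v x y)))

    ∑-cell³-cong : ∀ i j k {Φ Ψ : Vertex n → Vertex n → Vertex n → Carrier} →
      (∀ v x y → Φ v x y ≈ Ψ v x y) → ∑-cell³ i j k Φ ≈ ∑-cell³ i j k Ψ
    ∑-cell³-cong i j k e = ∑-cell-cong i (λ v → ∑-cell-cong j (λ x → ∑-cell-cong k (e v x)))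

    ∑-cell³-∙ : ∀ i j k {Φ Ψ : Vertex n → Vertex n → Vertex n → Carrier} →
      ∑-cell³ i j k (λ v x y → Φ v x y ∙ Ψ v x y) ≈ ∑-cell³ i j k Φ ∙ ∑-cell³ i j k Ψ
    ∑-cell³-∙ i j k = trans (∑-cell-cong i (λ v → trans (∑-cell-cong j (λ x → ∑-cell-∙ k)) (∑-cell-∙ j)))
      (∑-cell-∙ i)

    module _ {S : Fin m → Fin m → ℕ} (eq : IsEquitable C S) (i j k : Fin m)
      (Φ : Vertex n → Vertex n → Vertex n → Carrier) where

      private
        -- Moves the sum over t inside the cells that stay fixed, until `quotient-action` applies at
        -- the cell that varies.
        inner : ∀ l {φ : Fin m → Vertex n → Carrier} (s : Fin m → ℕ) →
          ∑ (allFin m) (λ t → s t × ∑-cell l (φ t)) ≈ ∑-cell l (λ v → ∑ (allFin m) (λ t → s t × φ t v))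
        inner l s = trans (∑-cong (allFin m) (λ t → ∑-cell-× l (s t))) (∑-cell-∑ l (allFin m))

      action₁ : ∑ (allFin m) (λ t → S t i × ∑-cell³ t j k Φ) ≈
        ∑-cell³ i j k (λ w x y → ∑-neighbours w (λ v → Φ v x y))
      action₁ = trans (quotient-action eq i _) (∑-cell-cong i (λ w → trans (∑-neighbours-cell w j)
        (∑-cell-cong j (λ x → ∑-neighbours-cell w k))))

      action₂ : ∑ (allFin m) (λ t → S t j × ∑-cell³ i t k Φ) ≈
        ∑-cell³ i j k (λ v w y → ∑-neighbours w (λ x → Φ v x y))
      action₂ = trans (inner i (λ t → S t j)) (∑-cell-cong i (λ v → trans (quotient-action eq j _)
        (∑-cell-cong j (λ w → ∑-neighbours-cell w k))))

      action₃ : ∑ (allFin m) (λ t → S t k × ∑-cell³ i j t Φ) ≈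
        ∑-cell³ i j k (λ v x w → ∑-neighbours w (λ y → Φ v x y))
      action₃ = trans (inner i (λ t → S t k)) (∑-cell-cong i (λ v → trans (inner j (λ t → S t k))
        (∑-cell-cong j (λ x → quotient-action eq k _))))

module CellHomo {M N : CommutativeMonoid 0ℓ 0ℓ} (φ : M →⁺ N) {n m : ℕ} (C : Vertex n → Fin m) where
  private
    module M = CommutativeMonoid M
    module N = CommutativeMonoid N
    module CM = CubeSums.Cells M C
    module CN = CubeSums.Cells N C
  open _→⁺_ φ
  open Additive φ

  ∑-cell-homo : ∀ i (f : Vertex n → M.Carrier) → ⟦ CM.∑-cell i f ⟧ N.≈ CN.∑-cell i (λ v → ⟦ f v ⟧)
  ∑-cell-homo i f = N.trans (∑-homo (allVertices n))
    (Sums.∑-cong N (allVertices n) (λ v → if-homo ⌊ C v ≟ᶠ i ⌋ (f v)))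

  ∑-cell³-homo : ∀ i j k (Φ : Vertex n → Vertex n → Vertex n → M.Carrier) →
    ⟦ CM.∑-cell³ i j k Φ ⟧ N.≈ CN.∑-cell³ i j k (λ v x y → ⟦ Φ v x y ⟧)
  ∑-cell³-homo i j k Φ = N.trans (∑-cell-homo i _) (CN.∑-cell-cong i (λ v →
    N.trans (∑-cell-homo j _) (CN.∑-cell-cong j (λ x → ∑-cell-homo k (Φ v x)))))

-- The weight of a triple of vertices and its neighbour sums.

-- The variable recording which of three bits is the odd one out.
weight : {A : Set} (one X Y Z : A) → Bool → Bool → Bool → A
weight one X Y Z false false false = one
weight one X Y Z true  true  true  = one
weight one X Y Z true  false false = X
weight one X Y Z false true  true  = X
weight one X Y Z false true  false = Y
weight one X Y Z true  false true  = Y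
weight one X Y Z false false true  = Z
weight one X Y Z true  true  false = Z

module TripleWeight (A : CSemiring) where
  open CommutativeSemiring A

  ∏ : (Bool → Bool → Bool → Carrier) → ∀ {n} → Vertex n → Vertex n → Vertex n → Carrier
  ∏ ω []      []      []      = 1#
  ∏ ω (a ∷ v) (b ∷ x) (c ∷ y) = ω a b c * ∏ ω v x y

  module _ {ω ω′ : Bool → Bool → Bool → Carrier} where
    -- The weight `ω′` belongs to another axis, whose moving vertex is listed first; this brings it
    -- back to the common order v, x, y.
    ∏-rotate₂ : (∀ a b c → ω′ b a c ≡ ω a b c) → ∀ {n} (v x y : Vertex n) → ∏ ω′ x v y ≡ ∏ ω v x y
    ∏-rotate₂ e []      []      []      = ≡.refl
    ∏-rotate₂ e (a ∷ v) (b ∷ x) (c ∷ y) = ≡.cong₂ _*_ (e a b c) (∏-rotate₂ e v x y)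

    ∏-rotate₃ : (∀ a b c → ω′ c a b ≡ ω a b c) → ∀ {n} (v x y : Vertex n) → ∏ ω′ y v x ≡ ∏ ω v x y
    ∏-rotate₃ e []      []      []      = ≡.refl
    ∏-rotate₃ e (a ∷ v) (b ∷ x) (c ∷ y) = ≡.cong₂ _*_ (e a b c) (∏-rotate₃ e v x y)

record Coordinates (A : CSemiring) (X Y Z : CommutativeSemiring.Carrier A) (DX DY DZ : Derivation A) : Set where
  open CommutativeSemiring A
  open Derivation
  field
    x1 : δ DX 1# ≈ 0#
    y1 : δ DY 1# ≈ 0#
    z1 : δ DZ 1# ≈ 0#
    xx : δ DX X ≈ 1#
    yx : δ DY X ≈ 0#
    zx : δ DZ X ≈ 0#
    xy : δ DX Y ≈ 0#
    yy : δ DY Y ≈ 1#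
    zy : δ DZ Y ≈ 0#
    xz : δ DX Z ≈ 0#
    yz : δ DY Z ≈ 0#
    zz : δ DZ Z ≈ 1#

module Neighbours (A : CSemiring) (X Y Z : CommutativeSemiring.Carrier A) (DX DY DZ : Derivation A)
  (coordinates : Coordinates A X Y Z DX DY DZ) where
  open CommutativeSemiring A hiding (zero)
  open Axis A X Y Z DX DY DZ using (P; P-*; P-cong; P-+; E; E-*; E-cong; E-+)
  open Coordinates coordinates
  open CubeSums +-commutativeMonoid
  open TripleWeight A
  open SemiringMult semiring using (_×_; ×-congʳ; ×-comm-*)
  open MonoidMult +-commutativeMonoid using (×-distrib-+)
  open SemiringSolver A using (solve; _:=_; _:+_; _:*_; con)
  open SetoidReasoning setoid
  open Derivation

  ω : Bool → Bool → Bool → Carrier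
  ω = weight 1# X Y Z

  private
    values : ∀ {s s′ p q r} → δ DX s ≈ p → δ DY s ≈ q → δ DZ s ≈ r →
      (p + (Y * r + Z * q)) + X * s ≈ s′ + X * (X * p + (Y * q + Z * r)) →
      P s + X * s ≈ s′ + X * E s
    values {s} {s′} p q r e = trans (+-congʳ (+-cong p (+-cong (*-congˡ r) (*-congˡ q))))
      (trans e (+-congˡ (*-congˡ (sym (+-cong (*-congˡ p) (+-cong (*-congˡ q) (*-congˡ r)))))))

    flip-1 : P 1# + X * 1# ≈ X + X * E 1#
    flip-1 = values x1 y1 z1 (solve 3 (λ x y z →
      (con 0 :+ (y :* con 0 :+ z :* con 0)) :+ x :* con 1 :=
      x :+ x :* (x :* con 0 :+ (y :* con 0 :+ z :* con 0))) refl X Y Z)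

    flip-X : P X + X * X ≈ 1# + X * E X
    flip-X = values xx yx zx (solve 3 (λ x y z →
      (con 1 :+ (y :* con 0 :+ z :* con 0)) :+ x :* x :=
      con 1 :+ x :* (x :* con 1 :+ (y :* con 0 :+ z :* con 0))) refl X Y Z)

    flip-Y : P Y + X * Y ≈ Z + X * E Y
    flip-Y = values xy yy zy (solve 3 (λ x y z →
      (con 0 :+ (y :* con 0 :+ z :* con 1)) :+ x :* y :=
      z :+ x :* (x :* con 0 :+ (y :* con 1 :+ z :* con 0))) refl X Y Z)

    flip-Z : P Z + X * Z ≈ Y + X * E Z
    flip-Z = values xz yz zz (solve 3 (λ x y z →
      (con 0 :+ (y :* con 1 :+ z :* con 0)) :+ x :* z :=
      y :+ x :* (x :* con 0 :+ (y :* con 0 :+ z :* con 1))) refl X Y Z)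

    -- On X, Y and Z, which have degree one, X s cancels against X E s and `P` alone makes the
    -- exchange. On 1 both `P` and `E` vanish, and the term X · 1 is the weight after the flip.
    flip : ∀ a b c → P (ω a b c) + X * ω a b c ≈ ω (not a) b c + X * E (ω a b c)
    flip false false false = flip-1
    flip true  true  true  = flip-1
    flip true  false false = flip-X
    flip false true  true  = flip-X
    flip false true  false = flip-Y
    flip true  false true  = flip-Y
    flip false false true  = flip-Z
    flip true  true  false = flip-Z

    scale : Carrier → +-commutativeMonoid →⁺ +-commutativeMonoid
    scale r = record { ⟦_⟧ = r *_ ; cong = *-congˡ ; ∙-homo = distribˡ r ; ε-homo = zeroʳ r }

  ∑-neighbours-* : ∀ {n} r (v : Vertex n) (φ : Vertex n → Carrier) →
    ∑-neighbours v (λ w → r * φ w) ≈ r * ∑-neighbours v φ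
  ∑-neighbours-* {n} r v φ = sym (trans (Additive.∑-homo (scale r) (allVertices n))
    (Sums.∑-cong +-commutativeMonoid (allVertices n)
      (λ w → Additive.if-homo (scale r) (dist v w ℕ.≡ᵇ 1) (φ w))))

  -- The Leibniz rule for `P` and `E` runs parallel to the choice of the coordinate that is flipped.
  -- Each coordinate uses up one copy of X times the weight, which accounts for the multiple n.
  neighbours : ∀ {n} (v x y : Vertex n) →
    P (∏ ω v x y) + n × (X * ∏ ω v x y) ≈ ∑-neighbours v (λ w → ∏ ω w x y) + X * E (∏ ω v x y)
  neighbours [] [] [] = begin
    P 1# + 0#            ≈⟨ +-identityʳ _ ⟩
    P 1#                 ≈⟨ +-cong x1 (+-cong (*-congˡ z1) (*-congˡ y1)) ⟩
    0# + (Y * 0# + Z * 0#) ≈⟨ solve 3 (λ x y z → con 0 :+ (y :* con 0 :+ z :* con 0) :=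
                                (con 0 :+ con 0) :+ x :* (x :* con 0 :+ (y :* con 0 :+ z :* con 0))) refl X Y Z ⟩
    (0# + 0#) + X * (X * 0# + (Y * 0# + Z * 0#))
                         ≈⟨ +-congˡ (*-congˡ (+-cong (*-congˡ x1) (+-cong (*-congˡ y1) (*-congˡ z1)))) ⟨
    (0# + 0#) + X * E 1# ∎
  neighbours {suc n} (a ∷ v) (b ∷ x) (c ∷ y) = begin
    P (w * G) + (X * (w * G) + n × (X * (w * G)))
      ≈⟨ +-cong (P-* w G) (+-congˡ (trans (×-congʳ n (solve 3 (λ x w g → x :* (w :* g) := w :* (x :* g)) refl X w G))
           (sym (×-comm-* n w (X * G))))) ⟩
    (P w * G + w * P G) + (X * (w * G) + w * (n × (X * G)))
      ≈⟨ solve 6 (λ x w g p p′ r → (p :* g :+ w :* p′) :+ (x :* (w :* g) :+ w :* r) :=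
           (p :+ x :* w) :* g :+ w :* (p′ :+ r)) refl X w G (P w) (P G) (n × (X * G)) ⟩
    (P w + X * w) * G + w * (P G + n × (X * G))
      ≈⟨ +-cong (*-congʳ (flip a b c)) (*-congˡ (neighbours v x y)) ⟩
    (w′ + X * E w) * G + w * (N + X * E G)
      ≈⟨ solve 7 (λ x w w′ g e e′ n → (w′ :+ x :* e) :* g :+ w :* (n :+ x :* e′) :=
           (w′ :* g :+ w :* n) :+ x :* (e :* g :+ w :* e′)) refl X w w′ G (E w) (E G) N ⟩
    (w′ * G + w * N) + X * (E w * G + w * E G)
      ≈⟨ +-cong (+-congˡ (∑-neighbours-* w v _)) (*-congˡ (E-* w G)) ⟨
    (w′ * G + ∑-neighbours v (λ u → w * ∏ ω u x y)) + X * E (w * G)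
      ≈⟨ +-congʳ (∑-neighbours-∷ a v (λ u → ∏ ω u (b ∷ x) (c ∷ y))) ⟨
    ∑-neighbours (a ∷ v) (λ u → ∏ ω u (b ∷ x) (c ∷ y)) + X * E (w * G) ∎
    where
    w w′ G N : Carrier
    w  = ω a b c
    w′ = ω (not a) b c
    G  = ∏ ω v x y
    N  = ∑-neighbours v (λ u → ∏ ω u x y)

  private
    -- Additivity gives only P 0 = P 0 + P 0, which cannot be cancelled here; the Leibniz rule
    -- applied to 0 = 0 · 0 does better.
    P-0 : P 0# ≈ 0#
    P-0 = trans (P-cong (sym (zeroˡ 0#))) (trans (P-* 0# 0#) (trans (+-cong (zeroʳ _) (zeroˡ _)) (+-identityˡ 0#)))

    E-0 : E 0# ≈ 0#
    E-0 = trans (E-cong (sym (zeroˡ 0#))) (trans (E-* 0# 0#) (trans (+-cong (zeroʳ _) (zeroˡ _)) (+-identityˡ 0#)))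

    ×-0 : ∀ n → n × (X * 0#) ≈ 0#
    ×-0 zero    = refl
    ×-0 (suc n) = trans (+-cong (zeroʳ X) (×-0 n)) (+-identityˡ 0#)

    -- Both operators in the neighbour identity are additive and vanish at 0, so the identity for
    -- one triple can be summed over any cells.
    left : ℕ → +-commutativeMonoid →⁺ +-commutativeMonoid
    left n = record
      { ⟦_⟧ = λ s → P s + n × (X * s)
      ; cong = λ e → +-cong (P-cong e) (×-congʳ n (*-congˡ e))
      ; ∙-homo = λ s t → trans
          (+-cong (P-+ s t) (trans (×-congʳ n (distribˡ X s t)) (×-distrib-+ _ _ n)))
          (solve 4 (λ a b c d → (a :+ b) :+ (c :+ d) := (a :+ c) :+ (b :+ d)) refl _ _ _ _)
      ; ε-homo = trans (+-cong P-0 (×-0 n)) (+-identityˡ 0#) }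

    right : +-commutativeMonoid →⁺ +-commutativeMonoid
    right = record
      { ⟦_⟧ = λ s → X * E s ; cong = λ e → *-congˡ (E-cong e)
      ; ∙-homo = λ s t → trans (*-congˡ (E-+ s t)) (distribˡ X _ _)
      ; ε-homo = trans (*-congˡ E-0) (zeroʳ X) }

  module _ {n m : ℕ} (C : Vertex n → Fin m) (i j k : Fin m) where
    open Cells C

    -- Φ is ∏ ω up to the order of its arguments, ν the neighbour sum in the moving argument.
    summed : (Φ ν : Vertex n → Vertex n → Vertex n → Carrier) {T : Carrier} →
      (∀ v x y → P (Φ v x y) + n × (X * Φ v x y) ≈ ν v x y + X * E (Φ v x y)) →
      T ≈ ∑-cell³ i j k ν →
      P (∑-cell³ i j k Φ) + n × (X * ∑-cell³ i j k Φ) ≈ T + X * E (∑-cell³ i j k Φ)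
    summed Φ ν {T} e Te = begin
      P (∑-cell³ i j k Φ) + n × (X * ∑-cell³ i j k Φ)
        ≈⟨ CellHomo.∑-cell³-homo (left n) C i j k Φ ⟩
      ∑-cell³ i j k (λ v x y → P (Φ v x y) + n × (X * Φ v x y))
        ≈⟨ ∑-cell³-cong i j k e ⟩
      ∑-cell³ i j k (λ v x y → ν v x y + X * E (Φ v x y))
        ≈⟨ ∑-cell³-∙ i j k ⟩
      ∑-cell³ i j k ν + ∑-cell³ i j k (λ v x y → X * E (Φ v x y))
        ≈⟨ +-cong Te (CellHomo.∑-cell³-homo right C i j k Φ) ⟨
      T + X * E (∑-cell³ i j k Φ) ∎

-- The differential equations as recurrences between coefficients.

module Recurrences (R : CSemiring) where
  open CommutativeSemiring R hiding (zero)
  open Series3 R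
  open MonoidMult +-commutativeMonoid using (_×_; ×-congʳ)
  private
    module S = CommutativeSemiring semiring³
  open MonoidMult S.+-commutativeMonoid using () renaming (_×_ to _×³_)

  up₁ up₂ up₃ weighted : S³ → S³
  up₁ s a b c = suc a × s (suc a) b c
  up₂ s a b c = suc b × s a (suc b) c
  up₃ s a b c = suc c × s a b (suc c)
  weighted s a b c = (a ℕ.+ b ℕ.+ c) × s a b c

  -- In `low₁` these are the terms Y∂_Z, Z∂_Y and nX. The first two preserve the total degree and
  -- the third reads one degree below, whereas `up₁`, from ∂_X, reads one degree above.
  low₁ low₂ low₃ : ℕ → S³ → S³
  low₁ n s a b c = (shiftY (up₃ s) a b c + shiftZ (up₂ s) a b c) + n × shiftX s a b c
  low₂ n s a b c = (shiftX (up₃ s) a b c + shiftZ (up₁ s) a b c) + n × shiftY s a b c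
  low₃ n s a b c = (shiftX (up₂ s) a b c + shiftY (up₁ s) a b c) + n × shiftZ s a b c

  private
    X-at : ∀ {s t} → s ≈³ t → ∀ a b c → (𝕏 *³ s) a b c ≈ shiftX t a b c
    X-at {s} e zero    b c = 𝕏-* s zero b c
    X-at {s} e (suc a) b c = trans (𝕏-* s (suc a) b c) (e a b c)

    Y-at : ∀ {s t} → s ≈³ t → ∀ a b c → (𝕐 *³ s) a b c ≈ shiftY t a b c
    Y-at {s} e a zero    c = 𝕐-* s a zero c
    Y-at {s} e a (suc b) c = trans (𝕐-* s a (suc b) c) (e a b c)

    Z-at : ∀ {s t} → s ≈³ t → ∀ a b c → (𝕫 *³ s) a b c ≈ shiftZ t a b c
    Z-at {s} e a b zero    = 𝕫-* s a b zero
    Z-at {s} e a b (suc c) = trans (𝕫-* s a b (suc c)) (e a b c)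

    ×-at : ∀ n (s : S³) {t : Carrier} a b c → s a b c ≈ t → (n ×³ s) a b c ≈ n × t
    ×-at n s a b c e = trans (Additive.×-homo (coefficient a b c) n s) (×-congʳ n e)

    regroup : ∀ {u l l′ B e u′ l₀ l₀′ e′} → u ≈ u′ → l ≈ l₀ → l′ ≈ l₀′ → e ≈ e′ →
      (u + l) + l′ ≈ B + e → u′ + (l₀ + l₀′) ≈ B + e′
    regroup uu ll ll′ ee eq = trans (sym (+-assoc _ _ _))
      (trans (+-cong (+-cong (sym uu) (sym ll)) (sym ll′)) (trans eq (+-congˡ ee)))

  recurrence₁ : ∀ n s B → Axis₁.P s S.+ n ×³ (𝕏 S.* s) S.≈ B S.+ 𝕏 S.* Axis₁.E s →
    ∀ a b c → up₁ s a b c + low₁ n s a b c ≈ B a b c + shiftX (weighted s) a b c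
  recurrence₁ n s B eq a b c = regroup (∂X-coefficient s a b c)
    (+-cong (Y-at {Derivation.δ ∂Z s} {up₃ s} (∂Z-coefficient s) a b c)
            (Z-at {Derivation.δ ∂Y s} {up₂ s} (∂Y-coefficient s) a b c))
    (×-at n (𝕏 *³ s) a b c (𝕏-* s a b c))
    (X-at {Axis₁.E s} {weighted s} (degree-× s) a b c)
    (eq a b c)

  recurrence₂ : ∀ n s B → Axis₂.P s S.+ n ×³ (𝕐 S.* s) S.≈ B S.+ 𝕐 S.* Axis₂.E s →
    ∀ a b c → up₂ s a b c + low₂ n s a b c ≈ B a b c + shiftY (weighted s) a b c
  recurrence₂ n s B eq a b c = regroup (∂Y-coefficient s a b c)
    (+-cong (X-at {Derivation.δ ∂Z s} {up₃ s} (∂Z-coefficient s) a b c)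
            (Z-at {Derivation.δ ∂X s} {up₁ s} (∂X-coefficient s) a b c))
    (×-at n (𝕐 *³ s) a b c (𝕐-* s a b c))
    (Y-at {Axis₂.E s} {weighted s} (λ a b c → trans (E₂≈E₁ s a b c) (degree-× s a b c)) a b c)
    (eq a b c)

  recurrence₃ : ∀ n s B → Axis₃.P s S.+ n ×³ (𝕫 S.* s) S.≈ B S.+ 𝕫 S.* Axis₃.E s →
    ∀ a b c → up₃ s a b c + low₃ n s a b c ≈ B a b c + shiftZ (weighted s) a b c
  recurrence₃ n s B eq a b c = regroup (∂Z-coefficient s a b c)
    (+-cong (X-at {Derivation.δ ∂Y s} {up₂ s} (∂Y-coefficient s) a b c)
            (Y-at {Derivation.δ ∂X s} {up₁ s} (∂X-coefficient s) a b c))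
    (×-at n (𝕫 *³ s) a b c (𝕫-* s a b c))
    (Z-at {Axis₃.E s} {weighted s} (λ a b c → trans (E₃≈E₁ s a b c) (degree-× s a b c)) a b c)
    (eq a b c)

  coordinates₁ : Coordinates semiring³ 𝕏 𝕐 𝕫 ∂X ∂Y ∂Z
  coordinates₁ = record
    { x1 = ∂X-free 1# 0 0 ; y1 = ∂Y-free 1# 0 0 ; z1 = ∂Z-free 1# 0 0
    ; xx = ∂X-linear 1# 0 0 ; yx = ∂Y-free 1# 1 0 ; zx = ∂Z-free 1# 1 0
    ; xy = ∂X-free 1# 1 0 ; yy = ∂Y-linear 1# 0 0 ; zy = ∂Z-free 1# 0 1
    ; xz = ∂X-free 1# 0 1 ; yz = ∂Y-free 1# 0 1 ; zz = ∂Z-linear 1# 0 0 }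

  open Coordinates coordinates₁

  coordinates₂ : Coordinates semiring³ 𝕐 𝕏 𝕫 ∂Y ∂X ∂Z
  coordinates₂ = record
    { x1 = y1 ; y1 = x1 ; z1 = z1 ; xx = yy ; yx = xy ; zx = zy
    ; xy = yx ; yy = xx ; zy = zx ; xz = yz ; yz = xz ; zz = zz }

  coordinates₃ : Coordinates semiring³ 𝕫 𝕏 𝕐 ∂Z ∂X ∂Y
  coordinates₃ = record
    { x1 = z1 ; y1 = x1 ; z1 = y1 ; xx = zz ; yx = xz ; zx = yz
    ; xy = zx ; yy = xx ; zy = yx ; xz = zy ; yz = xy ; zz = yy }

-- The lower-order part of the recurrences only involves coefficients of degree at most a + b + c.
module Compare {R R′ : CSemiring}
  (_~_ : CommutativeSemiring.Carrier R → CommutativeSemiring.Carrier R′ → Set)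
  (~-0 : CommutativeSemiring.0# R ~ CommutativeSemiring.0# R′)
  (+-related : ∀ p p′ q q′ → p ~ q → p′ ~ q′ →
    CommutativeSemiring._+_ R p p′ ~ CommutativeSemiring._+_ R′ q q′) where
  private
    module R = CommutativeSemiring R
    module R′ = CommutativeSemiring R′
    module S = Series3 R
    module S′ = Series3 R′
    module L = Recurrences R
    module L′ = Recurrences R′
    module ×R = MonoidMult R.+-commutativeMonoid
    module ×R′ = MonoidMult R′.+-commutativeMonoid

    ~-+ : ∀ {p p′ q q′} → p ~ q → p′ ~ q′ → (p R.+ p′) ~ (q R′.+ q′)
    ~-+ = +-related _ _ _ _

    ~-× : ∀ n {p q} → p ~ q → (n ×R.× p) ~ (n ×R′.× q)
    ~-× zero    pq = ~-0
    ~-× (suc n) pq = ~-+ pq (~-× n pq)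

  module _ {s : S.S³} {t : S′.S³} {d : ℕ} (low : ∀ a b c → a ℕ.+ b ℕ.+ c ℕ.≤ d → s a b c ~ t a b c) where
    private
      open ℕ-Solver using (solve; _:=_; _:+_; con)

      ≤-via : ∀ {m k} → m ≡ k → k ℕ.≤ d → m ℕ.≤ d
      ≤-via ≡.refl le = le

      ≤-pred : ∀ {m k} → suc m ≡ k → k ℕ.≤ d → m ℕ.≤ d
      ≤-pred ≡.refl le = ℕ.≤-trans (ℕ.n≤1+n _) le

    private
      exX : ∀ a b c → a ℕ.+ b ℕ.+ c ℕ.≤ d → S.shiftX s a b c ~ S′.shiftX t a b c
      exX zero    b c le = ~-0
      exX (suc a) b c le = low a b c (≤-pred ≡.refl le)

      exY : ∀ a b c → a ℕ.+ b ℕ.+ c ℕ.≤ d → S.shiftY s a b c ~ S′.shiftY t a b c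
      exY a zero    c le = ~-0
      exY a (suc b) c le = low a b c (≤-pred (≡.cong (ℕ._+ c) (≡.sym (ℕ.+-suc a b))) le)

      exZ : ∀ a b c → a ℕ.+ b ℕ.+ c ℕ.≤ d → S.shiftZ s a b c ~ S′.shiftZ t a b c
      exZ a b zero    le = ~-0
      exZ a b (suc c) le = low a b c (≤-pred (≡.sym (ℕ.+-suc (a ℕ.+ b) c)) le)

      Y3 : ∀ a b c → a ℕ.+ b ℕ.+ c ℕ.≤ d → S.shiftY (L.up₃ s) a b c ~ S′.shiftY (L′.up₃ t) a b c
      Y3 a zero    c le = ~-0
      Y3 a (suc b) c le = ~-× (suc c) (low a b (suc c) (≤-via
        (solve 3 (λ a b c → a :+ b :+ (con 1 :+ c) := a :+ (con 1 :+ b) :+ c) ≡.refl a b c) le))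

      Z2 : ∀ a b c → a ℕ.+ b ℕ.+ c ℕ.≤ d → S.shiftZ (L.up₂ s) a b c ~ S′.shiftZ (L′.up₂ t) a b c
      Z2 a b zero    le = ~-0
      Z2 a b (suc c) le = ~-× (suc b) (low a (suc b) c (≤-via
        (solve 3 (λ a b c → a :+ (con 1 :+ b) :+ c := a :+ b :+ (con 1 :+ c)) ≡.refl a b c) le))

      X3 : ∀ a b c → a ℕ.+ b ℕ.+ c ℕ.≤ d → S.shiftX (L.up₃ s) a b c ~ S′.shiftX (L′.up₃ t) a b c
      X3 zero    b c le = ~-0
      X3 (suc a) b c le = ~-× (suc c) (low a b (suc c) (≤-via (ℕ.+-suc (a ℕ.+ b) c) le))

      Z1 : ∀ a b c → a ℕ.+ b ℕ.+ c ℕ.≤ d → S.shiftZ (L.up₁ s) a b c ~ S′.shiftZ (L′.up₁ t) a b c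
      Z1 a b zero    le = ~-0
      Z1 a b (suc c) le = ~-× (suc a) (low (suc a) b c (≤-via (≡.sym (ℕ.+-suc (a ℕ.+ b) c)) le))

      X2 : ∀ a b c → a ℕ.+ b ℕ.+ c ℕ.≤ d → S.shiftX (L.up₂ s) a b c ~ S′.shiftX (L′.up₂ t) a b c
      X2 zero    b c le = ~-0
      X2 (suc a) b c le = ~-× (suc b) (low a (suc b) c (≤-via (≡.cong (ℕ._+ c) (ℕ.+-suc a b)) le))

      Y1 : ∀ a b c → a ℕ.+ b ℕ.+ c ℕ.≤ d → S.shiftY (L.up₁ s) a b c ~ S′.shiftY (L′.up₁ t) a b c
      Y1 a zero    c le = ~-0
      Y1 a (suc b) c le = ~-× (suc a) (low (suc a) b c
        (≤-via (≡.sym (≡.cong (ℕ._+ c) (ℕ.+-suc a b))) le))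

    -- Sums and natural multiples of coefficients are all that occurs, so an additive relation
    -- passes through. It is applied with two relations: vanishing at a monomial of too high degree,
    -- and evaluation of a polynomial to a given number.
    low₁~ : ∀ n a b c → a ℕ.+ b ℕ.+ c ℕ.≤ d → L.low₁ n s a b c ~ L′.low₁ n t a b c
    low₁~ n a b c le = ~-+ (~-+ (Y3 a b c le) (Z2 a b c le)) (~-× n (exX a b c le))

    low₂~ : ∀ n a b c → a ℕ.+ b ℕ.+ c ℕ.≤ d → L.low₂ n s a b c ~ L′.low₂ n t a b c
    low₂~ n a b c le = ~-+ (~-+ (X3 a b c le) (Z1 a b c le)) (~-× n (exY a b c le))

    low₃~ : ∀ n a b c → a ℕ.+ b ℕ.+ c ℕ.≤ d → L.low₃ n s a b c ~ L′.low₃ n t a b c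
    low₃~ n a b c le = ~-+ (~-+ (X2 a b c le) (Y1 a b c le)) (~-× n (exZ a b c le))

    shiftX~ : ∀ a b c → a ℕ.+ b ℕ.+ c ℕ.≤ d → S.shiftX (L.weighted s) a b c ~ S′.shiftX (L′.weighted t) a b c
    shiftX~ zero    b c le = ~-0
    shiftX~ (suc a) b c le = ~-× (a ℕ.+ b ℕ.+ c) (exX (suc a) b c le)

    shiftY~ : ∀ a b c → a ℕ.+ b ℕ.+ c ℕ.≤ d → S.shiftY (L.weighted s) a b c ~ S′.shiftY (L′.weighted t) a b c
    shiftY~ a zero    c le = ~-0
    shiftY~ a (suc b) c le = ~-× (a ℕ.+ b ℕ.+ c) (exY a (suc b) c le)

    shiftZ~ : ∀ a b c → a ℕ.+ b ℕ.+ c ℕ.≤ d → S.shiftZ (L.weighted s) a b c ~ S′.shiftZ (L′.weighted t) a b c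
    shiftZ~ a b zero    le = ~-0
    shiftZ~ a b (suc c) le = ~-× (a ℕ.+ b ℕ.+ c) (exZ a b (suc c) le)

-- The generating series of triples in given cells.

module TripleSeries (R : CSemiring) where
  open CommutativeSemiring R hiding (zero)
  open Series3 R
  open Recurrences R using (coordinates₁; coordinates₂; coordinates₃)
  private
    module S = CommutativeSemiring semiring³
    module N₁ = Neighbours semiring³ 𝕏 𝕐 𝕫 ∂X ∂Y ∂Z coordinates₁
    module N₂ = Neighbours semiring³ 𝕐 𝕏 𝕫 ∂Y ∂X ∂Z coordinates₂
    module N₃ = Neighbours semiring³ 𝕫 𝕏 𝕐 ∂Z ∂X ∂Y coordinates₃
  open CubeSums S.+-commutativeMonoid
  open TripleWeight semiring³
  open MonoidMult S.+-commutativeMonoid using () renaming (_×_ to _×³_)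

  tripleWeight : ∀ {n} → Vertex n → Vertex n → Vertex n → S³
  tripleWeight = ∏ N₁.ω

  private
    rotate₂ : ∀ a b c → N₂.ω b a c ≡ N₁.ω a b c
    rotate₂ false false false = ≡.refl
    rotate₂ false false true  = ≡.refl
    rotate₂ false true  false = ≡.refl
    rotate₂ false true  true  = ≡.refl
    rotate₂ true  false false = ≡.refl
    rotate₂ true  false true  = ≡.refl
    rotate₂ true  true  false = ≡.refl
    rotate₂ true  true  true  = ≡.refl

    rotate₃ : ∀ a b c → N₃.ω c a b ≡ N₁.ω a b c
    rotate₃ false false false = ≡.refl
    rotate₃ false false true  = ≡.refl
    rotate₃ false true  false = ≡.refl
    rotate₃ false true  true  = ≡.refl
    rotate₃ true  false false = ≡.refl
    rotate₃ true  false true  = ≡.refl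
    rotate₃ true  true  false = ≡.refl
    rotate₃ true  true  true  = ≡.refl

    move : ∀ {s t ν ν′ : S³} (L K : S³ → S³) → s ≡ t → ν S.≈ ν′ → L s S.≈ ν S.+ K s → L t S.≈ ν′ S.+ K t
    move L K ≡.refl νν h a b c = trans (h a b c) (+-congʳ (νν a b c))

    ≡⇒≈ : {s t : S³} → s ≡ t → s S.≈ t
    ≡⇒≈ ≡.refl a b c = refl

  neighbours₂ : ∀ {n} (v x y : Vertex n) →
    Axis₂.P (tripleWeight v x y) S.+ n ×³ (𝕐 S.* tripleWeight v x y) S.≈
    ∑-neighbours x (λ w → tripleWeight v w y) S.+ 𝕐 S.* Axis₂.E (tripleWeight v x y)
  neighbours₂ {n} v x y = move {∏ N₂.ω x v y} {tripleWeight v x y} {∑-neighbours x (λ w → ∏ N₂.ω w v y)}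
    {∑-neighbours x (λ w → tripleWeight v w y)}
    (λ s → Axis₂.P s S.+ n ×³ (𝕐 S.* s)) (λ s → 𝕐 S.* Axis₂.E s)
    (∏-rotate₂ rotate₂ v x y) (∑-neighbours-cong x (λ w → ≡⇒≈ (∏-rotate₂ rotate₂ v w y))) (N₂.neighbours x v y)

  neighbours₃ : ∀ {n} (v x y : Vertex n) →
    Axis₃.P (tripleWeight v x y) S.+ n ×³ (𝕫 S.* tripleWeight v x y) S.≈
    ∑-neighbours y (λ w → tripleWeight v x w) S.+ 𝕫 S.* Axis₃.E (tripleWeight v x y)
  neighbours₃ {n} v x y = move {∏ N₃.ω y v x} {tripleWeight v x y} {∑-neighbours y (λ w → ∏ N₃.ω w v x)}
    {∑-neighbours y (λ w → tripleWeight v x w)}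
    (λ s → Axis₃.P s S.+ n ×³ (𝕫 S.* s)) (λ s → 𝕫 S.* Axis₃.E s)
    (∏-rotate₃ rotate₃ v x y) (∑-neighbours-cong y (λ w → ≡⇒≈ (∏-rotate₃ rotate₃ v x w))) (N₃.neighbours y v x)

  module _ {n m : ℕ} (C : Vertex n → Fin m) where
    open Cells C
    open Sums S.+-commutativeMonoid using (∑)

    cellSeries : Fin m → Fin m → Fin m → S³
    cellSeries i j k = ∑-cell³ i j k tripleWeight

    module _ {S : Fin m → Fin m → ℕ} (eq : IsEquitable C S) (i j k : Fin m) where
      cellSeries₁ : Axis₁.P (cellSeries i j k) S.+ n ×³ (𝕏 S.* cellSeries i j k) S.≈
        ∑ (allFin m) (λ t → S t i ×³ cellSeries t j k) S.+ 𝕏 S.* Axis₁.E (cellSeries i j k)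
      cellSeries₁ = N₁.summed C i j k tripleWeight (λ w x y → ∑-neighbours w (λ v → tripleWeight v x y))
        {∑ (allFin m) (λ t → S t i ×³ cellSeries t j k)} N₁.neighbours (action₁ eq i j k tripleWeight)

      cellSeries₂ : Axis₂.P (cellSeries i j k) S.+ n ×³ (𝕐 S.* cellSeries i j k) S.≈
        ∑ (allFin m) (λ t → S t j ×³ cellSeries i t k) S.+ 𝕐 S.* Axis₂.E (cellSeries i j k)
      cellSeries₂ = N₂.summed C i j k tripleWeight (λ v w y → ∑-neighbours w (λ x → tripleWeight v x y))
        {∑ (allFin m) (λ t → S t j ×³ cellSeries i t k)} neighbours₂ (action₂ eq i j k tripleWeight)

      cellSeries₃ : Axis₃.P (cellSeries i j k) S.+ n ×³ (𝕫 S.* cellSeries i j k) S.≈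
        ∑ (allFin m) (λ t → S t k ×³ cellSeries i j t) S.+ 𝕫 S.* Axis₃.E (cellSeries i j k)
      cellSeries₃ = N₃.summed C i j k tripleWeight (λ v x w → ∑-neighbours w (λ y → tripleWeight v x y))
        {∑ (allFin m) (λ t → S t k ×³ cellSeries i j t)} neighbours₃ (action₃ eq i j k tripleWeight)

  private
    shiftX-mono : ∀ r a b c → shiftX (mono³ r a b c) ≈³ mono³ r (suc a) b c
    shiftX-mono r a b c zero    j k = refl
    shiftX-mono r a b c (suc i) j k = refl

    shiftY-mono : ∀ r a b c → shiftY (mono³ r a b c) ≈³ mono³ r a (suc b) c
    shiftY-mono r a b c i zero    k with a ℕ.≡ᵇ i
    ... | true  = refl
    ... | false = refl
    shiftY-mono r a b c i (suc j) k = refl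

    shiftZ-mono : ∀ r a b c → shiftZ (mono³ r a b c) ≈³ mono³ r a b (suc c)
    shiftZ-mono r a b c i j zero    with a ℕ.≡ᵇ i | b ℕ.≡ᵇ j
    ... | true  | true  = refl
    ... | true  | false = refl
    ... | false | _     = refl
    shiftZ-mono r a b c i j (suc k) = refl

  -- The three numbers count the coordinates at which v, x or y is the odd one out. Two vertices
  -- differ exactly where one of the two is odd, whence the distances.
  record Type {n} (v x y : Vertex n) : Set where
    constructor type
    field
      t₁ t₂ t₃ : ℕ
      monomial : tripleWeight v x y ≈³ mono³ 1# t₁ t₂ t₃
      dist-xy  : dist x y ≡ t₂ ℕ.+ t₃
      dist-vy  : dist v y ≡ t₁ ℕ.+ t₃
      dist-vx  : dist v x ≡ t₁ ℕ.+ t₂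

  private
    equal : ∀ {s : S³} {t₁ t₂ t₃} → s ≈³ mono³ 1# t₁ t₂ t₃ → S.1# *³ s ≈³ mono³ 1# t₁ t₂ t₃
    equal {s} e a b c = trans (S.*-identityˡ s a b c) (e a b c)

    oddX : ∀ {s : S³} {t₁ t₂ t₃} → s ≈³ mono³ 1# t₁ t₂ t₃ → 𝕏 *³ s ≈³ mono³ 1# (suc t₁) t₂ t₃
    oddX {s} {t₁} {t₂} {t₃} e a b c = trans (S.*-congˡ {𝕏} {s} {mono³ 1# t₁ t₂ t₃} e a b c)
      (trans (𝕏-* _ a b c) (shiftX-mono 1# t₁ t₂ t₃ a b c))

    oddY : ∀ {s : S³} {t₁ t₂ t₃} → s ≈³ mono³ 1# t₁ t₂ t₃ → 𝕐 *³ s ≈³ mono³ 1# t₁ (suc t₂) t₃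
    oddY {s} {t₁} {t₂} {t₃} e a b c = trans (S.*-congˡ {𝕐} {s} {mono³ 1# t₁ t₂ t₃} e a b c)
      (trans (𝕐-* _ a b c) (shiftY-mono 1# t₁ t₂ t₃ a b c))

    oddZ : ∀ {s : S³} {t₁ t₂ t₃} → s ≈³ mono³ 1# t₁ t₂ t₃ → 𝕫 *³ s ≈³ mono³ 1# t₁ t₂ (suc t₃)
    oddZ {s} {t₁} {t₂} {t₃} e a b c = trans (S.*-congˡ {𝕫} {s} {mono³ 1# t₁ t₂ t₃} e a b c)
      (trans (𝕫-* _ a b c) (shiftZ-mono 1# t₁ t₂ t₃ a b c))

    suc-+ : ∀ {d} m n → d ≡ m ℕ.+ n → suc d ≡ m ℕ.+ suc n
    suc-+ m n e = ≡.trans (≡.cong suc e) (≡.sym (ℕ.+-suc m n))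

  typeOf : ∀ {n} (v x y : Vertex n) → Type v x y
  typeOf []      []      []      = type 0 0 0 (S.refl {S.1#}) ≡.refl ≡.refl ≡.refl
  typeOf (a ∷ v) (b ∷ x) (c ∷ y) = extend a b c (typeOf v x y)
    where
    extend : ∀ a b c → Type v x y → Type (a ∷ v) (b ∷ x) (c ∷ y)
    extend false false false (type p q r e d₁ d₂ d₃) = type p q r (equal {tripleWeight v x y} {p} {q} {r} e) d₁ d₂ d₃
    extend true  true  true  (type p q r e d₁ d₂ d₃) = type p q r (equal {tripleWeight v x y} {p} {q} {r} e) d₁ d₂ d₃
    extend true  false false (type p q r e d₁ d₂ d₃) =
      type (suc p) q r (oddX {tripleWeight v x y} {p} {q} {r} e) d₁ (≡.cong suc d₂) (≡.cong suc d₃)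
    extend false true  true  (type p q r e d₁ d₂ d₃) =
      type (suc p) q r (oddX {tripleWeight v x y} {p} {q} {r} e) d₁ (≡.cong suc d₂) (≡.cong suc d₃)
    extend false true  false (type p q r e d₁ d₂ d₃) =
      type p (suc q) r (oddY {tripleWeight v x y} {p} {q} {r} e) (≡.cong suc d₁) d₂ (suc-+ p q d₃)
    extend true  false true  (type p q r e d₁ d₂ d₃) =
      type p (suc q) r (oddY {tripleWeight v x y} {p} {q} {r} e) (≡.cong suc d₁) d₂ (suc-+ p q d₃)
    extend false false true  (type p q r e d₁ d₂ d₃) =
      type p q (suc r) (oddZ {tripleWeight v x y} {p} {q} {r} e) (suc-+ q r d₁) (suc-+ p r d₂) d₃
    extend true  true  false (type p q r e d₁ d₂ d₃) =
      type p q (suc r) (oddZ {tripleWeight v x y} {p} {q} {r} e) (suc-+ q r d₁) (suc-+ p r d₂) d₃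

  -- The weight is a single monomial, and the distances determine its exponents: d(v,x) + d(v,y)
  -- counts the coordinates where v is odd twice and the others of d(x,y) once, so twice the first
  -- exponent is d(v,x) + d(v,y) - d(x,y).
  tripleWeight-coefficient : ∀ {n} (v x y : Vertex n) r₁ r₂ r₃ → tripleWeight v x y r₁ r₂ r₃ ≈
    (if (dist x y ℕ.≡ᵇ (r₂ ℕ.+ r₃)) ∧ (dist v y ℕ.≡ᵇ (r₁ ℕ.+ r₃)) ∧ (dist v x ℕ.≡ᵇ (r₁ ℕ.+ r₂)) then 1# else 0#)
  tripleWeight-coefficient v x y r₁ r₂ r₃ with typeOf v x y
  ... | type p q r e d₁ d₂ d₃ rewrite d₁ | d₂ | d₃ = trans (e r₁ r₂ r₃)
    (reflexive (≡.cong (λ b → if b then 1# else 0#) (T-ext to from)))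
    where
    T-ext : ∀ {b b′} → (T b → T b′) → (T b′ → T b) → b ≡ b′
    T-ext {false} {false} f g = ≡.refl
    T-ext {false} {true}  f g = ⊥-elim (g _)
    T-ext {true}  {false} f g = ⊥-elim (f _)
    T-ext {true}  {true}  f g = ≡.refl

    ∧³ : ∀ {b b′ b″} → T b → T b′ → T b″ → T (b ∧ b′ ∧ b″)
    ∧³ tb tb′ tb″ = Equivalence.from T-∧ (tb , Equivalence.from T-∧ (tb′ , tb″))

    to : T ((p ℕ.≡ᵇ r₁) ∧ (q ℕ.≡ᵇ r₂) ∧ (r ℕ.≡ᵇ r₃)) →
      T ((q ℕ.+ r ℕ.≡ᵇ r₂ ℕ.+ r₃) ∧ (p ℕ.+ r ℕ.≡ᵇ r₁ ℕ.+ r₃) ∧ (p ℕ.+ q ℕ.≡ᵇ r₁ ℕ.+ r₂))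
    to t with Equivalence.to T-∧ t
    ... | tp , t′ with Equivalence.to T-∧ t′
    ... | tq , tr with ℕ.≡ᵇ⇒≡ p r₁ tp | ℕ.≡ᵇ⇒≡ q r₂ tq | ℕ.≡ᵇ⇒≡ r r₃ tr
    ... | ≡.refl | ≡.refl | ≡.refl = ∧³ (ℕ.≡⇒≡ᵇ (q ℕ.+ r) _ ≡.refl) (ℕ.≡⇒≡ᵇ (p ℕ.+ r) _ ≡.refl)
      (ℕ.≡⇒≡ᵇ (p ℕ.+ q) _ ≡.refl)

    from : T ((q ℕ.+ r ℕ.≡ᵇ r₂ ℕ.+ r₃) ∧ (p ℕ.+ r ℕ.≡ᵇ r₁ ℕ.+ r₃) ∧ (p ℕ.+ q ℕ.≡ᵇ r₁ ℕ.+ r₂)) →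
      T ((p ℕ.≡ᵇ r₁) ∧ (q ℕ.≡ᵇ r₂) ∧ (r ℕ.≡ᵇ r₃))
    from t with Equivalence.to T-∧ t
    ... | tqr , t′ with Equivalence.to T-∧ t′
    ... | tpr , tpq = ∧³ (ℕ.≡⇒≡ᵇ p r₁ p≡) (ℕ.≡⇒≡ᵇ q r₂ q≡) (ℕ.≡⇒≡ᵇ r r₃ r≡)
      where
      open ≡.≡-Reasoning
      open ℕ-Solver using (solve; _:=_; _:+_; _:*_; con)
      qr = ℕ.≡ᵇ⇒≡ (q ℕ.+ r) _ tqr
      pr = ℕ.≡ᵇ⇒≡ (p ℕ.+ r) _ tpr
      pq = ℕ.≡ᵇ⇒≡ (p ℕ.+ q) _ tpq
      p≡ : p ≡ r₁
      p≡ = ℕ.*-cancelˡ-≡ p r₁ 2 (ℕ.+-cancelʳ-≡ (r₂ ℕ.+ r₃) (2 ℕ.* p) (2 ℕ.* r₁) (begin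
        2 ℕ.* p ℕ.+ (r₂ ℕ.+ r₃)           ≡⟨ ≡.cong (2 ℕ.* p ℕ.+_) qr ⟨
        2 ℕ.* p ℕ.+ (q ℕ.+ r)             ≡⟨ solve 3 (λ p q r → con 2 :* p :+ (q :+ r) := (p :+ r) :+ (p :+ q)) ≡.refl p q r ⟩
        (p ℕ.+ r) ℕ.+ (p ℕ.+ q)           ≡⟨ ≡.cong₂ ℕ._+_ pr pq ⟩
        (r₁ ℕ.+ r₃) ℕ.+ (r₁ ℕ.+ r₂)       ≡⟨ solve 3 (λ p q r → (p :+ r) :+ (p :+ q) := con 2 :* p :+ (q :+ r)) ≡.refl r₁ r₂ r₃ ⟩
        2 ℕ.* r₁ ℕ.+ (r₂ ℕ.+ r₃)          ∎))
      q≡ : q ≡ r₂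
      q≡ = ℕ.+-cancelˡ-≡ p q r₂ (≡.trans pq (≡.cong (ℕ._+ r₂) (≡.sym p≡)))
      r≡ : r ≡ r₃
      r≡ = ℕ.+-cancelˡ-≡ p r r₃ (≡.trans pr (≡.cong (ℕ._+ r₃) (≡.sym p≡)))

-- Truncated evaluation as a pairing.

-- The pairing of coefficients up to degree N in each variable, through which evalOp is defined.
module Pairing (R : CSemiring) (N : ℕ) where
  open CommutativeSemiring R hiding (zero)
  open Series3 R
  open Sums +-commutativeMonoid
  open MonoidMult +-commutativeMonoid using (_×_)
  private
    module S = CommutativeSemiring semiring³
  open MonoidMult S.+-commutativeMonoid using () renaming (_×_ to _×³_)

  ∑³ : S³ → Carrier
  ∑³ f = sumTo _+_ 0# N λ a → sumTo _+_ 0# N λ b → sumTo _+_ 0# N λ c → f a b c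

  ∑³-cong : ∀ {f g : S³} → f ≈³ g → ∑³ f ≈ ∑³ g
  ∑³-cong e = sumTo-cong N (λ a → sumTo-cong N (λ b → sumTo-cong N (e a b)))

  private
    sumTo-0 : ∀ {f : ℕ → Carrier} → (∀ a → f a ≈ 0#) → sumTo _+_ 0# N f ≈ 0#
    sumTo-0 e = trans (sumTo-cong N e) (∑-ε (upTo (suc N)))

    sumTo²-0 : ∀ {f : ℕ → ℕ → Carrier} → (∀ a b → f a b ≈ 0#) →
      (sumTo _+_ 0# N λ a → sumTo _+_ 0# N λ b → f a b) ≈ 0#
    sumTo²-0 e = sumTo-0 (λ a → sumTo-0 (e a))

  ⟪_,_⟫ : S³ → S³ → Carrier
  ⟪ p , w ⟫ = ∑³ (λ a b c → p a b c * w a b c)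

  pairˡ : S³ → S.+-commutativeMonoid →⁺ +-commutativeMonoid
  pairˡ w = record
    { ⟦_⟧ = λ p → ⟪ p , w ⟫
    ; cong = λ e → ∑³-cong (λ a b c → *-congʳ (e a b c))
    ; ∙-homo = λ p q → trans (∑³-cong (λ a b c → distribʳ _ _ _))
        (sumTo³-∙ N (λ a b c → p a b c * w a b c) (λ a b c → q a b c * w a b c))
    ; ε-homo = sumTo-0 (λ a → sumTo²-0 (λ b c → zeroˡ _)) }

  pairʳ : S³ → S.+-commutativeMonoid →⁺ +-commutativeMonoid
  pairʳ p = record
    { ⟦_⟧ = λ w → ⟪ p , w ⟫
    ; cong = λ e → ∑³-cong (λ a b c → *-congˡ (e a b c))
    ; ∙-homo = λ v w → trans (∑³-cong (λ a b c → distribˡ _ _ _))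
        (sumTo³-∙ N (λ a b c → p a b c * v a b c) (λ a b c → p a b c * w a b c))
    ; ε-homo = sumTo-0 (λ a → sumTo²-0 (λ b c → zeroʳ _)) }

  pair-∑ : ∀ {m} p {v : S³} (s : Fin m → ℕ) (w : Fin m → S³) →
    (∀ a b c → v a b c ≈ ∑ (allFin m) (λ t → s t × w t a b c)) →
    ⟪ p , v ⟫ ≈ ∑ (allFin m) (λ t → s t × ⟪ p , w t ⟫)
  pair-∑ {m} p s w v≈ = trans
    (∑³-cong (λ a b c → *-congˡ (trans (v≈ a b c) (sym (trans
      (Additive.∑-homo (coefficient a b c) {f = λ t → s t ×³ w t} (allFin m))
      (∑-cong (allFin m) (λ t → Additive.×-homo (coefficient a b c) (s t) (w t))))))))
    (trans (Additive.∑-homo (pairʳ p) {f = λ t → s t ×³ w t} (allFin m))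
      (∑-cong (allFin m) (λ t → Additive.×-homo (pairʳ p) (s t) (w t))))

  pair-1 : ∀ w → ⟪ mono³ 1# 0 0 0 , w ⟫ ≈ w 0 0 0
  pair-1 w = trans (sumTo-head N (λ a → sumTo²-0 (λ b c → zeroˡ _)))
    (trans (sumTo-head N (λ b → sumTo-0 (λ c → zeroˡ _)))
    (trans (sumTo-head N (λ c → zeroˡ _)) (*-identityˡ _)))

  module _ {d : ℕ} (d<N : d ℕ.< N) (p : S³) (deg : ∀ a b c → d ℕ.< a ℕ.+ b ℕ.+ c → p a b c ≈ 0#) (w : S³) where
    private
      vanish : ∀ a b c {x} → N ℕ.≤ a ℕ.+ b ℕ.+ c → p a b c * x ≈ 0#
      vanish a b c N≤ = trans (*-congʳ (deg a b c (ℕ.<-≤-trans d<N N≤))) (zeroˡ _)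

    -- Multiplication by the variable pushes the coefficients with exponent N past the cutoff. As
    -- the degree d is strictly below N, they are zero and nothing is lost.
    pair-shiftX : ⟪ shiftX p , w ⟫ ≈ ⟪ p , (λ a b c → w (suc a) b c) ⟫
    pair-shiftX = sumTo-shift N (sumTo²-0 (λ b c → zeroˡ _)) (λ a → refl)
      (sumTo²-0 (λ b c → vanish N b c (ℕ.≤-trans (ℕ.m≤m+n N b) (ℕ.m≤m+n (N ℕ.+ b) c))))

    pair-shiftY : ⟪ shiftY p , w ⟫ ≈ ⟪ p , (λ a b c → w a (suc b) c) ⟫
    pair-shiftY = sumTo-cong N (λ a → sumTo-shift N (sumTo-0 (λ c → zeroˡ _)) (λ b → refl)
      (sumTo-0 (λ c → vanish a N c (ℕ.≤-trans (ℕ.m≤n+m N a) (ℕ.m≤m+n (a ℕ.+ N) c)))))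

    pair-shiftZ : ⟪ shiftZ p , w ⟫ ≈ ⟪ p , (λ a b c → w a b (suc c)) ⟫
    pair-shiftZ = sumTo-cong N (λ a → sumTo-cong N (λ b → sumTo-shift N (zeroˡ _) (λ c → refl)
      (vanish a b N (ℕ.m≤n+m N (a ℕ.+ b)))))

-- The numbers of triples as coefficients.

ℚ⁺ : CommutativeMonoid 0ℓ 0ℓ
ℚ⁺ = CommutativeSemiring.+-commutativeMonoid ℚ-semiring

open Sums ℚ⁺ using (∑; ∑-cong; ∑-swap)

toℚ⁺ : ℕ.+-0-commutativeMonoid →⁺ ℚ⁺
toℚ⁺ = record { ⟦_⟧ = toℚ ; cong = ≡.cong toℚ ; ∙-homo = toℚ-+ ; ε-homo = ≡.refl }

toℚ-count : {I : Set} (p : I → Bool) (xs : List I) →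
  toℚ (count p xs) ≡ ∑ xs (λ x → if p x then 1ℚ else 0ℚ)
toℚ-count p xs = ≡.trans (≡.sym (≡.trans (×ℚ≡toℚ* (count p xs) 1ℚ) (ℚ.*-identityʳ _)))
  (CubeSums.count-× ℚ⁺ p xs 1ℚ)

module _ {n m : ℕ} (C : Vertex n → Fin m) where
  open TripleSeries ℚ-semiring
  private
    V : List (Vertex n)
    V = allVertices n
    module Q = CubeSums.Cells ℚ⁺ C
  open CubeSums ℚ⁺ using (∑-if; if-cong)

  -- The cell tests in the conjunction become nested cell sums, and the remaining distance test is a
  -- coefficient of the triple weight. One series per triple of cells thus contains the counts for
  -- all r₁, r₂, r₃.
  toℚ-Tcount : ∀ r₁ r₂ r₃ i j k → toℚ (Tcount r₁ r₂ r₃ C i j k) ≡ cellSeries C i j k r₁ r₂ r₃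
  toℚ-Tcount r₁ r₂ r₃ i j k = begin
    toℚ (Tcount r₁ r₂ r₃ C i j k)
      ≡⟨ Additive.∑-homo toℚ⁺ V ⟩
    _ ≡⟨ ∑-cong V (λ v → ≡.trans (Additive.∑-homo toℚ⁺ V) (≡.trans
           (∑-cong V (λ x → ≡.trans (toℚ-count _ V) (inner v x)))
           (∑-if V ⌊ C v ≟ᶠ i ⌋ _))) ⟩
    Q.∑-cell³ i j k (λ v x y → if D v x y then 1ℚ else 0ℚ)
      ≡⟨ Q.∑-cell³-cong i j k (λ v x y → tripleWeight-coefficient v x y r₁ r₂ r₃) ⟨
    Q.∑-cell³ i j k (λ v x y → tripleWeight v x y r₁ r₂ r₃)
      ≡⟨ CellHomo.∑-cell³-homo (ℚ³.coefficient r₁ r₂ r₃) C i j k tripleWeight ⟨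
    cellSeries C i j k r₁ r₂ r₃ ∎
    where
    open ≡.≡-Reasoning
    D : Vertex n → Vertex n → Vertex n → Bool
    D v x y = (dist x y ℕ.≡ᵇ (r₂ ℕ.+ r₃)) ∧ (dist v y ℕ.≡ᵇ (r₁ ℕ.+ r₃)) ∧ (dist v x ℕ.≡ᵇ (r₁ ℕ.+ r₂))

    if-∧ : ∀ b b′ → (if b ∧ b′ then 1ℚ else 0ℚ) ≡ (if b then (if b′ then 1ℚ else 0ℚ) else 0ℚ)
    if-∧ true  b′ = ≡.refl
    if-∧ false b′ = ≡.refl

    inner : ∀ v x →
      ∑ V (λ y → if ⌊ C v ≟ᶠ i ⌋ ∧ ⌊ C x ≟ᶠ j ⌋ ∧ ⌊ C y ≟ᶠ k ⌋ ∧ D v x y then 1ℚ else 0ℚ) ≡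
      (if ⌊ C v ≟ᶠ i ⌋ then (if ⌊ C x ≟ᶠ j ⌋ then
        ∑ V (λ y → if ⌊ C y ≟ᶠ k ⌋ then (if D v x y then 1ℚ else 0ℚ) else 0ℚ) else 0ℚ) else 0ℚ)
    inner v x = begin
      ∑ V (λ y → if ⌊ C v ≟ᶠ i ⌋ ∧ ⌊ C x ≟ᶠ j ⌋ ∧ ⌊ C y ≟ᶠ k ⌋ ∧ D v x y then 1ℚ else 0ℚ)
        ≡⟨ ∑-cong V (λ y → ≡.trans (if-∧ ⌊ C v ≟ᶠ i ⌋ _) (if-cong ⌊ C v ≟ᶠ i ⌋
             (≡.trans (if-∧ ⌊ C x ≟ᶠ j ⌋ _) (if-cong ⌊ C x ≟ᶠ j ⌋ (if-∧ ⌊ C y ≟ᶠ k ⌋ (D v x y)))))) ⟩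
      ∑ V (λ y → if ⌊ C v ≟ᶠ i ⌋ then (if ⌊ C x ≟ᶠ j ⌋ then
        (if ⌊ C y ≟ᶠ k ⌋ then (if D v x y then 1ℚ else 0ℚ) else 0ℚ) else 0ℚ) else 0ℚ)
        ≡⟨ ∑-if V ⌊ C v ≟ᶠ i ⌋ _ ⟩
      (if ⌊ C v ≟ᶠ i ⌋ then ∑ V (λ y → if ⌊ C x ≟ᶠ j ⌋ then
        (if ⌊ C y ≟ᶠ k ⌋ then (if D v x y then 1ℚ else 0ℚ) else 0ℚ) else 0ℚ) else 0ℚ)
        ≡⟨ if-cong ⌊ C v ≟ᶠ i ⌋ (∑-if V ⌊ C x ≟ᶠ j ⌋ _) ⟩
      _ ∎

-- The recurrences for f and for the counts side by side.

open Poly³ using (module Axis₁; module Axis₂; module Axis₃; C)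

-- f is kept abstract because comparing types would otherwise unfold fSeries n.
module CoefficientRecurrences (n : ℕ) (f : Ser)
  (solves₁ : Axis₁.Solves (C (monₚ 1ℚ 1 0 0)) (C (constₚ (toℚ n))) f)
  (solves₂ : Axis₂.Solves (C (monₚ 1ℚ 0 1 0)) (C (constₚ (toℚ n))) f)
  (solves₃ : Axis₃.Solves (C (monₚ 1ℚ 0 0 1)) (C (constₚ (toℚ n))) f) where
  private
    module F = Recurrences Poly-semiring
    module Q = Recurrences ℚ-semiring
  open MonoidMult Ser.+-commutativeMonoid using () renaming (_×_ to _×ₛ_)

  private
    -- `Solves` carries the total exponent as a constant series, the recurrences as a natural
    -- multiple; only the latter makes sense for both coefficient semirings at once.
    N-* : ∀ t → C (constₚ (toℚ n)) Ser.* t Ser.≈ n ×ₛ t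
    N-* t a b c i j k = ≡.trans (Poly³.mono³-const (constₚ (toℚ n)) t a b c i j k)
      (≡.trans (constₚ-* (toℚ n) (t a b c) i j k)
      (≡.trans (≡.sym (×ℚ≡toℚ* n (t a b c i j k)))
      (≡.trans (≡.sym (×ₚ-coefficient n (t a b c) i j k))
        (≡.sym (Additive.×-homo (Poly³.coefficient a b c) n t i j k)))))

    scaled : ∀ {Pf Xf B XEf : Ser} → Pf Ser.+ C (constₚ (toℚ n)) Ser.* Xf Ser.≈ B Ser.+ XEf →
      Pf Ser.+ n ×ₛ Xf Ser.≈ B Ser.+ XEf
    scaled {Pf} {Xf} eq a b c i j k =
      ≡.trans (≡.cong (Pf a b c i j k ℚ.+_) (≡.sym (N-* Xf a b c i j k))) (eq a b c i j k)

  f-recurrence₁ : ∀ a b c → F.up₁ f a b c Poly.+ F.low₁ n f a b c Poly.≈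
    ℚ³.shiftX (f a b c) Poly.+ Poly³.shiftX (F.weighted f) a b c
  f-recurrence₁ a b c i j k = ≡.trans
    (F.recurrence₁ n f (C (monₚ 1ℚ 1 0 0) Ser.* f)
      (scaled {Axis₁.P f} {Poly³.𝕏 Ser.* f} {C (monₚ 1ℚ 1 0 0) Ser.* f} {Poly³.𝕏 Ser.* Axis₁.E f}
        (Axis₁.Solves.equation solves₁)) a b c i j k)
    (≡.cong (ℚ._+ Poly³.shiftX (F.weighted f) a b c i j k)
      (≡.trans (Poly³.mono³-const (monₚ 1ℚ 1 0 0) f a b c i j k) (ℚ³.𝕏-* (f a b c) i j k)))

  f-recurrence₂ : ∀ a b c → F.up₂ f a b c Poly.+ F.low₂ n f a b c Poly.≈
    ℚ³.shiftY (f a b c) Poly.+ Poly³.shiftY (F.weighted f) a b c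
  f-recurrence₂ a b c i j k = ≡.trans
    (F.recurrence₂ n f (C (monₚ 1ℚ 0 1 0) Ser.* f)
      (scaled {Axis₂.P f} {Poly³.𝕐 Ser.* f} {C (monₚ 1ℚ 0 1 0) Ser.* f} {Poly³.𝕐 Ser.* Axis₂.E f}
        (Axis₂.Solves.equation solves₂)) a b c i j k)
    (≡.cong (ℚ._+ Poly³.shiftY (F.weighted f) a b c i j k)
      (≡.trans (Poly³.mono³-const (monₚ 1ℚ 0 1 0) f a b c i j k) (ℚ³.𝕐-* (f a b c) i j k)))

  f-recurrence₃ : ∀ a b c → F.up₃ f a b c Poly.+ F.low₃ n f a b c Poly.≈
    ℚ³.shiftZ (f a b c) Poly.+ Poly³.shiftZ (F.weighted f) a b c
  f-recurrence₃ a b c i j k = ≡.trans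
    (F.recurrence₃ n f (C (monₚ 1ℚ 0 0 1) Ser.* f)
      (scaled {Axis₃.P f} {Poly³.𝕫 Ser.* f} {C (monₚ 1ℚ 0 0 1) Ser.* f} {Poly³.𝕫 Ser.* Axis₃.E f}
        (Axis₃.Solves.equation solves₃)) a b c i j k)
    (≡.cong (ℚ._+ Poly³.shiftZ (F.weighted f) a b c i j k)
      (≡.trans (Poly³.mono³-const (monₚ 1ℚ 0 0 1) f a b c i j k) (ℚ³.𝕫-* (f a b c) i j k)))

  module _ {m : ℕ} (D : Vertex n → Fin m) {S : Fin m → Fin m → ℕ} (eq : IsEquitable D S) (i j k : Fin m) where
    open TripleSeries ℚ-semiring
    private
      𝒯 : Fin m → Fin m → Fin m → Poly3
      𝒯 = cellSeries D

      action-coefficient : (s : Fin m → ℕ) (U : Fin m → Poly3) → ∀ a b c →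
        Sums.∑ Poly.+-commutativeMonoid (allFin m) (λ t → s t ×ₚ U t) a b c ≡
        ∑ (allFin m) (λ t → s t ×ℚ U t a b c)
      action-coefficient s U a b c = ≡.trans (Additive.∑-homo (ℚ³.coefficient a b c) (allFin m))
        (∑-cong (allFin m) (λ t → ×ₚ-coefficient (s t) (U t) a b c))

    T-recurrence₁ : ∀ a b c → Q.up₁ (𝒯 i j k) a b c ℚ.+ Q.low₁ n (𝒯 i j k) a b c ≡
      ∑ (allFin m) (λ t → S t i ×ℚ 𝒯 t j k a b c) ℚ.+ ℚ³.shiftX (Q.weighted (𝒯 i j k)) a b c
    T-recurrence₁ a b c = ≡.trans (Q.recurrence₁ n (𝒯 i j k) (Sums.∑ Poly.+-commutativeMonoid (allFin m) (λ t → S t i ×ₚ 𝒯 t j k))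
      (cellSeries₁ D eq i j k) a b c)
      (≡.cong (ℚ._+ ℚ³.shiftX (Q.weighted (𝒯 i j k)) a b c) (action-coefficient (λ t → S t i) (λ t → 𝒯 t j k) a b c))

    T-recurrence₂ : ∀ a b c → Q.up₂ (𝒯 i j k) a b c ℚ.+ Q.low₂ n (𝒯 i j k) a b c ≡
      ∑ (allFin m) (λ t → S t j ×ℚ 𝒯 i t k a b c) ℚ.+ ℚ³.shiftY (Q.weighted (𝒯 i j k)) a b c
    T-recurrence₂ a b c = ≡.trans (Q.recurrence₂ n (𝒯 i j k) (Sums.∑ Poly.+-commutativeMonoid (allFin m) (λ t → S t j ×ₚ 𝒯 i t k))
      (cellSeries₂ D eq i j k) a b c)
      (≡.cong (ℚ._+ ℚ³.shiftY (Q.weighted (𝒯 i j k)) a b c) (action-coefficient (λ t → S t j) (λ t → 𝒯 i t k) a b c))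

    T-recurrence₃ : ∀ a b c → Q.up₃ (𝒯 i j k) a b c ℚ.+ Q.low₃ n (𝒯 i j k) a b c ≡
      ∑ (allFin m) (λ t → S t k ×ℚ 𝒯 i j t a b c) ℚ.+ ℚ³.shiftZ (Q.weighted (𝒯 i j k)) a b c
    T-recurrence₃ a b c = ≡.trans (Q.recurrence₃ n (𝒯 i j k) (Sums.∑ Poly.+-commutativeMonoid (allFin m) (λ t → S t k ×ₚ 𝒯 i j t))
      (cellSeries₃ D eq i j k) a b c)
      (≡.cong (ℚ._+ ℚ³.shiftZ (Q.weighted (𝒯 i j k)) a b c) (action-coefficient (λ t → S t k) (λ t → 𝒯 i j t) a b c))

×ℚ-cancel : ∀ k {p q} → suc k ×ℚ p ≡ suc k ×ℚ q → p ≡ q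
×ℚ-cancel k {p} {q} eq = ≡.trans (≡.sym (undo p)) (≡.trans (≡.cong (r ℚ.*_) eq) (undo q))
  where
  open ≡.≡-Reasoning
  -- The factor 1 in the denominator fits `toℚ*1/` at m = 1, whose right-hand side is then `1ℚ`.
  r : ℚ
  r = + 1 / (suc k ℕ.* 1)
  undo : ∀ p → r ℚ.* (suc k ×ℚ p) ≡ p
  undo p = begin
    r ℚ.* (suc k ×ℚ p)         ≡⟨ ≡.cong (r ℚ.*_) (×ℚ≡toℚ* (suc k) p) ⟩
    r ℚ.* (toℚ (suc k) ℚ.* p)  ≡⟨ ℚ.*-assoc r (toℚ (suc k)) p ⟨
    r ℚ.* toℚ (suc k) ℚ.* p    ≡⟨ ≡.cong (ℚ._* p) (≡.trans (ℚ.*-comm r (toℚ (suc k))) (toℚ*1/ k 1)) ⟩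
    1ℚ ℚ.* p                   ≡⟨ ℚ.*-identityˡ p ⟩
    p                          ∎

-- Polynomials in the three commuting actions of the quotient matrix.

module Actions {m : ℕ} (S : Fin m → Fin m → ℕ) where
  private
    I : List (Fin m)
    I = allFin m

    _≐_ : Vec3 m → Vec3 m → Set
    U ≐ V = ∀ i j k → U i j k ≡ V i j k

    open MonoidMult ℚ⁺ using (×-assocˡ)

    *-toℚ : ∀ q n → q ℚ.* toℚ n ≡ n ×ℚ q
    *-toℚ q n = ≡.trans (ℚ.*-comm q (toℚ n)) (≡.sym (×ℚ≡toℚ* n q))

    multiply : ℕ → ℚ⁺ →⁺ ℚ⁺
    multiply n = record
      { ⟦_⟧ = n ×ℚ_ ; cong = ≡.cong (n ×ℚ_)
      ; ∙-homo = λ p q → MonoidMult.×-distrib-+ ℚ⁺ p q n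
      ; ε-homo = ≡.trans (×ℚ≡toℚ* n 0ℚ) (ℚ.*-zeroʳ (toℚ n)) }

    -- All three commutation rules are instances: p and q are columns of S contracted with two
    -- different indices of one array, whose third index stays fixed.
    interchange : (p q : Fin m → ℕ) (V : Fin m → Fin m → ℚ) →
      ∑ I (λ t → p t ×ℚ ∑ I (λ s → q s ×ℚ V t s)) ≡ ∑ I (λ s → q s ×ℚ ∑ I (λ t → p t ×ℚ V t s))
    interchange p q V = begin
      ∑ I (λ t → p t ×ℚ ∑ I (λ s → q s ×ℚ V t s))
        ≡⟨ ∑-cong I (λ t → Additive.∑-homo (multiply (p t)) I) ⟩
      ∑ I (λ t → ∑ I (λ s → p t ×ℚ (q s ×ℚ V t s)))
        ≡⟨ ∑-swap I I ⟩
      ∑ I (λ s → ∑ I (λ t → p t ×ℚ (q s ×ℚ V t s)))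
        ≡⟨ ∑-cong I (λ s → ∑-cong I (λ t → ≡.trans (×-assocˡ (V t s) (p t) (q s))
             (≡.trans (≡.cong (_×ℚ V t s) (ℕ.*-comm (p t) (q s))) (≡.sym (×-assocˡ (V t s) (q s) (p t)))))) ⟩
      ∑ I (λ s → ∑ I (λ t → q s ×ℚ (p t ×ℚ V t s)))
        ≡⟨ ∑-cong I (λ s → Additive.∑-homo (multiply (q s)) I) ⟨
      ∑ I (λ s → q s ×ℚ ∑ I (λ t → p t ×ℚ V t s)) ∎
      where open ≡.≡-Reasoning

  act₁≡ : ∀ U i j k → act₁ S U i j k ≡ ∑ I (λ t → S t i ×ℚ U t j k)
  act₁≡ U i j k = ∑-cong I (λ t → *-toℚ (U t j k) (S t i))

  act₂≡ : ∀ U i j k → act₂ S U i j k ≡ ∑ I (λ t → S t j ×ℚ U i t k)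
  act₂≡ U i j k = ∑-cong I (λ t → *-toℚ (U i t k) (S t j))

  act₃≡ : ∀ U i j k → act₃ S U i j k ≡ ∑ I (λ t → S t k ×ℚ U i j t)
  act₃≡ U i j k = ∑-cong I (λ t → *-toℚ (U i j t) (S t k))

  private
    act₁-cong : ∀ {U V} → U ≐ V → act₁ S U ≐ act₁ S V
    act₁-cong e i j k = ∑-cong I (λ t → ≡.cong (ℚ._* toℚ (S t i)) (e t j k))

    act₂-cong : ∀ {U V} → U ≐ V → act₂ S U ≐ act₂ S V
    act₂-cong e i j k = ∑-cong I (λ t → ≡.cong (ℚ._* toℚ (S t j)) (e i t k))

    ×∑-cong : (p : Fin m → ℕ) {f g : Fin m → ℚ} → (∀ t → f t ≡ g t) →
      ∑ I (λ t → p t ×ℚ f t) ≡ ∑ I (λ t → p t ×ℚ g t)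
    ×∑-cong p e = ∑-cong I (λ t → ≡.cong (p t ×ℚ_) (e t))

    act₁-act₂ : ∀ U → act₁ S (act₂ S U) ≐ act₂ S (act₁ S U)
    act₁-act₂ U i j k = ≡.trans (≡.trans (act₁≡ (act₂ S U) i j k) (×∑-cong (λ t → S t i) (λ t → act₂≡ U t j k)))
      (≡.trans (interchange (λ t → S t i) (λ s → S s j) (λ t s → U t s k))
      (≡.sym (≡.trans (act₂≡ (act₁ S U) i j k) (×∑-cong (λ t → S t j) (λ s → act₁≡ U i s k)))))

    act₁-act₃ : ∀ U → act₁ S (act₃ S U) ≐ act₃ S (act₁ S U)
    act₁-act₃ U i j k = ≡.trans (≡.trans (act₁≡ (act₃ S U) i j k) (×∑-cong (λ t → S t i) (λ t → act₃≡ U t j k)))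
      (≡.trans (interchange (λ t → S t i) (λ s → S s k) (λ t s → U t j s))
      (≡.sym (≡.trans (act₃≡ (act₁ S U) i j k) (×∑-cong (λ t → S t k) (λ s → act₁≡ U i j s)))))

    act₂-act₃ : ∀ U → act₂ S (act₃ S U) ≐ act₃ S (act₂ S U)
    act₂-act₃ U i j k = ≡.trans (≡.trans (act₂≡ (act₃ S U) i j k) (×∑-cong (λ t → S t j) (λ t → act₃≡ U i t k)))
      (≡.trans (interchange (λ t → S t j) (λ s → S s k) (λ t s → U i t s))
      (≡.sym (≡.trans (act₃≡ (act₂ S U) i j k) (×∑-cong (λ t → S t k) (λ s → act₂≡ U i j s)))))

    iter-cong : (f : Vec3 m → Vec3 m) → (∀ {U V} → U ≐ V → f U ≐ f V) → ∀ a {U V} → U ≐ V → iter f a U ≐ iter f a V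
    iter-cong f f-cong zero    e = e
    iter-cong f f-cong (suc a) e = f-cong (iter-cong f f-cong a e)

    iter-commute : (f g : Vec3 m → Vec3 m) → (∀ {U V} → U ≐ V → f U ≐ f V) → (∀ U → f (g U) ≐ g (f U)) →
      ∀ a U → iter f a (g U) ≐ g (iter f a U)
    iter-commute f g f-cong fg zero    U i j k = ≡.refl
    iter-commute f g f-cong fg (suc a) U i j k =
      ≡.trans (f-cong (iter-commute f g f-cong fg a U) i j k) (fg (iter f a U) i j k)

  module _ (U : Vec3 m) where
    monomialAction : ℕ → ℕ → ℕ → Vec3 m
    monomialAction a b c = iter (act₁ S) a (iter (act₂ S) b (iter (act₃ S) c U))

    -- `evalOp` applies the first action outermost, so one more power of x is definitional. A
    -- further factor from the second or third action has to be moved out past the iterates that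
    -- enclose it.
    monomialAction₂ : ∀ a b c → monomialAction a (suc b) c ≐ act₂ S (monomialAction a b c)
    monomialAction₂ a b c = iter-commute (act₁ S) (act₂ S) (λ {U} {V} → act₁-cong {U} {V}) act₁-act₂ a (iter (act₂ S) b (iter (act₃ S) c U))

    monomialAction₃ : ∀ a b c → monomialAction a b (suc c) ≐ act₃ S (monomialAction a b c)
    monomialAction₃ a b c i j k = ≡.trans
      (iter-cong (act₁ S) (λ {U} {V} → act₁-cong {U} {V}) a
        (iter-commute (act₂ S) (act₃ S) (λ {U} {V} → act₂-cong {U} {V}) act₂-act₃ b (iter (act₃ S) c U)) i j k)
      (iter-commute (act₁ S) (act₃ S) (λ {U} {V} → act₁-cong {U} {V}) act₁-act₃ a (iter (act₂ S) b (iter (act₃ S) c U)) i j k)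

    module Evaluate (N : ℕ) where
      open Pairing ℚ-semiring N

      eval : Fin m → Fin m → Fin m → Poly3 → ℚ
      eval i j k p = evalOp S p N U i j k

      eval⁺ : Fin m → Fin m → Fin m →
        Poly.+-commutativeMonoid →⁺ ℚ⁺
      eval⁺ i j k = pairˡ (λ a b c → monomialAction a b c i j k)

      eval-1 : ∀ i j k → eval i j k (constₚ 1ℚ) ≡ U i j k
      eval-1 i j k = pair-1 (λ a b c → monomialAction a b c i j k)

      module _ {d : ℕ} (d<N : d ℕ.< N) (p : Poly3) (deg : DegreeAtMost d p) (i j k : Fin m) where
        private
          w : Fin m → Fin m → Fin m → Poly3
          w i j k a b c = monomialAction a b c i j k

        eval-shiftX : eval i j k (ℚ³.shiftX p) ≡ ∑ I (λ t → S t i ×ℚ eval t j k p)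
        eval-shiftX = ≡.trans (pair-shiftX d<N p deg (w i j k)) 
          (pair-∑ p {λ a b c → w i j k (suc a) b c} (λ t → S t i) (λ t → w t j k)
            (λ a b c → act₁≡ (monomialAction a b c) i j k))

        eval-shiftY : eval i j k (ℚ³.shiftY p) ≡ ∑ I (λ t → S t j ×ℚ eval i t k p)
        eval-shiftY = ≡.trans (pair-shiftY d<N p deg (w i j k)) 
          (pair-∑ p {λ a b c → w i j k a (suc b) c} (λ t → S t j) (λ t → w i t k)
            (λ a b c → ≡.trans (monomialAction₂ a b c i j k) (act₂≡ (monomialAction a b c) i j k)))

        eval-shiftZ : eval i j k (ℚ³.shiftZ p) ≡ ∑ I (λ t → S t k ×ℚ eval i j t p)
        eval-shiftZ = ≡.trans (pair-shiftZ d<N p deg (w i j k)) 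
          (pair-∑ p {λ a b c → w i j k a b (suc c)} (λ t → S t k) (λ t → w i j t)
            (λ a b c → ≡.trans (monomialAction₃ a b c i j k) (act₃≡ (monomialAction a b c) i j k)))

-- Induction on the total degree.

degree-induction : (Q : ℕ → ℕ → ℕ → Set) → Q 0 0 0 →
  (∀ a b c → (∀ a′ b′ c′ → a′ ℕ.+ b′ ℕ.+ c′ ℕ.≤ a ℕ.+ b ℕ.+ c → Q a′ b′ c′) → Q (suc a) b c) →
  (∀ a b c → (∀ a′ b′ c′ → a′ ℕ.+ b′ ℕ.+ c′ ℕ.≤ a ℕ.+ b ℕ.+ c → Q a′ b′ c′) → Q a (suc b) c) →
  (∀ a b c → (∀ a′ b′ c′ → a′ ℕ.+ b′ ℕ.+ c′ ℕ.≤ a ℕ.+ b ℕ.+ c → Q a′ b′ c′) → Q a b (suc c)) →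
  ∀ a b c → Q a b c
degree-induction Q start stepX stepY stepZ a b c = go (a ℕ.+ b ℕ.+ c) a b c ℕ.≤-refl
  where
  -- The recursion is on a bound for the total degree, not on one index: the terms Y∂_Z and Z∂_Y
  -- trade degree between the indices, so a step needs every index triple of the same total degree
  -- as its predecessor.
  go : ∀ d a b c → a ℕ.+ b ℕ.+ c ℕ.≤ d → Q a b c
  go d       zero    zero    zero    le = start
  go (suc d) zero    zero    (suc c) le =
    stepZ 0 0 c (λ a′ b′ c′ le′ → go d a′ b′ c′ (ℕ.≤-trans le′ (ℕ.s≤s⁻¹ le)))
  go (suc d) zero    (suc b) c       le =
    stepY 0 b c (λ a′ b′ c′ le′ → go d a′ b′ c′ (ℕ.≤-trans le′ (ℕ.s≤s⁻¹ le)))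
  go (suc d) (suc a) b       c       le =
    stepX a b c (λ a′ b′ c′ le′ → go d a′ b′ c′ (ℕ.≤-trans le′ (ℕ.s≤s⁻¹ le)))

-- Cancelling `l` and dividing by k + 1 leaves the top coefficient determined by the lower ones.
-- With zeros as the second solution this also serves to prove vanishing.
recurrence-unique : ∀ k {x y l l′ A A′ e e′} → suc k ×ℚ x ℚ.+ l ≡ A ℚ.+ e → suc k ×ℚ y ℚ.+ l′ ≡ A′ ℚ.+ e′ →
  l ≡ l′ → A ≡ A′ → e ≡ e′ → x ≡ y
recurrence-unique k {l = l} eq eq′ ≡.refl ≡.refl ≡.refl =
  ×ℚ-cancel k (∙-cancelʳ ℚ.+-0-group l _ _ (≡.trans eq (≡.sym eq′)))

module Solution (n : ℕ) (f : Ser)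
  (solves₁ : Axis₁.Solves (C (monₚ 1ℚ 1 0 0)) (C (constₚ (toℚ n))) f)
  (solves₂ : Axis₂.Solves (C (monₚ 1ℚ 0 1 0)) (C (constₚ (toℚ n))) f)
  (solves₃ : Axis₃.Solves (C (monₚ 1ℚ 0 0 1)) (C (constₚ (toℚ n))) f)
  (f-000 : f 0 0 0 Poly.≈ constₚ 1ℚ) where
  open CoefficientRecurrences n f solves₁ solves₂ solves₃

  -- Each step raises the total degree of the index by one and involves a single multiplication by
  -- x, y or z; the other terms of the recurrence have degree at most a + b + c by induction.
  f-degree : ∀ a b c → DegreeAtMost (a ℕ.+ b ℕ.+ c) (f a b c)
  f-degree = degree-induction (λ a b c → DegreeAtMost (a ℕ.+ b ℕ.+ c) (f a b c)) start stepX stepY stepZ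
    where
    start : DegreeAtMost 0 (f 0 0 0)
    start i j k lt = ≡.trans (f-000 i j k) (const-degree i j k lt)
      where
      const-degree : DegreeAtMost 0 (constₚ 1ℚ)
      const-degree zero    zero    (suc k) lt = ≡.refl
      const-degree zero    (suc j) k       lt = ≡.refl
      const-degree (suc i) j       k       lt = ≡.refl

    Vanishes : ℕ → ℕ → ℕ → Poly3 → Poly3 → Set
    Vanishes i j k p _ = p i j k ≡ 0ℚ

    Vanishes-+ : ∀ i j k p p′ q q′ → Vanishes i j k p q → Vanishes i j k p′ q′ →
      Vanishes i j k (p Poly.+ p′) (q Poly.+ q′)
    Vanishes-+ i j k _ _ _ _ p≡0 p′≡0 = ≡.cong₂ ℚ._+_ p≡0 p′≡0

    module At (i j k : ℕ) = Compare {Poly-semiring} {Poly-semiring} (Vanishes i j k) ≡.refl (Vanishes-+ i j k)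

    IH : ℕ → ℕ → ℕ → Set
    IH a b c = ∀ a′ b′ c′ → a′ ℕ.+ b′ ℕ.+ c′ ℕ.≤ a ℕ.+ b ℕ.+ c → DegreeAtMost (a′ ℕ.+ b′ ℕ.+ c′) (f a′ b′ c′)

    module Step (a b c : ℕ) (ih : IH a b c) (i j k : ℕ) (lt : suc (a ℕ.+ b ℕ.+ c) ℕ.< i ℕ.+ j ℕ.+ k) where
      low : ∀ a′ b′ c′ → a′ ℕ.+ b′ ℕ.+ c′ ℕ.≤ a ℕ.+ b ℕ.+ c → f a′ b′ c′ i j k ≡ 0ℚ
      low a′ b′ c′ le = ih a′ b′ c′ le i j k (ℕ.≤-<-trans le (ℕ.<-trans (ℕ.n<1+n _) lt))

      vanish : ∀ r {p l s e} → (suc r ×ₚ p) i j k ℚ.+ l ≡ s ℚ.+ e → l ≡ 0ℚ → s ≡ 0ℚ → e ≡ 0ℚ → p i j k ≡ 0ℚ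
      vanish r {p} eq l≡0 s≡0 e≡0 = recurrence-unique r
        (≡.trans (≡.cong (ℚ._+ _) (≡.sym (×ₚ-coefficient (suc r) p i j k))) eq)
        (≡.cong (ℚ._+ 0ℚ) (≡.trans (×ℚ≡toℚ* (suc r) 0ℚ) (ℚ.*-zeroʳ (toℚ (suc r))))) l≡0 s≡0 e≡0

    stepX : ∀ a b c → IH a b c → DegreeAtMost (suc a ℕ.+ b ℕ.+ c) (f (suc a) b c)
    stepX a b c ih i j k lt = vanish a {f (suc a) b c} (f-recurrence₁ a b c i j k)
      (At.low₁~ i j k {f} {f} low n a b c ℕ.≤-refl) (shifted i lt) (At.shiftX~ i j k {f} {f} low a b c ℕ.≤-refl)
      where
      open Step a b c ih i j k lt
      shifted : ∀ i → suc (a ℕ.+ b ℕ.+ c) ℕ.< i ℕ.+ j ℕ.+ k → ℚ³.shiftX (f a b c) i j k ≡ 0ℚ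
      shifted zero    lt = ≡.refl
      shifted (suc i) lt = ih a b c ℕ.≤-refl i j k (ℕ.s<s⁻¹ lt)

    stepY : ∀ a b c → IH a b c → DegreeAtMost (a ℕ.+ suc b ℕ.+ c) (f a (suc b) c)
    stepY a b c ih i j k lt = vanish b {f a (suc b) c} (f-recurrence₂ a b c i j k)
      (At.low₂~ i j k {f} {f} low n a b c ℕ.≤-refl) (shifted j lt′) (At.shiftY~ i j k {f} {f} low a b c ℕ.≤-refl)
      where
      lt′ : suc (a ℕ.+ b ℕ.+ c) ℕ.< i ℕ.+ j ℕ.+ k
      lt′ = ≡.subst (ℕ._< i ℕ.+ j ℕ.+ k) (≡.cong (ℕ._+ c) (ℕ.+-suc a b)) lt
      open Step a b c ih i j k lt′
      shifted : ∀ j → suc (a ℕ.+ b ℕ.+ c) ℕ.< i ℕ.+ j ℕ.+ k → ℚ³.shiftY (f a b c) i j k ≡ 0ℚ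
      shifted zero    lt = ≡.refl
      shifted (suc j) lt = ih a b c ℕ.≤-refl i j k
        (ℕ.s<s⁻¹ (≡.subst (suc (a ℕ.+ b ℕ.+ c) ℕ.<_) (≡.cong (ℕ._+ k) (ℕ.+-suc i j)) lt))

    stepZ : ∀ a b c → IH a b c → DegreeAtMost (a ℕ.+ b ℕ.+ suc c) (f a b (suc c))
    stepZ a b c ih i j k lt = vanish c {f a b (suc c)} (f-recurrence₃ a b c i j k)
      (At.low₃~ i j k {f} {f} low n a b c ℕ.≤-refl) (shifted k lt′) (At.shiftZ~ i j k {f} {f} low a b c ℕ.≤-refl)
      where
      lt′ : suc (a ℕ.+ b ℕ.+ c) ℕ.< i ℕ.+ j ℕ.+ k
      lt′ = ≡.subst (ℕ._< i ℕ.+ j ℕ.+ k) (ℕ.+-suc (a ℕ.+ b) c) lt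
      open Step a b c ih i j k lt′
      shifted : ∀ k → suc (a ℕ.+ b ℕ.+ c) ℕ.< i ℕ.+ j ℕ.+ k → ℚ³.shiftZ (f a b c) i j k ≡ 0ℚ
      shifted zero    lt = ≡.refl
      shifted (suc k) lt = ih a b c ℕ.≤-refl i j k
        (ℕ.s<s⁻¹ (≡.subst (suc (a ℕ.+ b ℕ.+ c) ℕ.<_) (ℕ.+-suc (i ℕ.+ j) k) lt))

  module _ {m : ℕ} (D : Vertex n → Fin m) {S : Fin m → Fin m → ℕ} (eq : IsEquitable D S) (N : ℕ) where
    private
      U : Vec3 m
      U i j k = toℚ (Tcount 0 0 0 D i j k)

      𝒯 : Fin m → Fin m → Fin m → Poly3
      𝒯 = TripleSeries.cellSeries ℚ-semiring D

    open Actions.Evaluate S U N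

    -- The cutoff N is the same for all intermediate polynomials, so that their evaluations can be
    -- combined. At an incremented index the bound by N says that the predecessor has degree
    -- strictly below N, as `eval-shiftX` and its analogues require.
    eval-f : ∀ a b c → a ℕ.+ b ℕ.+ c ℕ.≤ N → ∀ i j k → eval i j k (f a b c) ≡ 𝒯 i j k a b c
    eval-f = degree-induction Q start stepX stepY stepZ
      where
      Q : ℕ → ℕ → ℕ → Set
      Q a b c = a ℕ.+ b ℕ.+ c ℕ.≤ N → ∀ i j k → eval i j k (f a b c) ≡ 𝒯 i j k a b c

      start : Q 0 0 0
      start _ i j k = ≡.trans (_→⁺_.cong (eval⁺ i j k) {f 0 0 0} {constₚ 1ℚ} f-000)
        (≡.trans (eval-1 i j k) (toℚ-Tcount D 0 0 0 i j k))

      EvalsTo : Fin m → Fin m → Fin m → Poly3 → ℚ → Set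
      EvalsTo i j k p q = eval i j k p ≡ q

      EvalsTo-+ : ∀ i j k p p′ q q′ → EvalsTo i j k p q → EvalsTo i j k p′ q′ →
        EvalsTo i j k (p Poly.+ p′) (q ℚ.+ q′)
      EvalsTo-+ i j k p p′ _ _ e e′ = ≡.trans (_→⁺_.∙-homo (eval⁺ i j k) p p′) (≡.cong₂ ℚ._+_ e e′)

      module At (i j k : Fin m) = Compare {Poly-semiring} {ℚ-semiring} (EvalsTo i j k)
        (_→⁺_.ε-homo (eval⁺ i j k)) (EvalsTo-+ i j k)

      IH : ℕ → ℕ → ℕ → Set
      IH a b c = ∀ a′ b′ c′ → a′ ℕ.+ b′ ℕ.+ c′ ℕ.≤ a ℕ.+ b ℕ.+ c → Q a′ b′ c′

      module Step (a b c : ℕ) (ih : IH a b c) (d<N : a ℕ.+ b ℕ.+ c ℕ.< N) (i j k : Fin m) where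
        -- Stated for all cells, because the action of the quotient matrix replaces one of i, j, k
        -- by every cell t.
        known : ∀ a′ b′ c′ → a′ ℕ.+ b′ ℕ.+ c′ ℕ.≤ a ℕ.+ b ℕ.+ c → ∀ i j k →
          eval i j k (f a′ b′ c′) ≡ 𝒯 i j k a′ b′ c′
        known a′ b′ c′ le = ih a′ b′ c′ le (ℕ.≤-trans le (ℕ.<⇒≤ d<N))

        low : ∀ a′ b′ c′ → a′ ℕ.+ b′ ℕ.+ c′ ℕ.≤ a ℕ.+ b ℕ.+ c → eval i j k (f a′ b′ c′) ≡ 𝒯 i j k a′ b′ c′
        low a′ b′ c′ le = known a′ b′ c′ le i j k

        here : ∀ i j k → eval i j k (f a b c) ≡ 𝒯 i j k a b c
        here = known a b c ℕ.≤-refl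

        evaluated : ∀ r {p l s e : Poly3} → suc r ×ₚ p Poly.+ l Poly.≈ s Poly.+ e →
          suc r ×ℚ eval i j k p ℚ.+ eval i j k l ≡ eval i j k s ℚ.+ eval i j k e
        evaluated r {p} {l} {s} {e} h = ≡.trans
          (≡.cong (ℚ._+ eval i j k l) (≡.sym (Additive.×-homo (eval⁺ i j k) (suc r) p)))
          (≡.trans (≡.sym (_→⁺_.∙-homo (eval⁺ i j k) (suc r ×ₚ p) l))
          (≡.trans (_→⁺_.cong (eval⁺ i j k) {suc r ×ₚ p Poly.+ l} {s Poly.+ e} h)
            (_→⁺_.∙-homo (eval⁺ i j k) s e)))

        fill : (s : Fin m → ℕ) {x y : Fin m → ℚ} → (∀ t → x t ≡ y t) →
          ∑ (allFin m) (λ t → s t ×ℚ x t) ≡ ∑ (allFin m) (λ t → s t ×ℚ y t)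
        fill s e = ∑-cong (allFin m) (λ t → ≡.cong (s t ×ℚ_) (e t))

      module F = Recurrences Poly-semiring

      stepX : ∀ a b c → IH a b c → Q (suc a) b c
      stepX a b c ih d<N i j k = recurrence-unique a
        (evaluated a {f (suc a) b c} {F.low₁ n f a b c} {ℚ³.shiftX (f a b c)} {Poly³.shiftX (F.weighted f) a b c}
          (f-recurrence₁ a b c))
        (T-recurrence₁ D eq i j k a b c)
        (At.low₁~ i j k {f} {𝒯 i j k} low n a b c ℕ.≤-refl)
        (≡.trans (eval-shiftX d<N (f a b c) (f-degree a b c) i j k) (fill (λ t → S t i) (λ t → here t j k)))
        (At.shiftX~ i j k {f} {𝒯 i j k} low a b c ℕ.≤-refl)
        where open Step a b c ih d<N i j k

      stepY : ∀ a b c → IH a b c → Q a (suc b) c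
      stepY a b c ih le i j k = recurrence-unique b
        (evaluated b {f a (suc b) c} {F.low₂ n f a b c} {ℚ³.shiftY (f a b c)} {Poly³.shiftY (F.weighted f) a b c}
          (f-recurrence₂ a b c))
        (T-recurrence₂ D eq i j k a b c)
        (At.low₂~ i j k {f} {𝒯 i j k} low n a b c ℕ.≤-refl)
        (≡.trans (eval-shiftY d<N (f a b c) (f-degree a b c) i j k) (fill (λ t → S t j) (λ t → here i t k)))
        (At.shiftY~ i j k {f} {𝒯 i j k} low a b c ℕ.≤-refl)
        where
        d<N : a ℕ.+ b ℕ.+ c ℕ.< N
        d<N = ≡.subst (ℕ._≤ N) (≡.cong (ℕ._+ c) (ℕ.+-suc a b)) le
        open Step a b c ih d<N i j k

      stepZ : ∀ a b c → IH a b c → Q a b (suc c)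
      stepZ a b c ih le i j k = recurrence-unique c
        (evaluated c {f a b (suc c)} {F.low₃ n f a b c} {ℚ³.shiftZ (f a b c)} {Poly³.shiftZ (F.weighted f) a b c}
          (f-recurrence₃ a b c))
        (T-recurrence₃ D eq i j k a b c)
        (At.low₃~ i j k {f} {𝒯 i j k} low n a b c ℕ.≤-refl)
        (≡.trans (eval-shiftZ d<N (f a b c) (f-degree a b c) i j k) (fill (λ t → S t k) (λ t → here i j t)))
        (At.shiftZ~ i j k {f} {𝒯 i j k} low a b c ℕ.≤-refl)
        where
        d<N : a ℕ.+ b ℕ.+ c ℕ.< N
        d<N = ≡.subst (ℕ._≤ N) (ℕ.+-suc (a ℕ.+ b) c) le
        open Step a b c ih d<N i j k

  isP : ∀ r₁ r₂ r₃ → IsP n r₁ r₂ r₃ (f r₁ r₂ r₃)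
  isP r₁ r₂ r₃ = f-degree r₁ r₂ r₃ , λ m D _ S eq i j k →
    ≡.trans (toℚ-Tcount D r₁ r₂ r₃ i j k)
      (≡.sym (eval-f D eq (r₁ ℕ.+ r₂ ℕ.+ r₃) r₁ r₂ r₃ ℕ.≤-refl i j k))

open import Data.Nat using (_+_; _≤_)

theorem3 : ∀ (n r₁ r₂ r₃ : ℕ) → r₁ + r₂ + r₃ ≤ n →
    IsP n r₁ r₂ r₃ (fSeries n r₁ r₂ r₃)
theorem3 n r₁ r₂ r₃ _ = Solution.isP n (fSeries n)
  (fSeries-solves₁ n) (fSeries-solves₂ n) (fSeries-solves₃ n) (fSeries-000 n) r₁ r₂ r₃
  where open Generating
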